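{- Let $m\ge2$ be an integer and $G$ a matrix over $\mathrm{GF}(2)$ of rank $r$ with column set $E$. For $k=0,\dots,2m+1$ let $\mathcal{T}_m(k,2m+2)$ be the set of $(m+1)$-tuples $(f_1,\dots,f_{m+1})$ of functions $f_j:E\to\mathrm{GF}(2)$ such that $f_j-f_{j+1}$ lies in the row space of $G$ over $\mathrm{GF}(2)$ for $j=1,\dots,m$, and $\sum_{j=1}^{m+1}|\mathrm{supp}(f_j)|\equiv k\pmod{2m+2}$. Then $$\sum_{k=0}^{2m+1}e^{k\pi i/(m+1)}|\mathcal{T}_m(k,2m+2)|\ne0 \quad\text{if and only if}\quad \chi(M(G);2^m)\ne0.$$
   Context: $i=\sqrt{ -1}$; $\mathrm{supp}(f)=\{e: f(e)\ne0\}$. $M(G)$ is the matroid on $E$ of linear dependence of the columns of $G$, with rank function $\mathrm{rk}$ and rank $r$; $\chi(M;\lambda)=\sum_{B\subseteq E}(-1)^{|B|}\lambda^{r-\mathrm{rk}(B)}$ is its characteristic polynomial. -}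

module Defs where

open import Data.Bool using (Bool; true; false; _∧_; _∨_; _xor_; not; if_then_else_)
open import Data.Nat using (ℕ; zero; suc; _∸_; _⊔_; _≤_; _<_) renaming (_+_ to _+ℕ_; _*_ to _*ℕ_)
open import Data.Nat.DivMod using (_%_)
open import Data.Fin using (Fin; zero; suc)
open import Data.List using (List; []; _∷_; _++_; concatMap; length; filter; foldr; map)
open import Data.Vec using (Vec; []; _∷_; lookup)
open import Data.Integer using (ℤ; +_; -_) renaming (_+_ to _+ℤ_; _*_ to _*ℤ_)
open import Relation.Binary.PropositionalEquality using (_≡_)
open import Relation.Nullary using (¬_)
open import Data.Sum using (_⊎_)
open import Data.Product using (Σ)
open import Algebra.Bundles using (CommutativeRing)
import Algebra.Bundles
open import Level using (Level)

-- GF(2) is modelled by Bool: addition = _xor_, multiplication = _∧_.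
-- Vectors in GF(2)^n (equivalently functions E → GF(2) with E = Fin n)
-- are functions Fin n → Bool.  Subsets of E are also Fin n → Bool.

⊕-sum : ∀ {n} → (Fin n → Bool) → Bool
⊕-sum {zero}  _ = false
⊕-sum {suc n} f = f zero xor ⊕-sum (λ i → f (suc i))

count : ∀ {n} → (Fin n → Bool) → ℕ
count {zero}  _ = 0
count {suc n} f = (if f zero then 1 else 0) +ℕ count (λ i → f (suc i))

allᵇ : ∀ {n} → (Fin n → Bool) → Bool
allᵇ {zero}  _ = true
allᵇ {suc n} f = f zero ∧ allᵇ (λ i → f (suc i))

anyL : ∀ {A : Set} → (A → Bool) → List A → Bool
anyL p []       = false
anyL p (x ∷ xs) = p x ∨ anyL p xs

allL : ∀ {A : Set} → (A → Bool) → List A → Bool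
allL p []       = true
allL p (x ∷ xs) = p x ∧ allL p xs

maxL : List ℕ → ℕ
maxL = foldr _⊔_ 0

_==_ : Bool → Bool → Bool
a == b = not (a xor b)

cons : ∀ {n} → Bool → (Fin n → Bool) → (Fin (suc n) → Bool)
cons b f zero    = b
cons b f (suc i) = f i

allFuns : (n : ℕ) → List (Fin n → Bool)
allFuns zero    = (λ ()) ∷ []
allFuns (suc n) = concatMap (λ f → cons false f ∷ cons true f ∷ []) (allFuns n)

Matrix : ℕ → ℕ → Set
Matrix p n = Fin p → Fin n → Bool

rowComb : ∀ {p n} → Matrix p n → (Fin p → Bool) → (Fin n → Bool)
rowComb G x e = ⊕-sum (λ i → x i ∧ G i e)

inRowSpaceᵇ : ∀ {p n} → Matrix p n → (Fin n → Bool) → Bool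
inRowSpaceᵇ {p} {n} G v =
  anyL (λ x → allᵇ (λ e → v e == rowComb G x e)) (allFuns p)

colSum : ∀ {p n} → Matrix p n → (Fin n → Bool) → (Fin p → Bool)
colSum G T i = ⊕-sum (λ e → T e ∧ G i e)

⊆ᵇ : ∀ {n} → (Fin n → Bool) → (Fin n → Bool) → Bool
⊆ᵇ S B = allᵇ (λ e → not (S e) ∨ B e)

independentᵇ : ∀ {p n} → Matrix p n → (Fin n → Bool) → Bool
independentᵇ {p} {n} G S =
  allL (λ T → not (⊆ᵇ T S) ∨ (count T Data.Nat.≡ᵇ 0)
               ∨ not (allᵇ (λ i → not (colSum G T i))))
       (allFuns n)

rk : ∀ {p n} → Matrix p n → (Fin n → Bool) → ℕ
rk {p} {n} G B =
  maxL (map count (filter (λ S → Data.Bool._≟_ (⊆ᵇ S B ∧ independentᵇ G S) true)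
                          (allFuns n)))

rank : ∀ {p n} → Matrix p n → ℕ
rank G = rk G (λ _ → true)

_^ℤ_ : ℤ → ℕ → ℤ
x ^ℤ zero  = + 1
x ^ℤ suc k = x *ℤ (x ^ℤ k)

sign : ℕ → ℤ
sign k = (- (+ 1)) ^ℤ k

χ : ∀ {p n} → Matrix p n → ℤ → ℤ
χ {p} {n} G λ′ =
  foldr _+ℤ_ (+ 0)
    (map (λ B → sign (count B) *ℤ (λ′ ^ℤ (rank G ∸ rk G B))) (allFuns n))

allTuples : (n l : ℕ) → List (Vec (Fin n → Bool) l)
allTuples n zero    = [] ∷ []
allTuples n (suc l) = concatMap (λ f → map (f ∷_) (allTuples n l)) (allFuns n)

consecutiveᵇ : ∀ {p n l} → Matrix p n → Vec (Fin n → Bool) l → Bool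
consecutiveᵇ G []               = true
consecutiveᵇ G (f ∷ [])         = true
consecutiveᵇ G (f ∷ g ∷ fs)     =
  inRowSpaceᵇ G (λ e → f e xor g e) ∧ consecutiveᵇ G (g ∷ fs)

totalSupp : ∀ {n l} → Vec (Fin n → Bool) l → ℕ
totalSupp []       = 0
totalSupp (f ∷ fs) = count f +ℕ totalSupp fs

inTᵇ : ∀ {p n} → (m : ℕ) → Matrix p n → ℕ → Vec (Fin n → Bool) (suc m) → Bool
inTᵇ m G k t = consecutiveᵇ G t ∧
  (totalSupp t % suc (suc (2 *ℕ m)) Data.Nat.≡ᵇ k % suc (suc (2 *ℕ m)))

Tcard : ∀ {p n} → (m : ℕ) → Matrix p n → ℕ → ℕ
Tcard {p} {n} m G k =
  length (filter (λ t → Data.Bool._≟_ (inTᵇ m G k t) true) (allTuples n (suc m)))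

-- Ring-side notions (the complex number e^{πi/(m+1)} is replaced by a
-- primitive (2m+2)-th root of unity ζ in an integral domain of
-- characteristic 0).

module _ {c ℓ : Level} (R : CommutativeRing c ℓ) where
  open CommutativeRing R
  open import Algebra.Definitions.RawSemiring (Algebra.Bundles.Semiring.rawSemiring semiring) using (_×_; _^_)

  IsIntegralDomain : Set (c Level.⊔ ℓ)
  IsIntegralDomain = ∀ x y → (x * y) ≈ 0# → (x ≈ 0#) ⊎ (y ≈ 0#)

  CharZero : Set ℓ
  CharZero = ∀ (k : ℕ) → (k × 1#) ≈ 0# → k ≡ 0

  IsPrimitiveRoot : ℕ → Carrier → Set ℓ
  IsPrimitiveRoot N ζ = Σ ((ζ ^ N) ≈ 1#) (λ _ → ∀ j → 0 < j → j < N → ¬ ((ζ ^ j) ≈ 1#))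

  rootSum : (N : ℕ) → Carrier → (ℕ → ℕ) → Carrier
  rootSum zero    ζ a = 0#
  rootSum (suc N) ζ a = rootSum N ζ a + ((ζ ^ N) * (a N × 1#))

{-# OPTIONS --safe #-}

-- Put h = m + 1 and s(v) = ζ^v + ζ^(h−v) = ζ^v − ζ^(−v).  Writing a tuple as f₁ together with
-- its differences d₁, …, d_m in the row space C and summing over f₁ first turns the root sum
-- into Σ_d Π_e s(w_e(d)), where 0 ≤ w_e(d) ≤ m and w_e(d) = 0 exactly when all the d_j vanish
-- at e.  As s(0) = 0, only the d ∈ C^m covering E contribute, and by the critical theorem
-- their number is χ(M(G); 2^m).  So it remains to see that a nonempty sum of products of the
-- s(v), 1 ≤ v ≤ m, cannot vanish at ζ.
--
-- Over ℂ with ζ = e^(πi/h) this holds since s(v)/2i = sin(πv/h) > 0; here ζ is an arbitrary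
-- primitive root.  The quantum integers [w] = s(w)/s(1) satisfy truncated Clebsch–Gordan
-- rules, so such a sum is, up to a power of s(1), a nonempty sum of terms s(v), 1 ≤ v ≤ m.
-- If it vanishes at ζ then, by Landau's proof of the irreducibility of cyclotomic
-- polynomials, it vanishes at ζ^j for all j prime to 2h; multiplied by [1][2]⋯[m] it
-- vanishes at ζ^j for all odd j, and is still a nonempty sum of terms s(v).  Fourier
-- inversion over the odd j then contradicts characteristic 0.

module Submission where

open import Defs
open import Data.Bool using (Bool; true; false; _∧_; _∨_; _xor_; not; if_then_else_)
import Data.Bool as Bool
import Data.Bool.Properties as Bool
open import Data.Empty using (⊥-elim)
open import Data.Fin using (Fin; zero; suc; toℕ; fromℕ; inject₁)
import Data.Fin.Properties as Fin
open import Data.Integer as ℤ using (ℤ; +_; -[1+_]; ∣_∣) renaming (_+_ to _+ℤ_; _*_ to _*ℤ_; -_ to -ℤ_)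
import Data.Integer.Properties as ℤ
open import Data.List using (List; []; _∷_; _++_; concatMap; downFrom; filter; foldr; length; map)
open import Data.List.Membership.Propositional using (_∈_)
open import Data.List.Membership.Propositional.Properties using (∈-filter⁺; ∈-filter⁻; ∈-map⁺; ∈-map⁻; ∈-++⁺ˡ; ∈-++⁺ʳ; ∈-++⁻)
open import Data.List.Relation.Unary.All using (All; []; _∷_)
import Data.List.Relation.Unary.All.Properties as All
open import Data.List.Relation.Unary.Any using (here; there)
open import Data.Maybe using (Maybe; just; nothing)
open import Data.Nat as ℕ using (ℕ; zero; suc; _≤_; _<_; z≤n; s≤s; _⊔_; NonZero)
open import Data.Nat.Combinatorics using (_C_; nCn≡1; nC1≡n; nCk+nC[k+1]≡[n+1]C[k+1]; k>n⇒nCk≡0)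
open import Data.Nat.Coprimality using (Coprime; coprime?)
open import Data.Nat.Divisibility using (_∣_; divides; ∣⇒≤; >⇒∤; _∣?_; m∣m*n; n∣m*n; ∣m⇒∣m*n; ∣n⇒∣m*n; ∣m+n∣m⇒∣n; ∣1⇒≡1)
open import Data.Nat.DivMod using (_%_; _/_; m≡m%n+[m/n]*n; m%n<n; m<n⇒m%n≡m)
open import Data.Nat.GCD using (gcd; gcd[m,n]∣m; gcd[m,n]∣n; gcd-greatest)
open import Data.Nat.ListAction using (product)
open import Data.Nat.Primality using (Prime; euclidsLemma; prime⇒irreducible; irreducible[2]; ¬prime[0]; ¬prime[1])
open import Data.Nat.Primality.Factorisation using (PrimeFactorisation; factorise)
import Data.Nat.Properties as ℕ
open import Data.Nat.Tactic.RingSolver using (solve-∀)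
open import Data.Product using (∃; _,_; proj₁; proj₂) renaming (_×_ to _∧′_)
open import Data.Sum using (_⊎_; inj₁; inj₂; [_,_]′)
open import Data.Vec using (Vec; []; _∷_)
open import Function using (_∘_; _⟨_⟩_; _⇔_; mk⇔)
open import Relation.Binary.Definitions using (tri<; tri≈; tri>)
open import Relation.Binary.PropositionalEquality as ≡ using (_≡_; _≢_)
open import Relation.Nullary using (¬_; yes; no; does)
open import Algebra.Bundles using (CommutativeRing)
open import Level using (Level)

-- Sums and products over finite families

-- The positivity of sin(πv/h) has to survive in a ring without an order. Combinations of the s(v)
-- are therefore kept as lists of labels, and fusion and concatenation visibly return nonempty
-- lists. An untruncated fusion would leave the range from 1 to m, where s(h) = 0 and s(h + v) =
-- -s(v); the reflection v ↦ h - v prevents this.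
--
-- The factors [1], ..., [m] serve the odd j that are not prime to h: if d = gcd(j, h) > 1, then w =
-- h/d is at most m and s(w) vanishes at ζ^j. Fourier inversion needs all odd j, and Galois
-- conjugation supplies only the ones prime to h.
--
-- In Landau's argument f(ζ^i) = 0 forces f(ζ^(ip)) to lie in p·ℕ[ζ], while its coordinates with
-- respect to powers of ζ are too small to be divisible by a large prime p. Modulo 2h each j prime
-- to 2h is a product of large primes. Equality in K is not assumed decidable, so the minimal
-- relation of ζ is available only under a double negation; this suffices, because the nonvanishing
-- to be shown is itself a negation.

tuples : {a : Level} {A : Set a} → List A → (l : ℕ) → List (Vec A l)
tuples L zero    = [] ∷ []
tuples L (suc l) = concatMap (λ x → map (x ∷_) (tuples L l)) L

allTuples≡tuples : ∀ n l → allTuples n l ≡ tuples (allFuns n) l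
allTuples≡tuples n zero    = ≡.refl
allTuples≡tuples n (suc l) =
  ≡.cong (λ T → concatMap (λ f → map (f ∷_) T) (allFuns n)) (allTuples≡tuples n l)

allV : {a : Level} {A : Set a} {l : ℕ} → (A → Bool) → Vec A l → Bool
allV P []       = true
allV P (x ∷ xs) = P x ∧ allV P xs

module Sums {c ℓ : Level} (R : CommutativeRing c ℓ) where
  open CommutativeRing R hiding (zero)
  open import Algebra.Properties.Semiring.Exp semiring using (_^_)
  open import Algebra.Properties.Semiring.Mult semiring using (_×_)
  open import Algebra.Properties.CommutativeSemigroup *-commutativeSemigroup
    using () renaming (interchange to *-interchange)
  open import Algebra.Properties.CommutativeSemigroup +-commutativeSemigroup
    using () renaming (interchange to +-interchange)
  open import Relation.Binary.Reasoning.Setoid setoid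

  ∑ : {a : Level} {A : Set a} → List A → (A → Carrier) → Carrier
  ∑ []       f = 0#
  ∑ (x ∷ xs) f = f x + ∑ xs f

  ∑-cong : {a : Level} {A : Set a} (L : List A) {f g : A → Carrier} →
    (∀ x → f x ≈ g x) → ∑ L f ≈ ∑ L g
  ∑-cong []       f≈g = refl
  ∑-cong (x ∷ xs) f≈g = +-cong (f≈g x) (∑-cong xs f≈g)

  ∑-zero : {a : Level} {A : Set a} (L : List A) {f : A → Carrier} →
    (∀ x → f x ≈ 0#) → ∑ L f ≈ 0#
  ∑-zero []       f≈0 = refl
  ∑-zero (x ∷ xs) f≈0 = trans (+-cong (f≈0 x) (∑-zero xs f≈0)) (+-identityˡ 0#)

  ∑-++ : {a : Level} {A : Set a} (L M : List A) (f : A → Carrier) →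
    ∑ (L ++ M) f ≈ ∑ L f + ∑ M f
  ∑-++ []       M f = sym (+-identityˡ _)
  ∑-++ (x ∷ xs) M f = trans (+-congˡ (∑-++ xs M f)) (sym (+-assoc _ _ _))

  ∑-map : {a b : Level} {A : Set a} {B : Set b} (h : A → B) (L : List A) (f : B → Carrier) →
    ∑ (map h L) f ≈ ∑ L (λ x → f (h x))
  ∑-map h []       f = refl
  ∑-map h (x ∷ xs) f = +-congˡ (∑-map h xs f)

  ∑-concatMap : {a b : Level} {A : Set a} {B : Set b} (h : A → List B) (L : List A)
    (f : B → Carrier) → ∑ (concatMap h L) f ≈ ∑ L (λ x → ∑ (h x) f)
  ∑-concatMap h []       f = refl
  ∑-concatMap h (x ∷ xs) f = trans (∑-++ (h x) (concatMap h xs) f) (+-congˡ (∑-concatMap h xs f))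

  ∑-+ : {a : Level} {A : Set a} (L : List A) (f g : A → Carrier) →
    ∑ L (λ x → f x + g x) ≈ ∑ L f + ∑ L g
  ∑-+ []       f g = sym (+-identityˡ 0#)
  ∑-+ (x ∷ xs) f g = trans (+-congˡ (∑-+ xs f g)) (+-interchange _ _ _ _)

  *-∑ : {a : Level} {A : Set a} (L : List A) (k : Carrier) (f : A → Carrier) →
    k * ∑ L f ≈ ∑ L (λ x → k * f x)
  *-∑ []       k f = zeroʳ k
  *-∑ (x ∷ xs) k f = trans (distribˡ _ _ _) (+-congˡ (*-∑ xs k f))

  ∑-* : {a : Level} {A : Set a} (L : List A) (k : Carrier) (f : A → Carrier) →
    ∑ L f * k ≈ ∑ L (λ x → f x * k)
  ∑-* L k f = trans (*-comm _ _) (trans (*-∑ L k f) (∑-cong L (λ x → *-comm _ _)))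

  ∑-swap : {a b : Level} {A : Set a} {B : Set b} (L : List A) (M : List B)
    (f : A → B → Carrier) → ∑ L (λ x → ∑ M (f x)) ≈ ∑ M (λ y → ∑ L (λ x → f x y))
  ∑-swap []       M f = sym (∑-zero M (λ _ → refl))
  ∑-swap (x ∷ xs) M f = trans (+-congˡ (∑-swap xs M f)) (sym (∑-+ M _ _))

  ∑-tuples : {a : Level} {A : Set a} (L : List A) (l : ℕ) (f : Vec A (suc l) → Carrier) →
    ∑ (tuples L (suc l)) f ≈ ∑ L (λ x → ∑ (tuples L l) (λ t → f (x ∷ t)))
  ∑-tuples L l f = trans (∑-concatMap _ L f) (∑-cong L (λ x → ∑-map (x ∷_) (tuples L l) f))

  ∏ : {n : ℕ} → (Fin n → Carrier) → Carrier
  ∏ {zero}  f = 1#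
  ∏ {suc n} f = f zero * ∏ (λ i → f (suc i))

  ∏-cong : {n : ℕ} {f g : Fin n → Carrier} → (∀ i → f i ≈ g i) → ∏ f ≈ ∏ g
  ∏-cong {zero}  f≈g = refl
  ∏-cong {suc n} f≈g = *-cong (f≈g zero) (∏-cong (λ i → f≈g (suc i)))

  ∏-one : {n : ℕ} {f : Fin n → Carrier} → (∀ i → f i ≈ 1#) → ∏ f ≈ 1#
  ∏-one {zero}  f≈1 = refl
  ∏-one {suc n} f≈1 = trans (*-cong (f≈1 zero) (∏-one (λ i → f≈1 (suc i)))) (*-identityˡ 1#)

  ∏-* : {n : ℕ} (f g : Fin n → Carrier) → ∏ (λ i → f i * g i) ≈ ∏ f * ∏ g
  ∏-* {zero}  f g = sym (*-identityˡ 1#)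
  ∏-* {suc n} f g = trans (*-congˡ (∏-* (λ i → f (suc i)) (λ i → g (suc i)))) (*-interchange _ _ _ _)

  ∏-swap : {n k : ℕ} (f : Fin n → Fin k → Carrier) →
    ∏ (λ i → ∏ (f i)) ≈ ∏ (λ j → ∏ (λ i → f i j))
  ∏-swap {zero}  {k} f = sym (∏-one {k} (λ _ → refl))
  ∏-swap {suc n} {k} f = trans (*-congˡ (∏-swap (λ i → f (suc i))))
    (sym (∏-* {k} (f zero) (λ j → ∏ (λ i → f (suc i) j))))

  ∏-factor-0 : {n : ℕ} {f : Fin n → Carrier} (i : Fin n) → f i ≈ 0# → ∏ f ≈ 0#
  ∏-factor-0 zero    fi≈0 = trans (*-congʳ fi≈0) (zeroˡ _)
  ∏-factor-0 (suc i) fi≈0 = trans (*-congˡ (∏-factor-0 i fi≈0)) (zeroʳ _)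

  ∏-const : {n : ℕ} (k : Carrier) → ∏ {n} (λ _ → k) ≈ k ^ n
  ∏-const {zero}  k = refl
  ∏-const {suc n} k = *-congˡ (∏-const {n} k)

  ∑-allFuns-suc : (n : ℕ) (f : (Fin (suc n) → Bool) → Carrier) →
    ∑ (allFuns (suc n)) f ≈ ∑ (allFuns n) (λ g → f (cons false g) + f (cons true g))
  ∑-allFuns-suc n f = trans (∑-concatMap _ (allFuns n) f)
    (∑-cong (allFuns n) (λ g → +-congˡ (+-identityʳ _)))

  -- Distributivity: choosing a term in every factor is choosing a function E → GF(2). Character
  -- sums, inclusion-exclusion and the sum over f₁ all factor over E in this way.
  ∑-∏ : {n : ℕ} (φ : Fin n → Bool → Carrier) →
    ∑ (allFuns n) (λ f → ∏ (λ e → φ e (f e))) ≈ ∏ (λ e → φ e false + φ e true)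
  ∑-∏ {zero}  φ = +-identityʳ 1#
  ∑-∏ {suc n} φ = begin
    ∑ (allFuns (suc n)) (λ f → ∏ (λ e → φ e (f e)))
      ≈⟨ ∑-allFuns-suc n _ ⟩
    ∑ (allFuns n) (λ f → φ zero false * P f + φ zero true * P f)
      ≈⟨ ∑-cong (allFuns n) (λ f → sym (distribʳ (P f) _ _)) ⟩
    ∑ (allFuns n) (λ f → (φ zero false + φ zero true) * P f)
      ≈⟨ *-∑ (allFuns n) _ P ⟨
    (φ zero false + φ zero true) * ∑ (allFuns n) P
      ≈⟨ *-congˡ (∑-∏ (λ e → φ (suc e))) ⟩
    ∏ (λ e → φ e false + φ e true) ∎
    where
    P : (Fin n → Bool) → Carrier
    P f = ∏ (λ e → φ (suc e) (f e))

  -- Translation by c permutes GF(2)^n. The translated functions are only pointwise equal to listed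
  -- ones, hence the extensionality hypothesis on h.
  ∑-translate : {n : ℕ} (c : Fin n → Bool) (h : (Fin n → Bool) → Carrier) →
    (∀ f g → (∀ e → f e ≡ g e) → h f ≈ h g) →
    ∑ (allFuns n) h ≈ ∑ (allFuns n) (λ d → h (λ e → c e xor d e))
  ∑-translate {zero}  c h ext = +-congʳ (ext _ _ (λ ()))
  ∑-translate {suc n} c h ext = begin
    ∑ (allFuns (suc n)) h
      ≈⟨ ∑-allFuns-suc n h ⟩
    ∑ (allFuns n) h′
      ≈⟨ ∑-translate (λ e → c (suc e)) h′ ext′ ⟩
    ∑ (allFuns n) (λ d → h′ (λ e → c (suc e) xor d e))
      ≈⟨ ∑-cong (allFuns n) step ⟩
    ∑ (allFuns n) (λ d → h (λ e → c e xor cons false d e) + h (λ e → c e xor cons true d e))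
      ≈⟨ ∑-allFuns-suc n _ ⟨
    ∑ (allFuns (suc n)) (λ d → h (λ e → c e xor d e)) ∎
    where
    h′ : (Fin n → Bool) → Carrier
    h′ g = h (cons false g) + h (cons true g)
    cons-ext : ∀ {b f g} → (∀ e → f e ≡ g e) → ∀ e → cons {n} b f e ≡ cons b g e
    cons-ext f≗g zero    = ≡.refl
    cons-ext f≗g (suc e) = f≗g e
    ext′ : ∀ f g → (∀ e → f e ≡ g e) → h′ f ≈ h′ g
    ext′ f g f≗g = +-cong (ext _ _ (cons-ext f≗g)) (ext _ _ (cons-ext f≗g))
    step : ∀ d → h′ (λ e → c (suc e) xor d e)
      ≈ h (λ e → c e xor cons false d e) + h (λ e → c e xor cons true d e)
    step d with c zero in eq
    ... | false = +-cong (ext _ _ λ { zero → ≡.cong (_xor false) (≡.sym eq) ; (suc e) → ≡.refl })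
                         (ext _ _ λ { zero → ≡.cong (_xor true) (≡.sym eq) ; (suc e) → ≡.refl })
    ... | true  = trans (+-comm _ _)
      (+-cong (ext _ _ λ { zero → ≡.cong (_xor false) (≡.sym eq) ; (suc e) → ≡.refl })
              (ext _ _ λ { zero → ≡.cong (_xor true) (≡.sym eq) ; (suc e) → ≡.refl }))

  ind : Bool → Carrier
  ind b = if b then 1# else 0#

  ind-∧ : ∀ a b → ind (a ∧ b) ≈ ind a * ind b
  ind-∧ false b = sym (zeroˡ _)
  ind-∧ true  b = sym (*-identityˡ _)

  ind-allᵇ : {n : ℕ} (f : Fin n → Bool) → ind (allᵇ f) ≈ ∏ (λ e → ind (f e))
  ind-allᵇ {zero}  f = refl
  ind-allᵇ {suc n} f = trans (ind-∧ (f zero) _) (*-congˡ (ind-allᵇ (λ e → f (suc e))))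

  ∑-allV : {a : Level} {A : Set a} (L : List A) (P : A → Bool) (l : ℕ) →
    ∑ (tuples L l) (λ t → ind (allV P t)) ≈ ∑ L (λ x → ind (P x)) ^ l
  ∑-allV L P zero    = +-identityʳ 1#
  ∑-allV L P (suc l) = begin
    ∑ (tuples L (suc l)) (λ t → ind (allV P t))
      ≈⟨ ∑-tuples L l _ ⟩
    ∑ L (λ x → ∑ (tuples L l) (λ t → ind (P x ∧ allV P t)))
      ≈⟨ ∑-cong L (λ x → trans (∑-cong (tuples L l) (λ t → ind-∧ (P x) _))
                               (sym (*-∑ (tuples L l) _ _))) ⟩
    ∑ L (λ x → ind (P x) * ∑ (tuples L l) (λ t → ind (allV P t)))
      ≈⟨ ∑-* L _ _ ⟨
    ∑ L (λ x → ind (P x)) * ∑ (tuples L l) (λ t → ind (allV P t))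
      ≈⟨ *-congˡ (∑-allV L P l) ⟩
    ∑ L (λ x → ind (P x)) ^ suc l ∎

  length-filter : {a : Level} {A : Set a} (P : A → Bool) (L : List A) →
    length (filter (λ x → Bool._≟_ (P x) true) L) × 1# ≈ ∑ L (λ x → ind (P x))
  length-filter P []       = refl
  length-filter P (x ∷ xs) with P x
  ... | true  = +-congˡ (length-filter P xs)
  ... | false = trans (length-filter P xs) (sym (+-identityˡ _))

-- Prime binomial coefficients and integer multiples in a ring

[k+1]*[n+1]C[k+1]≡[n+1]*nCk : ∀ n k → suc k ℕ.* (suc n C suc k) ≡ suc n ℕ.* (n C k)
[k+1]*[n+1]C[k+1]≡[n+1]*nCk zero    zero    = ≡.refl
[k+1]*[n+1]C[k+1]≡[n+1]*nCk zero    (suc k) = ≡.trans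
  (≡.cong (suc (suc k) ℕ.*_) (k>n⇒nCk≡0 {1} {suc (suc k)} (s≤s (s≤s z≤n)))) (ℕ.*-zeroʳ k)
[k+1]*[n+1]C[k+1]≡[n+1]*nCk (suc n) zero    =
  ≡.trans (ℕ.*-identityˡ _) (≡.trans (nC1≡n (suc (suc n))) (≡.sym (ℕ.*-identityʳ _)))
[k+1]*[n+1]C[k+1]≡[n+1]*nCk (suc n) (suc k) = begin
  suc (suc k) ℕ.* (suc (suc n) C suc (suc k))
    ≡⟨ ≡.cong (suc (suc k) ℕ.*_) (nCk+nC[k+1]≡[n+1]C[k+1] (suc n) (suc k)) ⟨
  suc (suc k) ℕ.* (c ℕ.+ c′)
    ≡⟨ ℕ.*-distribˡ-+ (suc (suc k)) c c′ ⟩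
  (c ℕ.+ suc k ℕ.* c) ℕ.+ suc (suc k) ℕ.* c′
    ≡⟨ ≡.cong₂ (λ x y → (c ℕ.+ x) ℕ.+ y) ([k+1]*[n+1]C[k+1]≡[n+1]*nCk n k)
                                          ([k+1]*[n+1]C[k+1]≡[n+1]*nCk n (suc k)) ⟩
  (c ℕ.+ suc n ℕ.* (n C k)) ℕ.+ suc n ℕ.* (n C suc k)
    ≡⟨ ℕ.+-assoc c _ _ ⟩
  c ℕ.+ (suc n ℕ.* (n C k) ℕ.+ suc n ℕ.* (n C suc k))
    ≡⟨ ≡.cong (c ℕ.+_) (ℕ.*-distribˡ-+ (suc n) (n C k) (n C suc k)) ⟨
  c ℕ.+ suc n ℕ.* (n C k ℕ.+ n C suc k)
    ≡⟨ ≡.cong (λ x → c ℕ.+ suc n ℕ.* x) (nCk+nC[k+1]≡[n+1]C[k+1] n k) ⟩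
  suc (suc n) ℕ.* c ∎
  where
  open ≡.≡-Reasoning
  c  = suc n C suc k
  c′ = suc n C suc (suc k)

-- By the absorption identity the prime divides (k + 1) times the binomial coefficient, and it is
-- too large to divide k + 1.
prime∣pCk : ∀ {p} k → Prime (suc p) → k < p → suc p ∣ (suc p C suc k)
prime∣pCk {p} k pr k<p with euclidsLemma (suc k) (suc p C suc k) pr
  (divides (p C k) (≡.trans ([k+1]*[n+1]C[k+1]≡[n+1]*nCk p k) (ℕ.*-comm (suc p) (p C k))))
... | inj₁ p∣k = ⊥-elim (>⇒∤ (s≤s k<p) p∣k)
... | inj₂ p∣C = p∣C

module IntegerImage {c ℓ : Level} (K : CommutativeRing c ℓ) where
  open CommutativeRing K hiding (zero)
  open import Algebra.Properties.Ring ring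
  open import Algebra.Properties.AbelianGroup +-abelianGroup using (⁻¹-∙-comm)
  open import Algebra.Properties.Semiring.Mult semiring
    using (_×_; ×-homo-+; ×1-homo-*)
  open import Algebra.Properties.CommutativeSemigroup +-commutativeSemigroup using (interchange)
  open import Relation.Binary.Reasoning.Setoid setoid
  open import Algebra.Solver.Ring.AlmostCommutativeRing
    using (fromCommutativeRing; _-Raw-AlmostCommutative⟶_)

  ι : ℤ → Carrier
  ι (+ n)      = n × 1#
  ι (-[1+ n ]) = - (suc n × 1#)

  ι-neg : ∀ i → ι (ℤ.- i) ≈ - ι i
  ι-neg (+ zero)   = sym -0#≈0#
  ι-neg (+ suc n)  = refl
  ι-neg (-[1+ n ]) = sym (-‿involutive _)

  ι-⊖ : ∀ m n → ι (m ℤ.⊖ n) ≈ m × 1# - n × 1#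
  ι-⊖ m       zero    = sym (trans (+-congˡ -0#≈0#) (+-identityʳ _))
  ι-⊖ zero    (suc n) = sym (+-identityˡ _)
  ι-⊖ (suc m) (suc n) = begin
    ι (suc m ℤ.⊖ suc n)                   ≡⟨ ≡.cong ι (ℤ.[1+m]⊖[1+n]≡m⊖n m n) ⟩
    ι (m ℤ.⊖ n)                           ≈⟨ ι-⊖ m n ⟩
    m × 1# - n × 1#                       ≈⟨ +-identityˡ _ ⟨
    0# + (m × 1# - n × 1#)                ≈⟨ +-congʳ (-‿inverseʳ 1#) ⟨
    (1# - 1#) + (m × 1# - n × 1#)         ≈⟨ interchange _ _ _ _ ⟩
    (1# + m × 1#) + (- 1# + - (n × 1#))   ≈⟨ +-congˡ (⁻¹-∙-comm _ _) ⟩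
    suc m × 1# - suc n × 1#               ∎

  ι-+ : ∀ i j → ι (i ℤ.+ j) ≈ ι i + ι j
  ι-+ (+ m)      (+ n)      = ×-homo-+ 1# m n
  ι-+ (+ m)      (-[1+ n ]) = ι-⊖ m (suc n)
  ι-+ (-[1+ m ]) (+ n)      = trans (ι-⊖ n (suc m)) (+-comm _ _)
  ι-+ (-[1+ m ]) (-[1+ n ]) = begin
    - (suc (suc (m ℕ.+ n)) × 1#)      ≡⟨ ≡.cong (λ k → - (suc k × 1#)) (ℕ.+-suc m n) ⟨
    - ((suc m ℕ.+ suc n) × 1#)        ≈⟨ -‿cong (×-homo-+ 1# (suc m) (suc n)) ⟩
    - (suc m × 1# + suc n × 1#)       ≈⟨ ⁻¹-∙-comm _ _ ⟨
    - (suc m × 1#) + - (suc n × 1#)   ∎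

  private
    ι-pos-* : ∀ m j → ι (+ m ℤ.* j) ≈ m × 1# * ι j
    ι-pos-* m (+ n)      = trans (reflexive (≡.cong ι (≡.sym (ℤ.pos-* m n)))) (×1-homo-* m n)
    ι-pos-* m (-[1+ n ]) = begin
      ι (+ m ℤ.* (ℤ.- (+ suc n)))   ≡⟨ ≡.cong ι (ℤ.neg-distribʳ-* (+ m) (+ suc n)) ⟨
      ι (ℤ.- (+ m ℤ.* + suc n))     ≈⟨ ι-neg (+ m ℤ.* + suc n) ⟩
      - ι (+ m ℤ.* + suc n)         ≈⟨ -‿cong (ι-pos-* m (+ suc n)) ⟩
      - (m × 1# * (suc n × 1#))     ≈⟨ -‿distribʳ-* _ _ ⟩
      m × 1# * - (suc n × 1#)       ∎

  ι-* : ∀ i j → ι (i ℤ.* j) ≈ ι i * ι j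
  ι-* (+ m)      j = ι-pos-* m j
  ι-* (-[1+ m ]) j = begin
    ι ((ℤ.- (+ suc m)) ℤ.* j)   ≡⟨ ≡.cong ι (ℤ.neg-distribˡ-* (+ suc m) j) ⟨
    ι (ℤ.- (+ suc m ℤ.* j))     ≈⟨ ι-neg (+ suc m ℤ.* j) ⟩
    - ι (+ suc m ℤ.* j)         ≈⟨ -‿cong (ι-pos-* (suc m) j) ⟩
    - (suc m × 1# * ι j)        ≈⟨ -‿distribˡ-* _ _ ⟩
    - (suc m × 1#) * ι j        ∎

  -- Lets the ring solver work in K with integer constants.
  ι-homomorphism : CommutativeRing.rawRing ℤ.+-*-commutativeRing
    -Raw-AlmostCommutative⟶ fromCommutativeRing K
  ι-homomorphism = record
    { ⟦_⟧ = ι ; +-homo = ι-+ ; *-homo = ι-* ; -‿homo = ι-neg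
    ; 0-homo = refl ; 1-homo = +-identityʳ 1# }

  private
    ι-≟ : ∀ i j → Maybe (ι i ≈ ι j)
    ι-≟ i j with i ℤ.≟ j
    ... | yes i≡j = just (reflexive (≡.cong ι i≡j))
    ... | no _    = nothing

  open import Algebra.Solver.Ring (CommutativeRing.rawRing ℤ.+-*-commutativeRing)
    (fromCommutativeRing K) ι-homomorphism ι-≟ public
    using (solve; _:=_; _:+_; _:*_; _:-_; :-_; con)

-- Frobenius congruences and exponents with large prime factors

-- The multiplier M in j + N·M. It shares no prime with j and contains every other prime up to the
-- bound, so for j prime to N no prime up to the bound divides j + N·M.
coprimeProduct : ℕ → ℕ → ℕ
coprimeProduct j zero    = 1
coprimeProduct j (suc k) with coprime? (suc k) j
... | yes _ = suc k ℕ.* coprimeProduct j k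
... | no _  = coprimeProduct j k

prime∤⇒coprime : ∀ {q j} → Prime q → ¬ q ∣ j → Coprime q j
prime∤⇒coprime q-prime q∤j (i∣q , i∣j) with prime⇒irreducible q-prime i∣q
... | inj₁ i≡1    = i≡1
... | inj₂ ≡.refl = ⊥-elim (q∤j i∣j)

prime∣coprimeProduct : ∀ {q j} A → Prime q → ¬ q ∣ j → q ≤ A → q ∣ coprimeProduct j A
prime∣coprimeProduct zero q-prime q∤j z≤n = ⊥-elim (¬prime[0] q-prime)
prime∣coprimeProduct {q} {j} (suc A) q-prime q∤j q≤1+A with coprime? (suc A) j | ℕ.m≤n⇒m<n∨m≡n q≤1+A
... | yes _ | inj₁ (s≤s q≤A) = ∣n⇒∣m*n (suc A) (prime∣coprimeProduct A q-prime q∤j q≤A)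
... | yes _ | inj₂ ≡.refl    = m∣m*n _
... | no _  | inj₁ (s≤s q≤A) = prime∣coprimeProduct A q-prime q∤j q≤A
... | no ¬c | inj₂ ≡.refl    = ⊥-elim (¬c (prime∤⇒coprime q-prime q∤j))

prime∤coprimeProduct : ∀ {q j} A → Prime q → q ∣ j → ¬ q ∣ coprimeProduct j A
prime∤coprimeProduct zero q-prime q∣j q∣1 with ∣1⇒≡1 q∣1
... | ≡.refl = ¬prime[1] q-prime
prime∤coprimeProduct {q} {j} (suc A) q-prime q∣j q∣M with coprime? (suc A) j
... | no _  = prime∤coprimeProduct A q-prime q∣j q∣M
... | yes c with euclidsLemma (suc A) (coprimeProduct j A) q-prime q∣M
...   | inj₂ q∣M′ = prime∤coprimeProduct A q-prime q∣j q∣M′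
...   | inj₁ q∣A with c (q∣A , q∣j)
...     | ≡.refl = ¬prime[1] q-prime

-- A prime q ≤ A divides exactly one of j and coprimeProduct j A.
roughLift : ∀ j N A → (∀ {q} → Prime q → q ∣ j → ¬ q ∣ N) →
  ∀ {q} → Prime q → q ∣ j ℕ.+ N ℕ.* coprimeProduct j A → A < q
roughLift j N A coprime {q} q-prime q∣j′ with q ℕ.≤? A
... | no q≰A  = ℕ.≰⇒> q≰A
... | yes q≤A with q ∣? j
...   | no q∤j  = ⊥-elim (q∤j (∣m+n∣m⇒∣n (≡.subst (q ∣_) (ℕ.+-comm j _) q∣j′)
                    (∣n⇒∣m*n N (prime∣coprimeProduct A q-prime q∤j q≤A))))
...   | yes q∣j with euclidsLemma N (coprimeProduct j A) q-prime (∣m+n∣m⇒∣n q∣j′ q∣j)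
...     | inj₁ q∣N = ⊥-elim (coprime q-prime q∣j q∣N)
...     | inj₂ q∣M = ⊥-elim (prime∤coprimeProduct A q-prime q∣j q∣M)

roughFactors : ∀ {A} (ps : List ℕ) → All Prime ps →
  (∀ {q} → Prime q → q ∣ product ps → A < q) → All (A <_) ps
roughFactors []       []       h = []
roughFactors (p ∷ ps) (pr ∷ prs) h =
  h pr (m∣m*n _) ∷ roughFactors ps prs (λ q-prime q∣ps → h q-prime (∣n⇒∣m*n p q∣ps))

maximumBelow : (ℕ → ℕ) → ℕ → ℕ
maximumBelow f zero    = 0
maximumBelow f (suc n) = maximumBelow f n ⊔ f n

≤-maximumBelow : ∀ f {i} n → i < n → f i ≤ maximumBelow f n
≤-maximumBelow f {i} (suc n) (s≤s i≤n) with ℕ.m≤n⇒m<n∨m≡n i≤n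
... | inj₁ i<n    = ℕ.≤-trans (≤-maximumBelow f n i<n) (ℕ.m≤m⊔n _ _)
... | inj₂ ≡.refl = ℕ.m≤n⊔m _ _

module PowerSums {c ℓ : Level} (K : CommutativeRing c ℓ) where
  open CommutativeRing K hiding (zero)
  open Sums K
  open import Algebra.Properties.Semiring.Exp semiring
    using (_^_; ^-homo-*; ^-assocʳ; ^-congˡ)
  open import Algebra.Properties.Semiring.Mult semiring using (_×_; ×-congˡ; ×-congʳ; ×-assocˡ; ×-assoc-*)
  open import Algebra.Properties.Semiring.Sum semiring using (sum; sum-init-last)
  import Algebra.Properties.CommutativeSemiring.Binomial commutativeSemiring as Binomial
  open import Relation.Binary.Reasoning.Setoid setoid
  open IntegerImage K using (solve; _:=_; _:+_; _:*_)

  -- A polynomial with natural coefficients, given by its exponents with multiplicity. Signs are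
  -- absorbed into exponents, since -1 is itself a power of ζ.
  ev : List ℕ → Carrier → Carrier
  ev E ω = ∑ E (λ k → ω ^ k)

  ev-cong : ∀ E {ω ω′} → ω ≈ ω′ → ev E ω ≈ ev E ω′
  ev-cong E ω≈ω′ = ∑-cong E (λ k → ^-congˡ k ω≈ω′)

  ev-scale : ∀ j E ω → ev (map (j ℕ.*_) E) ω ≈ ev E (ω ^ j)
  ev-scale j E ω = trans (∑-map (j ℕ.*_) E _) (∑-cong E (λ k → sym (^-assocʳ ω j k)))

  1^n≈1 : ∀ n → 1# ^ n ≈ 1#
  1^n≈1 zero    = refl
  1^n≈1 (suc n) = trans (*-identityˡ _) (1^n≈1 n)

  ^-mod : ∀ {ω N} .{{_ : NonZero N}} → ω ^ N ≈ 1# → ∀ k → ω ^ k ≈ ω ^ (k % N)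
  ^-mod {ω} {N} ω^N≈1 k = begin
    ω ^ k                                ≡⟨ ≡.cong (ω ^_) (m≡m%n+[m/n]*n k N) ⟩
    ω ^ (k % N ℕ.+ k / N ℕ.* N)          ≈⟨ ^-homo-* ω (k % N) _ ⟩
    ω ^ (k % N) * ω ^ (k / N ℕ.* N)      ≡⟨ ≡.cong (λ i → ω ^ (k % N) * ω ^ i) (ℕ.*-comm (k / N) N) ⟩
    ω ^ (k % N) * ω ^ (N ℕ.* (k / N))    ≈⟨ *-congˡ (^-assocʳ ω N (k / N)) ⟨
    ω ^ (k % N) * (ω ^ N) ^ (k / N)      ≈⟨ *-congˡ (trans (^-congˡ (k / N) ω^N≈1) (1^n≈1 (k / N))) ⟩
    ω ^ (k % N) * 1#                     ≈⟨ *-identityʳ _ ⟩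
    ω ^ (k % N)                          ∎

  module _ (ω : Carrier) where

    -- The subsemiring ℕ[ω]. Congruences modulo p must be witnessed inside it, because p may well be
    -- invertible in K.
    PowerSum : Carrier → Set ℓ
    PowerSum x = ∃ λ E → x ≈ ev E ω

    PowerSum-0 : PowerSum 0#
    PowerSum-0 = [] , refl

    PowerSum-^ω : ∀ k → PowerSum (ω ^ k)
    PowerSum-^ω k = k ∷ [] , sym (+-identityʳ _)

    PowerSum-+ : ∀ {x y} → PowerSum x → PowerSum y → PowerSum (x + y)
    PowerSum-+ (E , x≈) (F , y≈) = E ++ F , trans (+-cong x≈ y≈) (sym (∑-++ E F _))

    PowerSum-* : ∀ {x y} → PowerSum x → PowerSum y → PowerSum (x * y)
    PowerSum-* (E , x≈) (F , y≈) = concatMap (λ k → map (k ℕ.+_) F) E ,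
      trans (*-cong x≈ y≈) (trans (∑-* E _ _) (sym (trans (∑-concatMap _ E _)
        (∑-cong E λ k → trans (∑-map (k ℕ.+_) F _)
          (trans (∑-cong F (λ l → ^-homo-* ω k l)) (sym (*-∑ F _ _)))))))

    PowerSum-^ : ∀ {x} → PowerSum x → ∀ n → PowerSum (x ^ n)
    PowerSum-^ x∈ zero    = PowerSum-^ω 0
    PowerSum-^ x∈ (suc n) = PowerSum-* x∈ (PowerSum-^ x∈ n)

    PowerSum-× : ∀ {x} n → PowerSum x → PowerSum (n × x)
    PowerSum-× zero    x∈ = PowerSum-0
    PowerSum-× (suc n) x∈ = PowerSum-+ x∈ (PowerSum-× n x∈)

    sum-divisible : ∀ p {n} (t : Fin n → Carrier) →
      (∀ i → ∃ λ z → t i ≈ p × 1# * z ∧′ PowerSum z) →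
      ∃ λ z → sum t ≈ p × 1# * z ∧′ PowerSum z
    sum-divisible p {zero}  t h = 0# , sym (zeroʳ _) , PowerSum-0
    sum-divisible p {suc n} t h =
      let z , t≈ , z∈ = h zero
          w , s≈ , w∈ = sum-divisible p (λ i → t (suc i)) (λ i → h (suc i))
      in z + w , trans (+-cong t≈ s≈) (sym (distribˡ _ _ _)) , PowerSum-+ z∈ w∈

    -- All binomial terms but the two outer ones carry a coefficient divisible by p, and their
    -- cofactors stay in ℕ[ω].
    freshman : ∀ {p x y} → Prime p → PowerSum x → PowerSum y →
      ∃ λ z → (x + y) ^ p ≈ x ^ p + y ^ p + p × 1# * z ∧′ PowerSum z
    freshman {zero}  p-prime _ _ = ⊥-elim (¬prime[0] p-prime)
    freshman {suc p} {x} {y} p-prime x∈ y∈ =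
      let z , s≈ , z∈ = sum-divisible (suc p) (λ i → t (suc (inject₁ i))) middle
      in z , expand z s≈ , z∈
      where
      t = Binomial.binomialTerm x y (suc p)
      first : t zero ≈ y ^ suc p
      first = trans (+-identityʳ _) (*-identityˡ _)
      last : t (suc (fromℕ p)) ≈ x ^ suc p
      last = begin
        (suc p C suc (toℕ (fromℕ p))) × (x ^ suc (toℕ (fromℕ p)) * y ^ (p ℕ.∸ toℕ (fromℕ p)))
          ≡⟨ ≡.cong (λ k → (suc p C suc k) × (x ^ suc k * y ^ (p ℕ.∸ k))) (Fin.toℕ-fromℕ p) ⟩
        (suc p C suc p) × (x ^ suc p * y ^ (p ℕ.∸ p))
          ≡⟨ ≡.cong₂ (λ k l → k × (x ^ suc p * y ^ l)) (nCn≡1 (suc p)) (ℕ.n∸n≡0 p) ⟩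
        x ^ suc p * 1# + 0#
          ≈⟨ trans (+-identityʳ _) (*-identityʳ _) ⟩
        x ^ suc p ∎
      middle : ∀ i → ∃ λ z → t (suc (inject₁ i)) ≈ suc p × 1# * z ∧′ PowerSum z
      middle i with prime∣pCk (toℕ (inject₁ i)) p-prime (≡.subst (_< p) (≡.sym (Fin.toℕ-inject₁ i)) (Fin.toℕ<n i))
      ... | divides q pCk≡q*p = q × b ,
            trans (×-congˡ (≡.trans pCk≡q*p (ℕ.*-comm q (suc p))))
              (trans (sym (×-assocˡ b (suc p) q))
                (sym (trans (×-assoc-* (suc p) 1# (q × b))
                  (×-congʳ (suc p) (*-identityˡ _))))) ,
            PowerSum-× q (PowerSum-* (PowerSum-^ x∈ (suc (toℕ (inject₁ i)))) (PowerSum-^ y∈ (p ℕ.∸ toℕ (inject₁ i))))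
        where b = Binomial.binomial x y (suc p) (suc (inject₁ i))
      expand : ∀ z → sum (λ i → t (suc (inject₁ i))) ≈ suc p × 1# * z →
        (x + y) ^ suc p ≈ x ^ suc p + y ^ suc p + suc p × 1# * z
      expand z s≈ = begin
        (x + y) ^ suc p
          ≈⟨ Binomial.theorem (suc p) x y ⟩
        t zero + sum (λ i → t (suc i))
          ≈⟨ +-cong first (sum-init-last (λ i → t (suc i))) ⟩
        y ^ suc p + (sum (λ i → t (suc (inject₁ i))) + t (suc (fromℕ p)))
          ≈⟨ +-congˡ (+-cong s≈ last) ⟩
        y ^ suc p + (suc p × 1# * z + x ^ suc p)
          ≈⟨ solve 3 (λ a b c → a :+ (b :+ c) := c :+ a :+ b) refl _ _ _ ⟩
        x ^ suc p + y ^ suc p + suc p × 1# * z ∎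

    -- Induction on the exponents with `freshman`. Coefficients are repetitions of exponents, so
    -- each summand is a bare power of ω, and its p-th power is the same power of ω^p.
    frobenius : ∀ {p} → Prime p → ∀ E →
      ∃ λ z → ev E ω ^ p ≈ ev E (ω ^ p) + p × 1# * z ∧′ PowerSum z
    frobenius {zero} p-prime E = ⊥-elim (¬prime[0] p-prime)
    frobenius {suc p} p-prime [] = 0# , trans (zeroˡ _) (sym (trans (+-congˡ (zeroʳ _)) (+-identityˡ _))) , PowerSum-0
    frobenius {p@(suc _)} p-prime (k ∷ E) =
      let z , E≈ , z∈ = frobenius p-prime E
          w , s≈ , w∈ = freshman p-prime (PowerSum-^ω k) (E , refl)
          ω^kp : (ω ^ k) ^ p ≈ (ω ^ p) ^ k
          ω^kp = trans (^-assocʳ ω k p) (trans (reflexive (≡.cong (ω ^_) (ℕ.*-comm k p))) (sym (^-assocʳ ω p k)))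
      in z + w ,
         trans s≈ (trans (+-congʳ (+-cong ω^kp E≈))
           (solve 5 (λ a b P z w → (a :+ (b :+ P :* z)) :+ P :* w := a :+ b :+ P :* (z :+ w)) refl _ _ _ _ _)) ,
         PowerSum-+ z∈ w∈

-- Galois conjugates of a vanishing sum of roots of unity

shift : (ℕ → ℤ) → ℕ → ℤ
shift b zero    = + 0
shift b (suc i) = b i

unitVec : ℕ → ℕ → ℤ
unitVec zero    zero    = + 1
unitVec zero    (suc i) = + 0
unitVec (suc k)         = shift (unitVec k)

unitVec-diag : ∀ k → unitVec k k ≡ + 1
unitVec-diag zero    = ≡.refl
unitVec-diag (suc k) = unitVec-diag k

unitVec-0 : ∀ n → .{{NonZero n}} → unitVec 0 n ≡ + 0
unitVec-0 (suc n) = ≡.refl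

module Landau {c ℓ : Level} (K : CommutativeRing c ℓ)
  (domain : IsIntegralDomain K) (charZero : CharZero K)
  (N : ℕ) {{N≢0 : NonZero N}} (ζ : CommutativeRing.Carrier K)
  (prim : IsPrimitiveRoot K N ζ) where

  open CommutativeRing K hiding (zero)
  open IntegerImage K
  open PowerSums K
  open import Algebra.Properties.Ring ring using (-0#≈0#)
  open import Algebra.Properties.Group +-group using () renaming (⁻¹-involutive to -‿involutive)
  open import Algebra.Properties.Semiring.Exp semiring
    using (_^_; ^-homo-*; ^-assocʳ; ^-congˡ)
  open import Algebra.Properties.Semiring.Mult semiring using (_×_)
  open import Relation.Binary.Reasoning.Setoid setoid

  ζᴺ : ζ ^ N ≈ 1#
  ζᴺ = proj₁ prim

  ι-injective₀ : ∀ i → ι i ≈ 0# → i ≡ + 0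
  ι-injective₀ (+ n)      n≈0 = ≡.cong +_ (charZero n n≈0)
  ι-injective₀ (-[1+ n ]) n≈0 with charZero (suc n)
    (trans (sym (-‿involutive _)) (trans (-‿cong n≈0) -0#≈0#))
  ... | ()

  cancel-ι : ∀ i {x} → i ≢ + 0 → ι i * x ≈ 0# → x ≈ 0#
  cancel-ι i i≢0 ix≈0 with domain _ _ ix≈0
  ... | inj₁ i≈0 = ⊥-elim (i≢0 (ι-injective₀ i i≈0))
  ... | inj₂ x≈0 = x≈0

  lin : ℕ → (ℕ → ℤ) → Carrier
  lin zero    b = 0#
  lin (suc d) b = lin d b + ι (b d) * ζ ^ d

  lin-+ : ∀ d b b′ → lin d (λ i → b i ℤ.+ b′ i) ≈ lin d b + lin d b′
  lin-+ zero    b b′ = sym (+-identityˡ _)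
  lin-+ (suc d) b b′ = trans (+-cong (lin-+ d b b′) (*-congʳ (ι-+ (b d) (b′ d))))
    (solve 5 (λ x y u v z → x :+ y :+ (u :+ v) :* z := x :+ u :* z :+ (y :+ v :* z)) refl _ _ _ _ _)

  lin-* : ∀ k d b → lin d (λ i → k ℤ.* b i) ≈ ι k * lin d b
  lin-* k zero    b = sym (zeroʳ _)
  lin-* k (suc d) b = trans (+-cong (lin-* k d b) (*-congʳ (ι-* k (b d))))
    (solve 4 (λ k x u z → k :* x :+ k :* u :* z := k :* (x :+ u :* z)) refl _ _ _ _)

  lin-shift : ∀ d b → lin (suc d) (shift b) ≈ ζ * lin d b
  lin-shift zero    b = trans (+-identityˡ _) (trans (zeroˡ _) (sym (zeroʳ _)))
  lin-shift (suc d) b = trans (+-congʳ (lin-shift d b))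
    (solve 4 (λ z x u w → z :* x :+ u :* (z :* w) := z :* (x :+ u :* w)) refl _ _ _ _)

  lin-zero : ∀ d b → (∀ i → i < d → b i ≡ + 0) → lin d b ≈ 0#
  lin-zero zero    b b≡0 = refl
  lin-zero (suc d) b b≡0 = trans
    (+-cong (lin-zero d b (λ i i<d → b≡0 i (ℕ.m<n⇒m<1+n i<d)))
            (trans (*-congʳ (reflexive (≡.cong ι (b≡0 d ℕ.≤-refl)))) (zeroˡ _)))
    (+-identityˡ _)

  lin-unitVec : ∀ d k → k ≤ d → lin (suc d) (unitVec k) ≈ ζ ^ k
  lin-unitVec zero    zero    _         = trans (+-identityˡ _) (trans (*-identityʳ _) (+-identityʳ _))
  lin-unitVec (suc d) zero    _         = trans (+-cong (lin-unitVec d zero z≤n) (zeroˡ _)) (+-identityʳ _)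
  lin-unitVec (suc d) (suc k) (s≤s k≤d) = trans (lin-shift (suc d) (unitVec k)) (*-congˡ (lin-unitVec d k k≤d))

  Independent : ℕ → Set ℓ
  Independent d = ∀ b → lin d b ≈ 0# → ∀ i → i < d → b i ≡ + 0

  -- Stands in for the minimal polynomial of ζ; powers of a serve as denominators.
  record Basis : Set (c Level.⊔ ℓ) where
    field
      d           : ℕ
      independent : Independent d
      a           : ℤ
      a≢0         : a ≢ + 0
      r           : ℕ → ℤ
      relation    : ι a * ζ ^ d ≈ lin d r

  -- ζ^N - 1 = 0 is a nontrivial integral relation among the first N + 1 powers.
  dependent : ¬ Independent (suc N)
  dependent ind = 1≢0 (≡.trans
      (≡.sym (≡.cong₂ (λ x y → x ℤ.+ (ℤ.- + 1) ℤ.* y) (unitVec-diag N) (unitVec-0 N)))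
      (ind _ vanishes N ℕ.≤-refl))
    where
    1≢0 : + 1 ≢ + 0
    1≢0 ()
    vanishes : lin (suc N) (λ i → unitVec N i ℤ.+ (ℤ.- + 1) ℤ.* unitVec 0 i) ≈ 0#
    vanishes = begin
      lin (suc N) (λ i → unitVec N i ℤ.+ (ℤ.- + 1) ℤ.* unitVec 0 i)
        ≈⟨ lin-+ (suc N) (unitVec N) (λ i → (ℤ.- + 1) ℤ.* unitVec 0 i) ⟩
      lin (suc N) (unitVec N) + lin (suc N) (λ i → (ℤ.- + 1) ℤ.* unitVec 0 i)
        ≈⟨ +-cong (lin-unitVec N N ℕ.≤-refl) (lin-* (ℤ.- + 1) (suc N) (unitVec 0)) ⟩
      ζ ^ N + ι (ℤ.- + 1) * lin (suc N) (unitVec 0)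
        ≈⟨ +-cong ζᴺ (*-congˡ (lin-unitVec N 0 z≤n)) ⟩
      1# + ι (ℤ.- + 1) * 1#
        ≈⟨ solve 1 (λ x → x :+ con (ℤ.- + 1) :* x := con (+ 0)) refl 1# ⟩
      0# ∎

  -- Without any `Basis`, independence would pass from d to d + 1 for ever and contradict
  -- `dependent`.
  withBasis : ¬ ¬ Basis
  withBasis noBasis = dependent (all (suc N))
    where
    all : ∀ d → Independent d
    all zero    b b≈0 i ()
    all (suc d) b b≈0 = go (b d ℤ.≟ + 0)
      where
      go : _ → ∀ i → i < suc d → b i ≡ + 0
      go (yes bd≡0) i (s≤s i≤d) with ℕ.m≤n⇒m<n∨m≡n i≤d
      ... | inj₂ ≡.refl = bd≡0
      ... | inj₁ i<d    = all d b (trans (sym (trans (+-congˡ (trans (*-congʳ (reflexive (≡.cong ι bd≡0))) (zeroˡ _)))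
                                              (+-identityʳ _))) b≈0) i i<d
      -- A relation with nonzero top coefficient, together with the independence of the lower
      -- powers, is a `Basis`.
      go (no bd≢0) = ⊥-elim (noBasis record
        { d = d ; independent = all d ; a = b d ; a≢0 = bd≢0 ; r = λ i → (ℤ.- + 1) ℤ.* b i
        ; relation = begin
            ι (b d) * ζ ^ d
              ≈⟨ solve 2 (λ x y → y := x :+ y :+ con (ℤ.- + 1) :* x) refl (lin d b) _ ⟩
            lin d b + ι (b d) * ζ ^ d + ι (ℤ.- + 1) * lin d b
              ≈⟨ +-congʳ b≈0 ⟩
            0# + ι (ℤ.- + 1) * lin d b
              ≈⟨ trans (+-identityˡ _) (sym (lin-* (ℤ.- + 1) d b)) ⟩
            lin d (λ i → (ℤ.- + 1) ℤ.* b i) ∎ })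

  module WithBasis (B : Basis) where
    open Basis B

    -- The span of the basis powers over ℤ[1/a]. Since a need not be invertible in K, the power of a
    -- in the denominator is recorded as e.
    Span : Carrier → Set ℓ
    Span x = ∃ λ e → ∃ λ b → ι (a ℤ.^ e) * x ≈ lin d b

    ι-^-+ : ∀ e e′ → ι (a ℤ.^ (e ℕ.+ e′)) ≈ ι (a ℤ.^ e) * ι (a ℤ.^ e′)
    ι-^-+ e e′ = trans (reflexive (≡.cong ι (ℤ.^-distribˡ-+-* a e e′))) (ι-* (a ℤ.^ e) (a ℤ.^ e′))

    Span-0 : Span 0#
    Span-0 = 0 , (λ _ → + 0) , trans (zeroʳ _) (sym (lin-zero d _ (λ _ _ → ≡.refl)))

    Span-+ : ∀ {x y} → Span x → Span y → Span (x + y)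
    Span-+ {x} {y} (e , b , x≈) (e′ , b′ , y≈) = e ℕ.+ e′ , _ , (begin
      ι (a ℤ.^ (e ℕ.+ e′)) * (x + y)
        ≈⟨ *-congʳ (ι-^-+ e e′) ⟩
      ι (a ℤ.^ e) * ι (a ℤ.^ e′) * (x + y)
        ≈⟨ solve 4 (λ A A′ x y → A :* A′ :* (x :+ y) := A′ :* (A :* x) :+ A :* (A′ :* y)) refl _ _ x y ⟩
      ι (a ℤ.^ e′) * (ι (a ℤ.^ e) * x) + ι (a ℤ.^ e) * (ι (a ℤ.^ e′) * y)
        ≈⟨ +-cong (*-congˡ x≈) (*-congˡ y≈) ⟩
      ι (a ℤ.^ e′) * lin d b + ι (a ℤ.^ e) * lin d b′
        ≈⟨ +-cong (lin-* (a ℤ.^ e′) d b) (lin-* (a ℤ.^ e) d b′) ⟨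
      lin d (λ i → a ℤ.^ e′ ℤ.* b i) + lin d (λ i → a ℤ.^ e ℤ.* b′ i)
        ≈⟨ lin-+ d (λ i → a ℤ.^ e′ ℤ.* b i) (λ i → a ℤ.^ e ℤ.* b′ i) ⟨
      lin d (λ i → a ℤ.^ e′ ℤ.* b i ℤ.+ a ℤ.^ e ℤ.* b′ i) ∎)

    -- Multiplication by ζ shifts the coordinates; the one that overflows onto ζ^d is rewritten by
    -- `relation`, at the cost of one more factor a.
    Span-ζ : ∀ {x} → Span x → Span (ζ * x)
    Span-ζ {x} (e , b , x≈) = suc e , _ , (begin
      ι (a ℤ.* a ℤ.^ e) * (ζ * x)
        ≈⟨ *-congʳ (ι-* a (a ℤ.^ e)) ⟩
      ι a * ι (a ℤ.^ e) * (ζ * x)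
        ≈⟨ solve 4 (λ A E z x → A :* E :* (z :* x) := A :* (z :* (E :* x))) refl _ _ ζ x ⟩
      ι a * (ζ * (ι (a ℤ.^ e) * x))
        ≈⟨ *-congˡ (trans (*-congˡ x≈) (sym (lin-shift d b))) ⟩
      ι a * (lin d (shift b) + ι (shift b d) * ζ ^ d)
        ≈⟨ solve 4 (λ A L S Z → A :* (L :+ S :* Z) := A :* L :+ S :* (A :* Z)) refl _ _ _ _ ⟩
      ι a * lin d (shift b) + ι (shift b d) * (ι a * ζ ^ d)
        ≈⟨ +-congˡ (*-congˡ relation) ⟩
      ι a * lin d (shift b) + ι (shift b d) * lin d r
        ≈⟨ +-cong (lin-* a d (shift b)) (lin-* (shift b d) d r) ⟨
      lin d (λ i → a ℤ.* shift b i) + lin d (λ i → shift b d ℤ.* r i)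
        ≈⟨ lin-+ d (λ i → a ℤ.* shift b i) (λ i → shift b d ℤ.* r i) ⟨
      lin d (λ i → a ℤ.* shift b i ℤ.+ shift b d ℤ.* r i) ∎)

    Span-1 : Span 1#
    Span-1 = go d relation
      where
      go : ∀ d′ → ι a * ζ ^ d′ ≈ lin d′ r → ∃ λ e → ∃ λ b → ι (a ℤ.^ e) * 1# ≈ lin d′ b
      -- With d = 0 there is no basis power to represent 1, and the relation itself serves as the
      -- witness with denominator a.
      go zero     rel = 1 , r , trans (*-congʳ (reflexive (≡.cong ι (ℤ.*-identityʳ a)))) rel
      go (suc d′) rel = 0 , unitVec 0 ,
        trans (*-identityʳ _) (trans (+-identityʳ _) (sym (lin-unitVec d′ 0 z≤n)))

    Span-ζ^ : ∀ k → Span (ζ ^ k)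
    Span-ζ^ zero    = Span-1
    Span-ζ^ (suc k) = Span-ζ (Span-ζ^ k)

    Span-ev : ∀ E → Span (ev E ζ)
    Span-ev []      = Span-0
    Span-ev (k ∷ E) = Span-+ (Span-ζ^ k) (Span-ev E)

    cancel-a^ : ∀ e {x} → ι (a ℤ.^ e) * x ≈ 0# → x ≈ 0#
    cancel-a^ zero    {x} h = trans (sym (trans (*-congʳ (+-identityʳ 1#)) (*-identityˡ x))) h
    cancel-a^ (suc e) h =
      cancel-a^ e (cancel-ι a a≢0 (trans (sym (*-assoc _ _ _)) (trans (*-congʳ (sym (ι-* a (a ℤ.^ e)))) h)))

    prime-cancel-a^ : ∀ {p} e n → Prime p → ∣ a ∣ < p → p ∣ ∣ a ℤ.^ e ∣ ℕ.* n → p ∣ n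
    prime-cancel-a^ zero    n pr a<p h = ≡.subst (_ ∣_) (ℕ.+-identityʳ n) h
    prime-cancel-a^ {p} (suc e) n pr a<p h
      with euclidsLemma ∣ a ∣ (∣ a ℤ.^ e ∣ ℕ.* n) pr
             (≡.subst (p ∣_) (≡.trans (≡.cong (ℕ._* n) (ℤ.abs-* a (a ℤ.^ e))) (ℕ.*-assoc ∣ a ∣ _ n)) h)
    ... | inj₂ p∣rest = prime-cancel-a^ e n pr a<p p∣rest
    ... | inj₁ p∣a    = ⊥-elim (ℕ.<⇒≱ a<p (∣⇒≤ {{ℕ.≢-nonZero (λ ∣a∣≡0 → a≢0 (ℤ.∣i∣≡0⇒i≡0 ∣a∣≡0))}} p∣a))

    -- Clear denominators in ev E ζ = -p·z and compare coordinates: p divides a^e′·b i, hence b i as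
    -- p > |a|, and p > |b i| leaves b i = 0. The bound A depends on E alone, not on p or z.
    no-large-prime-divisor : ∀ E → ∃ λ A → ∀ {p z} → Prime p → A < p → PowerSum ζ z →
      ev E ζ + p × 1# * z ≈ 0# → ev E ζ ≈ 0#
    no-large-prime-divisor E = A , go
      where
      e = proj₁ (Span-ev E)
      b = proj₁ (proj₂ (Span-ev E))
      A = ∣ a ∣ ⊔ maximumBelow (λ i → ∣ b i ∣) d
      go : ∀ {p z} → Prime p → A < p → PowerSum ζ z → ev E ζ + p × 1# * z ≈ 0# → ev E ζ ≈ 0#
      go {p} {z} pr A<p (F , z≈) h = cancel-a^ e (trans (proj₂ (proj₂ (Span-ev E))) (lin-zero d b b≡0))
        where
        e′ = proj₁ (Span-ev F)
        b′ = proj₁ (proj₂ (Span-ev F))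
        q = λ i → a ℤ.^ e′ ℤ.* b i
        q′ = λ i → (a ℤ.^ e ℤ.* + p) ℤ.* b′ i
        vanishes : lin d (λ i → q i ℤ.+ q′ i) ≈ 0#
        vanishes = begin
          lin d (λ i → q i ℤ.+ q′ i)
            ≈⟨ lin-+ d q q′ ⟩
          lin d q + lin d q′
            ≈⟨ +-cong (lin-* (a ℤ.^ e′) d b) (trans (lin-* (a ℤ.^ e ℤ.* + p) d b′) (*-congʳ (ι-* (a ℤ.^ e) (+ p)))) ⟩
          ι (a ℤ.^ e′) * lin d b + ι (a ℤ.^ e) * p × 1# * lin d b′
            ≈⟨ +-cong (*-congˡ (proj₂ (proj₂ (Span-ev E)))) (*-congˡ (proj₂ (proj₂ (Span-ev F)))) ⟨
          ι (a ℤ.^ e′) * (ι (a ℤ.^ e) * ev E ζ) + ι (a ℤ.^ e) * p × 1# * (ι (a ℤ.^ e′) * ev F ζ)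
            ≈⟨ solve 5 (λ A′ A x P y → A′ :* (A :* x) :+ A :* P :* (A′ :* y) := A′ :* A :* (x :+ P :* y)) refl _ _ _ _ _ ⟩
          ι (a ℤ.^ e′) * ι (a ℤ.^ e) * (ev E ζ + p × 1# * ev F ζ)
            ≈⟨ *-congˡ (trans (+-congˡ (*-congˡ (sym z≈))) h) ⟩
          ι (a ℤ.^ e′) * ι (a ℤ.^ e) * 0#
            ≈⟨ zeroʳ _ ⟩
          0# ∎
        p∣b : ∀ i → i < d → p ∣ ∣ b i ∣
        p∣b i i<d = prime-cancel-a^ e′ ∣ b i ∣ pr (ℕ.≤-<-trans (ℕ.m≤m⊔n _ _) A<p)
          (≡.subst (p ∣_) (ℤ.abs-* (a ℤ.^ e′) (b i))
            (≡.subst (p ∣_) (≡.trans (≡.sym (ℤ.∣-i∣≡∣i∣ (q′ i)))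
                               (≡.cong ∣_∣ (≡.sym (ℤinverse (q i) (q′ i) (independent _ vanishes i i<d)))))
              p∣q′))
          where
          open import Algebra.Properties.Group (CommutativeRing.+-group ℤ.+-*-commutativeRing) using () renaming (inverseˡ-unique to ℤinverse)
          p∣q′ : p ∣ ∣ q′ i ∣
          p∣q′ = ≡.subst (p ∣_) (≡.sym (≡.trans (ℤ.abs-* (a ℤ.^ e ℤ.* + p) (b′ i))
                                       (≡.cong (ℕ._* ∣ b′ i ∣) (ℤ.abs-* (a ℤ.^ e) (+ p)))))
                   (∣m⇒∣m*n ∣ b′ i ∣ (n∣m*n ∣ a ℤ.^ e ∣))
        b≡0 : ∀ i → i < d → b i ≡ + 0
        b≡0 i i<d with ∣ b i ∣ in eq
        ... | zero  = ℤ.∣i∣≡0⇒i≡0 eq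
        ... | suc n = ⊥-elim (ℕ.<⇒≱ (ℕ.≤-<-trans
                (ℕ.≤-trans (≤-maximumBelow (λ i → ∣ b i ∣) d i<d) (ℕ.m≤n⊔m ∣ a ∣ _)) A<p)
                (≡.subst (p ≤_) (≡.sym eq) (∣⇒≤ (≡.subst (p ∣_) eq (p∣b i i<d)))))

    module _ (E : List ℕ) (ev≈0 : ev E ζ ≈ 0#) where

      -- ζ^j depends on j mod N only, so one bound serves every step.
      bound : ℕ
      bound = maximumBelow (λ j → proj₁ (no-large-prime-divisor (map (j ℕ.*_) E))) N

      -- By `frobenius`, 0 = f(ζ^i)^p = f(ζ^(ip)) + p·z. Reducing ip modulo N turns f(ζ^(ip)) into
      -- one of the N values at ζ for which `bound` was chosen.
      prime-step : ∀ i {p} → Prime p → bound < p → ev E (ζ ^ i) ≈ 0# → ev E (ζ ^ (i ℕ.* p)) ≈ 0#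
      prime-step i {suc p-1} pr A<p h =
        trans (ev-cong E ζ^ip) (trans (sym (ev-scale j E ζ)) j-zero)
        where
        p = suc p-1
        j = (i ℕ.* p) % N
        ζ^ip : ζ ^ (i ℕ.* p) ≈ ζ ^ j
        ζ^ip = ^-mod ζᴺ (i ℕ.* p)
        Fr = frobenius ζ pr (map (i ℕ.*_) E)
        z = proj₁ Fr
        j-zero : ev (map (j ℕ.*_) E) ζ ≈ 0#
        j-zero = proj₂ (no-large-prime-divisor (map (j ℕ.*_) E)) {p} {z} pr
          (ℕ.≤-<-trans (≤-maximumBelow (λ j → proj₁ (no-large-prime-divisor (map (j ℕ.*_) E))) N (m%n<n (i ℕ.* p) N)) A<p)
          (proj₂ (proj₂ Fr)) (begin
            ev (map (j ℕ.*_) E) ζ + p × 1# * z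
              ≈⟨ +-congʳ (trans (ev-scale j E ζ) (ev-cong E (sym ζ^ip))) ⟩
            ev E (ζ ^ (i ℕ.* p)) + p × 1# * z
              ≈⟨ +-congʳ (ev-cong E (trans (reflexive (≡.cong (ζ ^_) (ℕ.*-comm i p))) (sym (^-assocʳ ζ p i)))) ⟩
            ev E ((ζ ^ p) ^ i) + p × 1# * z
              ≈⟨ +-congʳ (ev-scale i E (ζ ^ p)) ⟨
            ev (map (i ℕ.*_) E) (ζ ^ p) + p × 1# * z
              ≈⟨ proj₁ (proj₂ Fr) ⟨
            ev (map (i ℕ.*_) E) ζ ^ p
              ≈⟨ *-congʳ (trans (ev-scale i E ζ) h) ⟩
            0# * ev (map (i ℕ.*_) E) ζ ^ p-1
              ≈⟨ zeroˡ _ ⟩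
            0# ∎)

      primes-step : ∀ i ps → All Prime ps → All (bound <_) ps →
        ev E (ζ ^ i) ≈ 0# → ev E (ζ ^ (i ℕ.* product ps)) ≈ 0#
      primes-step i []       []         []         h =
        trans (ev-cong E (reflexive (≡.cong (ζ ^_) (ℕ.*-identityʳ i)))) h
      primes-step i (p ∷ ps) (pr ∷ prs) (gt ∷ gts) h =
        trans (ev-cong E (reflexive (≡.cong (ζ ^_) (≡.sym (ℕ.*-assoc i p (product ps))))))
          (primes-step (i ℕ.* p) ps prs gts (prime-step i pr gt h))

      -- Adding a multiple of N to j leaves ζ^j unchanged and can be arranged so that all prime
      -- factors exceed `bound`; these are then multiplied into the exponent one at a time, starting
      -- from ζ^1.
      conjugate-zero : ∀ j → 0 < j → (∀ {q} → Prime q → q ∣ j → ¬ q ∣ N) → ev E (ζ ^ j) ≈ 0#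
      conjugate-zero j 0<j coprime = trans (ev-cong E ζʲ≈) (primes-step 1 ps prs gts ev≈0′)
        where
        j′ = j ℕ.+ N ℕ.* coprimeProduct j bound
        instance
          j′≢0 : NonZero j′
          j′≢0 = ℕ.>-nonZero (ℕ.≤-trans 0<j (ℕ.m≤m+n j _))
        F = factorise j′
        ps = PrimeFactorisation.factors F
        prs = PrimeFactorisation.factorsPrime F
        j′≡ : j′ ≡ product ps
        j′≡ = PrimeFactorisation.isFactorisation F
        gts : All (bound <_) ps
        gts = roughFactors ps prs (λ q-prime q∣ → roughLift j N bound coprime q-prime (≡.subst (_ ∣_) (≡.sym j′≡) q∣))
        ev≈0′ : ev E (ζ ^ 1) ≈ 0#
        ev≈0′ = trans (ev-cong E (*-identityʳ ζ)) ev≈0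
        ζʲ≈ : ζ ^ j ≈ ζ ^ (1 ℕ.* product ps)
        ζʲ≈ = begin
          ζ ^ j                                      ≈⟨ *-identityʳ _ ⟨
          ζ ^ j * 1#                                 ≈⟨ *-congˡ (trans (^-congˡ M ζᴺ) (1^n≈1 M)) ⟨
          ζ ^ j * (ζ ^ N) ^ M                        ≈⟨ *-congˡ (^-assocʳ ζ N M) ⟩
          ζ ^ j * ζ ^ (N ℕ.* M)                      ≈⟨ ^-homo-* ζ j _ ⟨
          ζ ^ j′                                     ≡⟨ ≡.cong (ζ ^_) (≡.trans j′≡ (≡.sym (ℕ.+-identityʳ _))) ⟩
          ζ ^ (1 ℕ.* product ps)                     ∎
          where M = coprimeProduct j bound

  conjugate-zeros : ∀ E → ev E ζ ≈ 0# →
    ¬ ¬ (∀ j → 0 < j → (∀ {q} → Prime q → q ∣ j → ¬ q ∣ N) → ev E (ζ ^ j) ≈ 0#)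
  conjugate-zeros E ev≈0 k = withBasis (λ B → k (WithBasis.conjugate-zero B E ev≈0))

-- Quantum integers and truncated fusion

Label : ℕ → ℕ → Set
Label m v = 0 < v ∧′ v ≤ m

-- A nonzero combination of the s(v) with natural coefficients. Nonemptiness is the form in which
-- positivity is carried along.
Labels : ℕ → List ℕ → Set
Labels m L = L ≢ [] ∧′ All (Label m) L

-- The labels v+w−1, v+w−3, …, |v−w|+1.
clebschGordan : ℕ → ℕ → List ℕ
clebschGordan zero    v       = []
clebschGordan (suc w) zero    = []
clebschGordan (suc w) (suc v) = suc (v ℕ.+ w) ∷ clebschGordan w v

clebschGordan-labels : ∀ {m} w v → w ℕ.+ v ≤ suc m → All (Label m) (clebschGordan w v)
clebschGordan-labels zero    v       _ = []
clebschGordan-labels (suc w) zero    _ = []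
clebschGordan-labels {m} (suc w) (suc v) (s≤s w+1+v≤m) =
  (s≤s z≤n , ≡.subst (_≤ m) (≡.trans (ℕ.+-suc w v) (≡.cong suc (ℕ.+-comm w v))) w+1+v≤m)
  ∷ clebschGordan-labels w v (ℕ.m≤n⇒m≤1+n (ℕ.≤-trans (ℕ.+-monoʳ-≤ w (ℕ.n≤1+n v)) w+1+v≤m))

clebschGordan-nonempty : ∀ {w v} → 0 < w → 0 < v → clebschGordan w v ≢ []
clebschGordan-nonempty (s≤s _) (s≤s _) ()

-- s is invariant under v ↦ m + 1 − v, so beyond w + v = m + 1 both labels are reflected.
fuse : ℕ → ℕ → ℕ → List ℕ
fuse m w v with w ℕ.+ v ℕ.≤? suc m
... | yes _ = clebschGordan w v
... | no _  = clebschGordan (suc m ℕ.∸ w) (suc m ℕ.∸ v)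

reflect-label : ∀ {m v} → Label m v → Label m (suc m ℕ.∸ v)
reflect-label {m} {v} (0<v , v≤m) = ℕ.m<n⇒0<n∸m (s≤s v≤m) , ℕ.∸-monoʳ-≤ (suc m) 0<v

-- The largest label is w + v - 1, which is at most m when w + v ≤ h. Otherwise (h - w) + (h - v) =
-- 2h - (w + v) is below h, so the reflected labels satisfy the same bound.
fuse-labels : ∀ {m w v} → Label m w → Label m v → Labels m (fuse m w v)
fuse-labels {m} {w} {v} w-lab v-lab with w ℕ.+ v ℕ.≤? suc m
... | yes w+v≤h = clebschGordan-nonempty (proj₁ w-lab) (proj₁ v-lab) , clebschGordan-labels w v w+v≤h
... | no w+v≰h  =
  clebschGordan-nonempty (proj₁ (reflect-label w-lab)) (proj₁ (reflect-label v-lab)) ,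
  clebschGordan-labels w′ v′ (ℕ.+-cancelʳ-≤ (w ℕ.+ v) (w′ ℕ.+ v′) h (ℕ.≤-trans
      (ℕ.≤-reflexive total) (ℕ.+-monoʳ-≤ h (ℕ.<⇒≤ (ℕ.≰⇒> w+v≰h)))))
  where
  h  = suc m
  w′ = h ℕ.∸ w
  v′ = h ℕ.∸ v
  swap : ∀ a b c d → (a ℕ.+ b) ℕ.+ (c ℕ.+ d) ≡ (a ℕ.+ c) ℕ.+ (b ℕ.+ d)
  swap = solve-∀
  total : (w′ ℕ.+ v′) ℕ.+ (w ℕ.+ v) ≡ h ℕ.+ h
  total = ≡.trans (swap w′ v′ w v)
    (≡.cong₂ ℕ._+_ (ℕ.m∸n+n≡m (ℕ.m≤n⇒m≤1+n (proj₂ w-lab))) (ℕ.m∸n+n≡m (ℕ.m≤n⇒m≤1+n (proj₂ v-lab))))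

concatMap-labels : ∀ {m L} {f : ℕ → List ℕ} → (∀ {v} → Label m v → Labels m (f v)) →
  Labels m L → Labels m (concatMap f L)
concatMap-labels {L = []}    f-lab (L≢[] , _) = ⊥-elim (L≢[] ≡.refl)
concatMap-labels {m} {v ∷ L} {f} f-lab (_ , v-lab ∷ L-lab) = nonempty (f v) (proj₁ (f-lab v-lab)) ,
  All.concat⁺ (All.map⁺ (all (v-lab ∷ L-lab)))
  where
  nonempty : ∀ M {M′} → M ≢ [] → M ++ M′ ≢ []
  nonempty []      M≢[] = ⊥-elim (M≢[] ≡.refl)
  nonempty (_ ∷ _) M≢[] ()
  all : ∀ {L} → All (Label m) L → All (λ v → All (Label m) (f v)) L
  all []         = []
  all (px ∷ pxs) = proj₂ (f-lab px) ∷ all pxs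

module QuantumIntegers {c ℓ : Level} (K : CommutativeRing c ℓ) (m : ℕ) where
  open CommutativeRing K hiding (zero)
  open Sums K
  open PowerSums K
  open IntegerImage K
  open import Algebra.Properties.Semiring.Exp semiring
    using (_^_; ^-homo-*; ^-congˡ)
  open import Algebra.Properties.CommutativeSemiring.Exp commutativeSemiring using (^-distrib-*)
  open import Relation.Binary.Reasoning.Setoid setoid

  -- Holds for the odd powers of a primitive (2m+2)-th root of unity.  For such ω, inv ω is the
  -- inverse of ω and quantum ω w is [w] = ω^(w−1) + ω^(w−3) + ⋯ + ω^(1−w).
  Odd : Carrier → Set ℓ
  Odd ω = ω ^ suc m ≈ - 1#

  inv : Carrier → Carrier
  inv ω = ω ^ suc (2 ℕ.* m)

  s : Carrier → ℕ → Carrier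
  s ω v = ω ^ v - inv ω ^ v

  quantum : Carrier → ℕ → Carrier
  quantum ω zero    = 0#
  quantum ω (suc w) = ω ^ w + inv ω * quantum ω w

  S : List ℕ → Carrier → Carrier
  S L ω = ∑ L (s ω)

  module _ {ω : Carrier} (odd : Odd ω) where

    ω⁻¹ : Carrier
    ω⁻¹ = inv ω

    inverse : ω * ω⁻¹ ≈ 1#
    inverse = begin
      ω * ω ^ suc (2 ℕ.* m)      ≡⟨ ≡.cong (ω ^_) (exponent m) ⟩
      ω ^ (suc m ℕ.+ suc m)      ≈⟨ ^-homo-* ω (suc m) (suc m) ⟩
      ω ^ suc m * ω ^ suc m      ≈⟨ *-cong odd odd ⟩
      - 1# * - 1#                ≈⟨ solve 1 (λ x → :- x :* :- x := x :* x) refl 1# ⟩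
      1# * 1#                    ≈⟨ *-identityˡ _ ⟩
      1#                         ∎
      where
      exponent : ∀ m → suc (suc (2 ℕ.* m)) ≡ suc m ℕ.+ suc m
      exponent = solve-∀

    inverse-^ : ∀ v → ω ^ v * ω⁻¹ ^ v ≈ 1#
    inverse-^ v = trans (sym (^-distrib-* ω ω⁻¹ v)) (trans (^-congˡ v inverse) (1^n≈1 v))

    -- Since ω^h = -1, the term -ω^(-v) equals ω^(h - v). This writes s(v) as a sum of powers with
    -- natural coefficients and exhibits its symmetry under reflection.
    s≈ : ∀ {v} → v ≤ suc m → s ω v ≈ ω ^ v + ω ^ (suc m ℕ.∸ v)
    s≈ {v} v≤h = +-congˡ (sym (begin
      ω ^ (suc m ℕ.∸ v)                          ≈⟨ *-identityʳ _ ⟨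
      ω ^ (suc m ℕ.∸ v) * 1#                     ≈⟨ *-congˡ (inverse-^ v) ⟨
      ω ^ (suc m ℕ.∸ v) * (ω ^ v * ω⁻¹ ^ v)      ≈⟨ *-assoc _ _ _ ⟨
      ω ^ (suc m ℕ.∸ v) * ω ^ v * ω⁻¹ ^ v        ≈⟨ *-congʳ (^-homo-* ω (suc m ℕ.∸ v) v) ⟨
      ω ^ (suc m ℕ.∸ v ℕ.+ v) * ω⁻¹ ^ v          ≡⟨ ≡.cong (λ k → ω ^ k * ω⁻¹ ^ v) (ℕ.m∸n+n≡m v≤h) ⟩
      ω ^ suc m * ω⁻¹ ^ v                        ≈⟨ *-congʳ odd ⟩
      - 1# * ω⁻¹ ^ v                             ≈⟨ solve 2 (λ x y → :- x :* y := :- (x :* y)) refl _ _ ⟩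
      - (1# * ω⁻¹ ^ v)                           ≈⟨ -‿cong (*-identityˡ _) ⟩
      - ω⁻¹ ^ v                                  ∎))

    s-reflect : ∀ {v} → v ≤ suc m → s ω (suc m ℕ.∸ v) ≈ s ω v
    s-reflect {v} v≤h = begin
      s ω (suc m ℕ.∸ v)                                        ≈⟨ s≈ (ℕ.m∸n≤m (suc m) v) ⟩
      ω ^ (suc m ℕ.∸ v) + ω ^ (suc m ℕ.∸ (suc m ℕ.∸ v))        ≡⟨ ≡.cong (λ k → ω ^ (suc m ℕ.∸ v) + ω ^ k) (ℕ.m∸[m∸n]≡n v≤h) ⟩
      ω ^ (suc m ℕ.∸ v) + ω ^ v                                ≈⟨ +-comm _ _ ⟩
      ω ^ v + ω ^ (suc m ℕ.∸ v)                                ≈⟨ s≈ v≤h ⟨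
      s ω v                                                    ∎

    s₀≈0 : s ω 0 ≈ 0#
    s₀≈0 = -‿inverseʳ 1#

    -- [w] = s(w)/s(1) without a division: s(1) vanishes at ω = -1, which is an odd power of ζ
    -- whenever h is odd.
    s₁*quantum : ∀ w → s ω 1 * quantum ω w ≈ s ω w
    s₁*quantum zero    = trans (zeroʳ _) (sym s₀≈0)
    s₁*quantum (suc w) = begin
      s ω 1 * (ω ^ w + ω⁻¹ * quantum ω w)
        ≈⟨ solve 4 (λ s a b q → s :* (a :+ b :* q) := s :* a :+ b :* (s :* q)) refl _ _ _ _ ⟩
      s ω 1 * ω ^ w + ω⁻¹ * (s ω 1 * quantum ω w)
        ≈⟨ +-cong (*-congʳ (+-cong (*-identityʳ _) (-‿cong (*-identityʳ _)))) (*-congˡ (s₁*quantum w)) ⟩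
      (ω - ω⁻¹) * ω ^ w + ω⁻¹ * (ω ^ w - ω⁻¹ ^ w)
        ≈⟨ solve 4 (λ x y a b → (x :- y) :* a :+ y :* (a :- b) := x :* a :- y :* b) refl _ _ _ _ ⟩
      s ω (suc w) ∎

    -- Both sides are s(1)·[w]·[v]. The swap lets a property of s(w) act on the factor [w], for
    -- which it may fail.
    quantum-s-swap : ∀ w v → quantum ω w * s ω v ≈ s ω w * quantum ω v
    quantum-s-swap w v = begin
      quantum ω w * s ω v                       ≈⟨ *-congˡ (s₁*quantum v) ⟨
      quantum ω w * (s ω 1 * quantum ω v)       ≈⟨ solve 3 (λ a b c → a :* (b :* c) := b :* a :* c) refl _ _ _ ⟩
      s ω 1 * quantum ω w * quantum ω v         ≈⟨ *-congʳ (s₁*quantum w) ⟩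
      s ω w * quantum ω v                       ∎

    -- One step of the Clebsch-Gordan rule: the top label splits off and both arguments drop by one.
    -- It follows from [w + 1] = ω^w + ω⁻¹·[w] and `s₁*quantum`.
    quantum-step : ∀ w v → quantum ω (suc w) * s ω (suc v) ≈ s ω (suc (v ℕ.+ w)) + quantum ω w * s ω v
    quantum-step w v = begin
      (ω ^ w + ω⁻¹ * q) * (ω * ω ^ v - ω⁻¹ * ω⁻¹ ^ v)
        ≈⟨ solve 6 (λ x y a b d q → (a :+ y :* q) :* (x :* b :- y :* d)
             := x :* (b :* a) :- (y :* d) :* a :+ q :* ((x :* y) :* b :- y :* (y :* d))) refl ω ω⁻¹ (ω ^ w) (ω ^ v) (ω⁻¹ ^ v) q ⟩
      ω * (ω ^ v * ω ^ w) - (ω⁻¹ * ω⁻¹ ^ v) * ω ^ w + q * ((ω * ω⁻¹) * ω ^ v - ω⁻¹ * (ω⁻¹ * ω⁻¹ ^ v))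
        ≈⟨ +-congˡ (*-congˡ (+-congʳ (trans (*-congʳ inverse) (*-identityˡ _)))) ⟩
      ω * (ω ^ v * ω ^ w) - (ω⁻¹ * ω⁻¹ ^ v) * ω ^ w + q * (ω ^ v - ω⁻¹ * (ω⁻¹ * ω⁻¹ ^ v))
        ≈⟨ solve 6 (λ A y a b d q → A :- (y :* d) :* a :+ q :* (b :- y :* (y :* d))
             := A :- (y :* d) :* a :+ q :* (b :- d) :+ (q :* d :- y :* (y :* d) :* q)) refl (ω * (ω ^ v * ω ^ w)) ω⁻¹ (ω ^ w) (ω ^ v) (ω⁻¹ ^ v) q ⟩
      ω * (ω ^ v * ω ^ w) - (ω⁻¹ * ω⁻¹ ^ v) * ω ^ w + q * s ω v + (q * ω⁻¹ ^ v - ω⁻¹ * (ω⁻¹ * ω⁻¹ ^ v) * q)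
        ≈⟨ +-congˡ (trans (+-congʳ (trans (sym (*-identityˡ _)) (*-congʳ (sym inverse))))
             (solve 4 (λ x y d q → x :* y :* (q :* d) :- y :* (y :* d) :* q := y :* d :* ((x :- y) :* q)) refl ω ω⁻¹ (ω⁻¹ ^ v) q)) ⟩
      ω * (ω ^ v * ω ^ w) - (ω⁻¹ * ω⁻¹ ^ v) * ω ^ w + q * s ω v + ω⁻¹ * ω⁻¹ ^ v * ((ω - ω⁻¹) * q)
        ≈⟨ +-congˡ (*-congˡ (trans (*-congʳ (sym (+-cong (*-identityʳ _) (-‿cong (*-identityʳ _))))) (s₁*quantum w))) ⟩
      ω * (ω ^ v * ω ^ w) - (ω⁻¹ * ω⁻¹ ^ v) * ω ^ w + q * s ω v + ω⁻¹ * ω⁻¹ ^ v * (ω ^ w - ω⁻¹ ^ w)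
        ≈⟨ solve 6 (λ A y a d e Q → A :- y :* d :* a :+ Q :+ y :* d :* (a :- e) := A :- y :* (d :* e) :+ Q)
             refl (ω * (ω ^ v * ω ^ w)) ω⁻¹ (ω ^ w) (ω⁻¹ ^ v) (ω⁻¹ ^ w) (q * s ω v) ⟩
      ω * (ω ^ v * ω ^ w) - ω⁻¹ * (ω⁻¹ ^ v * ω⁻¹ ^ w) + q * s ω v
        ≈⟨ +-congʳ (+-cong (*-congˡ (^-homo-* ω v w)) (-‿cong (*-congˡ (^-homo-* ω⁻¹ v w)))) ⟨
      s ω (suc (v ℕ.+ w)) + q * s ω v ∎
      where q = quantum ω w

    clebschGordan-correct : ∀ w v → quantum ω w * s ω v ≈ S (clebschGordan w v) ω
    clebschGordan-correct zero    v       = zeroˡ _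
    clebschGordan-correct (suc w) zero    = trans (*-congˡ s₀≈0) (zeroʳ _)
    clebschGordan-correct (suc w) (suc v) =
      trans (quantum-step w v) (+-congˡ (clebschGordan-correct w v))

    -- Beyond the truncation point `quantum-s-swap` turns [w] into s(w), where reflection applies,
    -- and back again; then s(v) is reflected directly.
    fuse-correct : ∀ {w v} → w ≤ suc m → v ≤ suc m → quantum ω w * s ω v ≈ S (fuse m w v) ω
    fuse-correct {w} {v} w≤h v≤h with w ℕ.+ v ℕ.≤? suc m
    ... | yes _ = clebschGordan-correct w v
    ... | no _  = begin
      quantum ω w * s ω v                              ≈⟨ quantum-s-swap w v ⟩
      s ω w * quantum ω v                              ≈⟨ *-congʳ (s-reflect w≤h) ⟨
      s ω (suc m ℕ.∸ w) * quantum ω v                  ≈⟨ quantum-s-swap (suc m ℕ.∸ w) v ⟨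
      quantum ω (suc m ℕ.∸ w) * s ω v                  ≈⟨ *-congˡ (s-reflect v≤h) ⟨
      quantum ω (suc m ℕ.∸ w) * s ω (suc m ℕ.∸ v)      ≈⟨ clebschGordan-correct (suc m ℕ.∸ w) (suc m ℕ.∸ v) ⟩
      S (clebschGordan (suc m ℕ.∸ w) (suc m ℕ.∸ v)) ω  ∎

    mul-correct : ∀ {w L} → w ≤ suc m → All (Label m) L →
      S (concatMap (fuse m w) L) ω ≈ quantum ω w * S L ω
    mul-correct w≤h [] = sym (zeroʳ _)
    mul-correct {w} {v ∷ L} w≤h (v-lab ∷ L-lab) = begin
      S (fuse m w v ++ concatMap (fuse m w) L) ω
        ≈⟨ ∑-++ (fuse m w v) _ _ ⟩
      S (fuse m w v) ω + S (concatMap (fuse m w) L) ω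
        ≈⟨ +-cong (sym (fuse-correct w≤h (ℕ.m≤n⇒m≤1+n (proj₂ v-lab)))) (mul-correct w≤h L-lab) ⟩
      quantum ω w * s ω v + quantum ω w * S L ω
        ≈⟨ distribˡ _ _ _ ⟨
      quantum ω w * S (v ∷ L) ω ∎

    quantum-annihilates : ∀ w L → s ω w ≈ 0# → quantum ω w * S L ω ≈ 0#
    quantum-annihilates w L sw≈0 = trans (*-∑ L _ _)
      (∑-zero L (λ v → trans (quantum-s-swap w v) (trans (*-congʳ sw≈0) (zeroˡ _))))

  -- L′ represents the product of L with [1][2]⋯[k].
  mulAll : ∀ k → k ≤ m → ∀ {L} → Labels m L → ∃ λ L′ → Labels m L′ ∧′
    (∀ {ω} → Odd ω → (S L ω ≈ 0# → S L′ ω ≈ 0#) ∧′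
      (∀ {w} → 0 < w → w ≤ k → s ω w ≈ 0# → S L′ ω ≈ 0#))
  mulAll zero    _   {L} L-lab = L , L-lab , λ _ → (λ h → h) , λ { (s≤s _) () _ }
  mulAll (suc k) k<m L-lab with mulAll k (ℕ.<⇒≤ k<m) L-lab
  ... | L′ , L′-lab , h = concatMap (fuse m (suc k)) L′ ,
    concatMap-labels (fuse-labels (s≤s z≤n , k<m)) L′-lab ,
    λ {ω} odd → let mul = mul-correct odd {suc k} (ℕ.m≤n⇒m≤1+n k<m) (proj₂ L′-lab)
                    keep = λ (z : S L′ ω ≈ 0#) → trans mul (trans (*-congˡ z) (zeroʳ _)) in
      (λ z → keep (proj₁ (h odd) z)) ,
      λ {w} 0<w w≤1+k sw≈0 → case odd mul keep 0<w (ℕ.m≤n⇒m<n∨m≡n w≤1+k) sw≈0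
    where
    case : ∀ {ω} → Odd ω → S (concatMap (fuse m (suc k)) L′) ω ≈ quantum ω (suc k) * S L′ ω →
      (S L′ ω ≈ 0# → S (concatMap (fuse m (suc k)) L′) ω ≈ 0#) →
      ∀ {w} → 0 < w → w < suc k ⊎ w ≡ suc k → s ω w ≈ 0# → S (concatMap (fuse m (suc k)) L′) ω ≈ 0#
    case odd mul keep 0<w (inj₁ (s≤s w≤k)) sw≈0 = keep (proj₂ (h odd) 0<w w≤k sw≈0)
    -- Here [k + 1] itself need not vanish (s(1) may be zero as well), but its product with any s(v)
    -- is s(k + 1)·[v] = 0.
    case odd mul keep 0<w (inj₂ ≡.refl)    sw≈0 = trans mul (quantum-annihilates odd (suc k) L′ sw≈0)

  -- Each s(w) = s(1)·[w] gives one factor s(1) and one fusion with w. The extra s(1) on the left is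
  -- the label 1 from which the fusions start, so the empty product fits as well.
  product-labels : 1 ≤ m → ∀ {n} (w : Fin n → ℕ) → (∀ e → Label m (w e)) →
    ∃ λ L → Labels m L ∧′ (∀ {ω} → Odd ω → s ω 1 * ∏ (λ e → s ω (w e)) ≈ s ω 1 ^ n * S L ω)
  product-labels 1≤m {zero} w w-lab = 1 ∷ [] , ((λ ()) , (s≤s z≤n , 1≤m) ∷ []) ,
    λ odd → trans (*-identityʳ _) (sym (trans (*-identityˡ _) (+-identityʳ _)))
  product-labels 1≤m {suc n} w w-lab with product-labels 1≤m (λ e → w (suc e)) (λ e → w-lab (suc e))
  ... | L , L-lab , h = concatMap (fuse m (w zero)) L , concatMap-labels (fuse-labels (w-lab zero)) L-lab ,
    λ {ω} odd → begin
      s ω 1 * (s ω (w zero) * ∏ (λ e → s ω (w (suc e))))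
        ≈⟨ solve 3 (λ a b c → a :* (b :* c) := b :* (a :* c)) refl _ _ _ ⟩
      s ω (w zero) * (s ω 1 * ∏ (λ e → s ω (w (suc e))))
        ≈⟨ *-cong (sym (s₁*quantum odd (w zero))) (h odd) ⟩
      s ω 1 * quantum ω (w zero) * (s ω 1 ^ n * S L ω)
        ≈⟨ solve 4 (λ a b c d → a :* b :* (c :* d) := a :* c :* (b :* d)) refl _ _ _ _ ⟩
      s ω 1 ^ suc n * (quantum ω (w zero) * S L ω)
        ≈⟨ *-congˡ (mul-correct odd (ℕ.m≤n⇒m≤1+n (proj₂ (w-lab zero))) (proj₂ L-lab)) ⟨
      s ω 1 ^ suc n * S (concatMap (fuse m (w zero)) L) ω ∎

-- Positivity

private
  rearrange-above : ∀ a u d → 2 ℕ.* (a ℕ.+ (d ℕ.+ u)) ≡ (a ℕ.+ u) ℕ.* 2 ℕ.+ 2 ℕ.* d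
  rearrange-above = solve-∀

  rearrange-below₁ : ∀ a x d → 2 ℕ.* (a ℕ.+ x) ℕ.+ 2 ℕ.* d ≡ 2 ℕ.* (a ℕ.+ (d ℕ.+ x))
  rearrange-below₁ = solve-∀

  rearrange-below₂ : ∀ h d d′ → 2 ℕ.* ((d ℕ.+ d′) ℕ.+ h) ≡ (h ℕ.+ h) ℕ.+ 2 ℕ.* d ℕ.+ 2 ℕ.* d′
  rearrange-below₂ = solve-∀

-- Together with `double-below`, reduces the exponent 2(N - u + x) modulo N = 2h for distinct labels
-- u and x; in both cases the residue lies strictly between 0 and N.
double-above : ∀ {N u x} → u ≤ N → u < x → 2 ℕ.* (N ℕ.∸ u ℕ.+ x) ≡ N ℕ.* 2 ℕ.+ 2 ℕ.* (x ℕ.∸ u)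
double-above {N} {u} {x} u≤N u<x = begin
  2 ℕ.* (N ℕ.∸ u ℕ.+ x)                       ≡⟨ ≡.cong (λ y → 2 ℕ.* (N ℕ.∸ u ℕ.+ y)) (ℕ.m∸n+n≡m (ℕ.<⇒≤ u<x)) ⟨
  2 ℕ.* (N ℕ.∸ u ℕ.+ (x ℕ.∸ u ℕ.+ u))         ≡⟨ rearrange-above (N ℕ.∸ u) u (x ℕ.∸ u) ⟩
  (N ℕ.∸ u ℕ.+ u) ℕ.* 2 ℕ.+ 2 ℕ.* (x ℕ.∸ u)   ≡⟨ ≡.cong (λ y → y ℕ.* 2 ℕ.+ 2 ℕ.* (x ℕ.∸ u)) (ℕ.m∸n+n≡m u≤N) ⟩
  N ℕ.* 2 ℕ.+ 2 ℕ.* (x ℕ.∸ u)                 ∎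
  where open ≡.≡-Reasoning

double-below : ∀ {h u x} → u ≤ h ℕ.+ h → x < u → u ℕ.∸ x ≤ h →
  2 ℕ.* (h ℕ.+ h ℕ.∸ u ℕ.+ x) ≡ (h ℕ.+ h) ℕ.+ 2 ℕ.* (h ℕ.∸ (u ℕ.∸ x))
double-below {h} {u} {x} u≤N x<u d≤h = ℕ.+-cancelʳ-≡ (2 ℕ.* d) _ _ (begin
  2 ℕ.* (h ℕ.+ h ℕ.∸ u ℕ.+ x) ℕ.+ 2 ℕ.* d          ≡⟨ rearrange-below₁ (h ℕ.+ h ℕ.∸ u) x d ⟩
  2 ℕ.* (h ℕ.+ h ℕ.∸ u ℕ.+ (d ℕ.+ x))              ≡⟨ ≡.cong (λ y → 2 ℕ.* (h ℕ.+ h ℕ.∸ u ℕ.+ y)) (ℕ.m∸n+n≡m (ℕ.<⇒≤ x<u)) ⟩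
  2 ℕ.* (h ℕ.+ h ℕ.∸ u ℕ.+ u)                      ≡⟨ ≡.cong (2 ℕ.*_) (ℕ.m∸n+n≡m u≤N) ⟩
  2 ℕ.* (h ℕ.+ h)                                  ≡⟨ ≡.cong (λ y → 2 ℕ.* (y ℕ.+ h)) (ℕ.m∸n+n≡m d≤h) ⟨
  2 ℕ.* ((h ℕ.∸ d ℕ.+ d) ℕ.+ h)                    ≡⟨ rearrange-below₂ h (h ℕ.∸ d) d ⟩
  (h ℕ.+ h) ℕ.+ 2 ℕ.* (h ℕ.∸ d) ℕ.+ 2 ℕ.* d        ∎)
  where
  open ≡.≡-Reasoning
  d = u ℕ.∸ x

odd-prime-divisor : ∀ {q} i → Prime q → q ∣ suc (2 ℕ.* i) → ¬ q ∣ 2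
odd-prime-divisor i q-prime q∣j q∣2 with irreducible[2] q∣2
... | inj₁ ≡.refl = ¬prime[1] q-prime
... | inj₂ ≡.refl with ∣1⇒≡1 (∣m+n∣m⇒∣n (≡.subst (2 ∣_) (ℕ.+-comm 1 (2 ℕ.* i)) q∣j) (m∣m*n i))
...   | ()

module Positivity {c ℓ : Level} (K : CommutativeRing c ℓ)
  (domain : IsIntegralDomain K) (charZero : CharZero K)
  (m : ℕ) (ζ : CommutativeRing.Carrier K)
  (prim : IsPrimitiveRoot K (2 ℕ.* m ℕ.+ 2) ζ) (1≤m : 1 ≤ m) where

  open CommutativeRing K hiding (zero)
  open Sums K
  open PowerSums K
  open IntegerImage K
  open QuantumIntegers K m
  open import Algebra.Properties.Semiring.Exp semiring
    using (_^_; ^-homo-*; ^-assocʳ; ^-congˡ)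
  open import Algebra.Properties.Semiring.Mult semiring using (_×_; ×-homo-+)
  open import Algebra.Properties.Group +-group using () renaming (inverseˡ-unique to -‿uniqueˡ)
  open import Relation.Binary.Reasoning.Setoid setoid

  N h : ℕ
  N = 2 ℕ.* m ℕ.+ 2
  h = suc m

  instance
    N≢0 : NonZero N
    N≢0 = ℕ.>-nonZero (ℕ.≤-trans (s≤s z≤n) (ℕ.m≤n+m 2 (2 ℕ.* m)))

  open Landau K domain charZero N ζ prim using (ζᴺ; conjugate-zeros)

  h+h≡N : h ℕ.+ h ≡ N
  h+h≡N = eq m
    where
    eq : ∀ m → suc m ℕ.+ suc m ≡ 2 ℕ.* m ℕ.+ 2
    eq = solve-∀

  h<N : h < N
  h<N = ≡.subst (h <_) h+h≡N (ℕ.m<m+n h (s≤s z≤n))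

  x-y≈0⇒x≈y : ∀ {x y} → x - y ≈ 0# → x ≈ y
  x-y≈0⇒x≈y {x} {y} x-y≈0 = begin
    x              ≈⟨ solve 2 (λ x y → x := x :- y :+ y) refl x y ⟩
    x - y + y      ≈⟨ +-congʳ x-y≈0 ⟩
    0# + y         ≈⟨ +-identityˡ y ⟩
    y              ∎

  -- ζ^h is a square root of 1, and primitivity excludes 1 itself.
  ζ-odd : Odd ζ
  ζ-odd = [ (λ z-1≈0 → ⊥-elim (proj₂ prim h (s≤s z≤n) h<N (x-y≈0⇒x≈y z-1≈0))) , -‿uniqueˡ (ζ ^ h) 1# ]′
    (domain (ζ ^ h - 1#) (ζ ^ h + 1#) (begin
      (ζ ^ h - 1#) * (ζ ^ h + 1#)
        ≈⟨ solve 2 (λ x o → (x :- o) :* (x :+ o) := x :* x :- o :* o) refl _ _ ⟩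
      ζ ^ h * ζ ^ h - 1# * 1#
        ≈⟨ +-cong (trans (sym (^-homo-* ζ h h)) (trans (reflexive (≡.cong (ζ ^_) h+h≡N)) ζᴺ)) (-‿cong (*-identityˡ 1#)) ⟩
      1# - 1#
        ≈⟨ -‿inverseʳ 1# ⟩
      0# ∎))

  oddPower : ℕ → ℕ
  oddPower i = suc (2 ℕ.* i)

  ζ^odd-odd : ∀ i → Odd (ζ ^ oddPower i)
  ζ^odd-odd i = begin
    (ζ ^ oddPower i) ^ h             ≈⟨ ^-assocʳ ζ (oddPower i) h ⟩
    ζ ^ (oddPower i ℕ.* h)           ≡⟨ ≡.cong (ζ ^_) (eq i m) ⟩
    ζ ^ (h ℕ.+ N ℕ.* i)              ≈⟨ ^-homo-* ζ h _ ⟩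
    ζ ^ h * ζ ^ (N ℕ.* i)            ≈⟨ *-cong ζ-odd (trans (sym (^-assocʳ ζ N i)) (trans (^-congˡ i ζᴺ) (1^n≈1 i))) ⟩
    - 1# * 1#                        ≈⟨ *-identityʳ _ ⟩
    - 1#                             ∎
    where
    eq : ∀ i m → suc (2 ℕ.* i) ℕ.* suc m ≡ suc m ℕ.+ (2 ℕ.* m ℕ.+ 2) ℕ.* i
    eq = solve-∀

  geometric : ∀ a x n → (x - 1#) * ∑ (downFrom n) (λ i → a * x ^ i) ≈ a * (x ^ n - 1#)
  geometric a x zero    = trans (zeroʳ _) (sym (trans (*-congˡ (-‿inverseʳ 1#)) (zeroʳ _)))
  geometric a x (suc n) = trans (distribˡ _ _ _) (trans (+-congˡ (geometric a x n))
    (solve 4 (λ x o a y → (x :- o) :* (a :* y) :+ a :* (y :- o) := a :* (x :* y :- o) :+ (a :* y :- o :* (a :* y))) refl x 1# a (x ^ n)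
      ⟨ trans ⟩ trans (+-congˡ (trans (+-congˡ (-‿cong (*-identityˡ _))) (-‿inverseʳ _))) (+-identityʳ _)))

  oddSum : ℕ → Carrier
  oddSum k = ∑ (downFrom h) (λ i → (ζ ^ oddPower i) ^ k)

  oddSum≈ : ∀ k → oddSum k ≈ ∑ (downFrom h) (λ i → ζ ^ k * (ζ ^ (2 ℕ.* k)) ^ i)
  oddSum≈ k = ∑-cong (downFrom h) λ i → begin
    (ζ ^ oddPower i) ^ k                ≈⟨ ^-assocʳ ζ (oddPower i) k ⟩
    ζ ^ (oddPower i ℕ.* k)              ≡⟨ ≡.cong (ζ ^_) (eq i k) ⟩
    ζ ^ (k ℕ.+ 2 ℕ.* k ℕ.* i)           ≈⟨ ^-homo-* ζ k _ ⟩
    ζ ^ k * ζ ^ (2 ℕ.* k ℕ.* i)         ≈⟨ *-congˡ (^-assocʳ ζ (2 ℕ.* k) i) ⟨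
    ζ ^ k * (ζ ^ (2 ℕ.* k)) ^ i         ∎
    where
    eq : ∀ i k → suc (2 ℕ.* i) ℕ.* k ≡ k ℕ.+ 2 ℕ.* k ℕ.* i
    eq = solve-∀

  -- A geometric series with ratio ζ^(2k), whose h-th power is 1; if the ratio is not 1, the domain
  -- property leaves only a zero sum.
  oddSum-zero : ∀ k → ¬ ζ ^ (2 ℕ.* k) ≈ 1# → oddSum k ≈ 0#
  oddSum-zero k x≉1 = [ (λ x-1≈0 → ⊥-elim (x≉1 (x-y≈0⇒x≈y x-1≈0))) , trans (oddSum≈ k) ]′
    (domain (x - 1#) (∑ (downFrom h) (λ i → ζ ^ k * x ^ i)) product≈0)
    where
    x = ζ ^ (2 ℕ.* k)
    eq : ∀ k m → 2 ℕ.* k ℕ.* suc m ≡ (2 ℕ.* m ℕ.+ 2) ℕ.* k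
    eq = solve-∀
    x^h≈1 : x ^ h ≈ 1#
    x^h≈1 = begin
      x ^ h                     ≈⟨ ^-assocʳ ζ (2 ℕ.* k) h ⟩
      ζ ^ (2 ℕ.* k ℕ.* h)       ≡⟨ ≡.cong (ζ ^_) (eq k m) ⟩
      ζ ^ (N ℕ.* k)             ≈⟨ ^-assocʳ ζ N k ⟨
      (ζ ^ N) ^ k               ≈⟨ trans (^-congˡ k ζᴺ) (1^n≈1 k) ⟩
      1#                        ∎
    product≈0 : (x - 1#) * ∑ (downFrom h) (λ i → ζ ^ k * x ^ i) ≈ 0#
    product≈0 = begin
      (x - 1#) * ∑ (downFrom h) (λ i → ζ ^ k * x ^ i)    ≈⟨ geometric (ζ ^ k) x h ⟩
      ζ ^ k * (x ^ h - 1#)                               ≈⟨ *-congˡ (+-congʳ x^h≈1) ⟩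
      ζ ^ k * (1# - 1#)                                  ≈⟨ trans (*-congˡ (-‿inverseʳ 1#)) (zeroʳ _) ⟩
      0#                                                 ∎

  oddSum-N : oddSum N ≈ h × 1#
  oddSum-N = trans (∑-cong (downFrom h) (λ i → begin
      (ζ ^ oddPower i) ^ N      ≈⟨ ^-assocʳ ζ (oddPower i) N ⟩
      ζ ^ (oddPower i ℕ.* N)    ≡⟨ ≡.cong (ζ ^_) (ℕ.*-comm (oddPower i) N) ⟩
      ζ ^ (N ℕ.* oddPower i)    ≈⟨ ^-assocʳ ζ N (oddPower i) ⟨
      (ζ ^ N) ^ oddPower i      ≈⟨ trans (^-congˡ (oddPower i) ζᴺ) (1^n≈1 (oddPower i)) ⟩
      1#                        ∎)) (ones h)
    where
    ones : ∀ n → ∑ (downFrom n) (λ _ → 1#) ≈ n × 1#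
    ones zero    = refl
    ones (suc n) = +-congˡ (ones n)

  2h≡N : 2 ℕ.* h ≡ N
  2h≡N = ≡.trans (≡.cong (h ℕ.+_) (ℕ.+-identityʳ h)) h+h≡N

  -- The exponent lies strictly between N and 2N, or strictly between 2N and 3N.
  ζ^2k≉1 : ∀ u x → Label m u → Label m x → x ≢ u → ¬ ζ ^ (2 ℕ.* (N ℕ.∸ u ℕ.+ x)) ≈ 1#
  ζ^2k≉1 u x (0<u , u≤m) (0<x , x≤m) x≢u ζ^≈1 with ℕ.<-cmp x u
  ... | tri≈ _ x≡u _ = x≢u x≡u
  ... | tri> _ _ u<x = proj₂ prim (2 ℕ.* d) (ℕ.m<n⇒0<n (ℕ.*-monoʳ-< 2 (ℕ.m<n⇒0<n∸m u<x)))
      (ℕ.<-≤-trans (ℕ.*-monoʳ-< 2 (ℕ.≤-<-trans (ℕ.m∸n≤m x u) (s≤s x≤m))) (ℕ.≤-reflexive 2h≡N))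
      (begin
        ζ ^ (2 ℕ.* d)                         ≈⟨ *-identityˡ _ ⟨
        1# * ζ ^ (2 ℕ.* d)                    ≈⟨ *-congʳ (trans (^-congˡ 2 ζᴺ) (1^n≈1 2)) ⟨
        (ζ ^ N) ^ 2 * ζ ^ (2 ℕ.* d)           ≈⟨ *-congʳ (^-assocʳ ζ N 2) ⟩
        ζ ^ (N ℕ.* 2) * ζ ^ (2 ℕ.* d)         ≈⟨ ^-homo-* ζ (N ℕ.* 2) (2 ℕ.* d) ⟨
        ζ ^ (N ℕ.* 2 ℕ.+ 2 ℕ.* d)             ≡⟨ ≡.cong (ζ ^_) (double-above u≤N u<x) ⟨
        ζ ^ (2 ℕ.* (N ℕ.∸ u ℕ.+ x))           ≈⟨ ζ^≈1 ⟩
        1#                                    ∎)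
    where
    d = x ℕ.∸ u
    u≤N : u ≤ N
    u≤N = ℕ.≤-trans u≤m (ℕ.≤-trans (ℕ.n≤1+n m) (ℕ.<⇒≤ h<N))
  ... | tri< x<u _ _ = proj₂ prim (2 ℕ.* d) (ℕ.m<n⇒0<n (ℕ.*-monoʳ-< 2 (ℕ.m<n⇒0<n∸m d′<h)))
      (ℕ.<-≤-trans (ℕ.*-monoʳ-< 2 (ℕ.∸-monoʳ-< (ℕ.m<n⇒0<n∸m x<u) (ℕ.<⇒≤ d′<h))) (ℕ.≤-reflexive 2h≡N))
      (begin
        ζ ^ (2 ℕ.* d)                         ≈⟨ *-identityˡ _ ⟨
        1# * ζ ^ (2 ℕ.* d)                    ≈⟨ *-congʳ ζᴺ ⟨
        ζ ^ N * ζ ^ (2 ℕ.* d)                 ≈⟨ ^-homo-* ζ N (2 ℕ.* d) ⟨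
        ζ ^ (N ℕ.+ 2 ℕ.* d)                   ≡⟨ ≡.cong (ζ ^_) split ⟨
        ζ ^ (2 ℕ.* (N ℕ.∸ u ℕ.+ x))           ≈⟨ ζ^≈1 ⟩
        1#                                    ∎)
    where
    d = h ℕ.∸ (u ℕ.∸ x)
    d′<h : u ℕ.∸ x < h
    d′<h = ℕ.≤-<-trans (ℕ.m∸n≤m u x) (s≤s u≤m)
    split : 2 ℕ.* (N ℕ.∸ u ℕ.+ x) ≡ N ℕ.+ 2 ℕ.* d
    split = ≡.subst (λ y → 2 ℕ.* (y ℕ.∸ u ℕ.+ x) ≡ y ℕ.+ 2 ℕ.* d) h+h≡N
      (double-below (ℕ.≤-trans u≤m (ℕ.≤-trans (ℕ.n≤1+n m) (ℕ.m≤m+n h h))) x<u (ℕ.<⇒≤ d′<h))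

  coefficient : ℕ → ℕ → ℕ
  coefficient u x with x ℕ.≟ u
  ... | yes _ = h
  ... | no _  = 0

  coefficient-diag : ∀ u → coefficient u u ≡ h
  coefficient-diag u with u ℕ.≟ u
  ... | yes _  = ≡.refl
  ... | no u≢u = ⊥-elim (u≢u ≡.refl)

  -- Orthogonality of the characters j ↦ ζ^(jv) over the odd residues j modulo N; `coefficient` is h
  -- times the Kronecker delta.
  oddSum-shift : ∀ u x → Label m u → Label m x → oddSum (N ℕ.∸ u ℕ.+ x) ≈ coefficient u x × 1#
  oddSum-shift u x u-lab x-lab with x ℕ.≟ u
  ... | no x≢u     = oddSum-zero (N ℕ.∸ u ℕ.+ x) (ζ^2k≉1 u x u-lab x-lab x≢u)
  ... | yes ≡.refl = trans (reflexive (≡.cong oddSum (ℕ.m∸n+n≡m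
                       (ℕ.≤-trans (proj₂ u-lab) (ℕ.≤-trans (ℕ.n≤1+n m) (ℕ.<⇒≤ h<N)))))) oddSum-N

  multiplicity : ℕ → List ℕ → ℕ
  multiplicity u []      = 0
  multiplicity u (v ∷ L) = coefficient u v ℕ.+ coefficient u (h ℕ.∸ v) ℕ.+ multiplicity u L

  -- Pairing with ω^(−u), written ω^(N−u), counts the v ∈ L with v = u or h − v = u.
  fourier : ∀ u L → Label m u → All (Label m) L →
    ∑ (downFrom h) (λ i → (ζ ^ oddPower i) ^ (N ℕ.∸ u) * S L (ζ ^ oddPower i)) ≈ multiplicity u L × 1#
  fourier u []      u-lab []              = ∑-zero (downFrom h) (λ i → zeroʳ _)
  fourier u (v ∷ L) u-lab (v-lab ∷ L-lab) = begin
    ∑ (downFrom h) (λ i → ω i ^ a * (s (ω i) v + S L (ω i)))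
      ≈⟨ ∑-cong (downFrom h) (λ i → trans (distribˡ _ _ _) (+-congʳ (trans (*-congˡ (s≈ (ζ^odd-odd i) (ℕ.m≤n⇒m≤1+n (proj₂ v-lab))))
           (trans (distribˡ _ _ _) (sym (+-cong (^-homo-* (ω i) a v) (^-homo-* (ω i) a (h ℕ.∸ v)))))))) ⟩
    ∑ (downFrom h) (λ i → ω i ^ (a ℕ.+ v) + ω i ^ (a ℕ.+ (h ℕ.∸ v)) + ω i ^ a * S L (ω i))
      ≈⟨ trans (∑-+ (downFrom h) _ _) (+-congʳ (∑-+ (downFrom h) _ _)) ⟩
    oddSum (a ℕ.+ v) + oddSum (a ℕ.+ (h ℕ.∸ v)) + ∑ (downFrom h) (λ i → ω i ^ a * S L (ω i))
      ≈⟨ +-cong (+-cong (oddSum-shift u v u-lab v-lab) (oddSum-shift u (h ℕ.∸ v) u-lab (reflect-label v-lab))) (fourier u L u-lab L-lab) ⟩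
    coefficient u v × 1# + coefficient u (h ℕ.∸ v) × 1# + multiplicity u L × 1#
      ≈⟨ trans (×-homo-+ 1# (coefficient u v ℕ.+ coefficient u (h ℕ.∸ v)) _) (+-congʳ (×-homo-+ 1# (coefficient u v) _)) ⟨
    multiplicity u (v ∷ L) × 1# ∎
    where
    a = N ℕ.∸ u
    ω = λ i → ζ ^ oddPower i

  -- Take the Fourier coefficient at the head u of the list: natural contributions cannot cancel,
  -- and the head alone contributes h = m + 1.
  positivity : ∀ L → Labels m L → ¬ (∀ i → S L (ζ ^ oddPower i) ≈ 0#)
  positivity []      (L≢[] , _)                   _      = L≢[] ≡.refl
  positivity (u ∷ L) (_    , lab@(u-lab ∷ L-lab)) S≈0 = nonzero (charZero (multiplicity u (u ∷ L))
    (trans (sym (fourier u (u ∷ L) u-lab lab))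
      (∑-zero (downFrom h) (λ i → trans (*-congˡ (S≈0 i)) (zeroʳ _)))))
    where
    nonzero : multiplicity u (u ∷ L) ≢ 0
    nonzero rewrite coefficient-diag u = λ ()

  exponents : List ℕ → List ℕ
  exponents = concatMap (λ v → v ∷ h ℕ.∸ v ∷ [])

  ev-exponents : ∀ {L ω} → Odd ω → All (Label m) L → ev (exponents L) ω ≈ S L ω
  ev-exponents odd []              = refl
  ev-exponents odd (v-lab ∷ L-lab) = trans (sym (+-assoc _ _ _))
    (+-cong (sym (s≈ odd (ℕ.m≤n⇒m≤1+n (proj₂ v-lab)))) (ev-exponents odd L-lab))

  -- Because s(w) = ω^(-w)·(ω^(2w) - 1).
  s-vanishes : ∀ {ω} → Odd ω → ∀ w → ω ^ w * ω ^ w ≈ 1# → s ω w ≈ 0#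
  s-vanishes {ω} odd w ω^2w≈1 = begin
    x - y                ≈⟨ +-cong (*-identityʳ _) (-‿cong (*-identityʳ _)) ⟨
    x * 1# - y * 1#      ≈⟨ +-cong (*-congˡ (inverse-^ odd w)) (-‿cong (*-congˡ ω^2w≈1)) ⟨
    x * (x * y) - y * (x * x)
                         ≈⟨ solve 2 (λ x y → x :* (x :* y) :- y :* (x :* x) := con (+ 0)) refl x y ⟩
    0#                   ∎
    where
    x = ω ^ w
    y = inv ω ^ w

  -- With d a common divisor of j and h, and w = h/d, the exponent 2jw equals N·(j/d).
  s-vanishes-common : ∀ i {d w j₁} → oddPower i ≡ j₁ ℕ.* d → h ≡ w ℕ.* d → s (ζ ^ oddPower i) w ≈ 0#
  s-vanishes-common i {d} {w} {j₁} j≡j₁d h≡wd = s-vanishes (ζ^odd-odd i) w (begin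
    (ζ ^ j) ^ w * (ζ ^ j) ^ w      ≈⟨ *-cong (^-assocʳ ζ j w) (^-assocʳ ζ j w) ⟩
    ζ ^ (j ℕ.* w) * ζ ^ (j ℕ.* w)  ≈⟨ ^-homo-* ζ (j ℕ.* w) (j ℕ.* w) ⟨
    ζ ^ (j ℕ.* w ℕ.+ j ℕ.* w)      ≡⟨ ≡.cong (ζ ^_) (≡.trans (≡.cong (λ k → k ℕ.* w ℕ.+ k ℕ.* w) j≡j₁d)
                                        (≡.trans (rearrange j₁ d w) (≡.cong (ℕ._* j₁)
                                          (≡.trans (≡.cong₂ ℕ._+_ (≡.sym h≡wd) (≡.sym h≡wd)) h+h≡N)))) ⟩
    ζ ^ (N ℕ.* j₁)                 ≈⟨ ^-assocʳ ζ N j₁ ⟨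
    (ζ ^ N) ^ j₁                   ≈⟨ trans (^-congˡ j₁ ζᴺ) (1^n≈1 j₁) ⟩
    1#                             ∎)
    where
    j = oddPower i
    rearrange : ∀ j d w → (j ℕ.* d) ℕ.* w ℕ.+ (j ℕ.* d) ℕ.* w ≡ (w ℕ.* d ℕ.+ w ℕ.* d) ℕ.* j
    rearrange = solve-∀

  -- Every odd j falls into one of two cases: prime to h, where the zero at ζ is conjugated to ζ^j,
  -- or gcd d > 1 with h, where the factor [h/d] annihilates. So L′ vanishes at all odd powers,
  -- against `positivity`.
  S-nonzero : ∀ L → Labels m L → ¬ S L ζ ≈ 0#
  S-nonzero L L-lab S≈0 with mulAll m ℕ.≤-refl L-lab
  ... | L′ , L′-lab , annihilate = conjugate-zeros (exponents L) (trans (ev-exponents ζ-odd (proj₂ L-lab)) S≈0)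
      (λ conj → positivity L′ L′-lab (λ i → vanish conj i (gcd (oddPower i) h ℕ.≟ 1)))
    where
    vanish : (∀ j → 0 < j → (∀ {q} → Prime q → q ∣ j → ¬ q ∣ N) → ev (exponents L) (ζ ^ j) ≈ 0#) →
      ∀ i → _ → S L′ (ζ ^ oddPower i) ≈ 0#
    vanish conj i (yes gcd≡1) = proj₁ (annihilate (ζ^odd-odd i))
      (trans (sym (ev-exponents (ζ^odd-odd i) (proj₂ L-lab))) (conj (oddPower i) (s≤s z≤n) coprime))
      where
      coprime : ∀ {q} → Prime q → q ∣ oddPower i → ¬ q ∣ N
      coprime {q} q-prime q∣j q∣N with euclidsLemma 2 h q-prime (≡.subst (q ∣_) (≡.sym 2h≡N) q∣N)
      ... | inj₁ q∣2 = odd-prime-divisor i q-prime q∣j q∣2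
      ... | inj₂ q∣h with ∣1⇒≡1 (≡.subst (q ∣_) gcd≡1 (gcd-greatest q∣j q∣h))
      ...   | ≡.refl = ¬prime[1] q-prime
    vanish conj i (no gcd≢1) with gcd[m,n]∣m (oddPower i) h | gcd[m,n]∣n (oddPower i) h
    ... | divides j₁ j≡ | divides w h≡ = proj₂ (annihilate (ζ^odd-odd i)) (0<w w {gcd (oddPower i) h} h≡) (w≤m w (gcd (oddPower i) h) h≡ gcd≢1)
            (s-vanishes-common i {gcd (oddPower i) h} {w} {j₁} j≡ h≡)
      where
      0<w : ∀ w {d} → h ≡ w ℕ.* d → 0 < w
      0<w (suc w) _ = s≤s z≤n
      w≤m : ∀ w d → h ≡ w ℕ.* d → d ≢ 1 → w ≤ m
      w≤m w zero          h≡ _   with ≡.trans h≡ (ℕ.*-zeroʳ w)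
      ... | ()
      w≤m w (suc zero)    h≡ d≢1 = ⊥-elim (d≢1 ≡.refl)
      w≤m w (suc (suc d)) h≡ _   = ℕ.≤-pred (≡.subst (w <_) (≡.sym h≡)
        (ℕ.m<m*n w (suc (suc d)) {{ℕ.>-nonZero (0<w w h≡)}} (s≤s (s≤s z≤n))))

-- The characteristic polynomial of a binary matroid

module BinaryMatroid where
  open ≡ using (refl; sym; trans; cong; cong₂; subst)

  true≢false : ∀ {b} → b ≡ true → b ≢ false
  true≢false refl ()

  ∧-true : ∀ {a b} → a ∧ b ≡ true → a ≡ true ∧′ b ≡ true
  ∧-true {true} {true} _ = refl , refl

  allᵇ⁻ : ∀ {n} {f : Fin n → Bool} → allᵇ f ≡ true → ∀ e → f e ≡ true
  allᵇ⁻ h zero    = proj₁ (∧-true h)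
  allᵇ⁻ h (suc e) = allᵇ⁻ (proj₂ (∧-true h)) e

  allᵇ⁺ : ∀ {n} {f : Fin n → Bool} → (∀ e → f e ≡ true) → allᵇ f ≡ true
  allᵇ⁺ {zero}  h = refl
  allᵇ⁺ {suc n} h = cong₂ _∧_ (h zero) (allᵇ⁺ (λ e → h (suc e)))

  allᵇ-false⁻ : ∀ {n} {f : Fin n → Bool} → allᵇ f ≡ false → ∃ λ e → f e ≡ false
  allᵇ-false⁻ {suc n} {f} h with f zero in eq
  ... | false = zero , eq
  ... | true  = let e , fe≡false = allᵇ-false⁻ h in suc e , fe≡false

  allᵇ-cong : ∀ {n} {f g : Fin n → Bool} → (∀ e → f e ≡ g e) → allᵇ f ≡ allᵇ g
  allᵇ-cong {zero}  h = refl
  allᵇ-cong {suc n} h = cong₂ _∧_ (h zero) (allᵇ-cong (λ e → h (suc e)))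

  allL⁻ : ∀ {A : Set} {P : A → Bool} {L x} → allL P L ≡ true → x ∈ L → P x ≡ true
  allL⁻ h (here refl) = proj₁ (∧-true h)
  allL⁻ h (there x∈L) = allL⁻ (proj₂ (∧-true h)) x∈L

  allL⁺ : ∀ {A : Set} {P : A → Bool} L → (∀ x → P x ≡ true) → allL P L ≡ true
  allL⁺ []      h = refl
  allL⁺ (x ∷ L) h = cong₂ _∧_ (h x) (allL⁺ L h)

  allL-false⁻ : ∀ {A : Set} {P : A → Bool} L → allL P L ≡ false → ∃ λ x → x ∈ L ∧′ P x ≡ false
  allL-false⁻ {P = P} (x ∷ L) h with P x in eq
  ... | false = x , here refl , eq
  ... | true  = let y , y∈L , Py = allL-false⁻ L h in y , there y∈L , Py

  anyL⁻ : ∀ {A : Set} {P : A → Bool} L → anyL P L ≡ true → ∃ λ x → x ∈ L ∧′ P x ≡ true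
  anyL⁻ {P = P} (x ∷ L) h with P x in eq
  ... | true  = x , here refl , eq
  ... | false = let y , y∈L , Py = anyL⁻ L h in y , there y∈L , Py

  anyL⁺ : ∀ {A : Set} {P : A → Bool} {L x} → x ∈ L → P x ≡ true → anyL P L ≡ true
  anyL⁺ {P = P} (here refl) Px rewrite Px = refl
  anyL⁺ {P = P} {y ∷ L} (there x∈L) Px with P y
  ... | true  = refl
  ... | false = anyL⁺ x∈L Px

  ∈-tuples : ∀ {A : Set} {L : List A} {l x xs} → x ∈ L → xs ∈ tuples L l → x ∷ xs ∈ tuples L (suc l)
  ∈-tuples {L = y ∷ L} {l} (here refl) xs∈ = ∈-++⁺ˡ (∈-map⁺ _ xs∈)
  ∈-tuples {L = y ∷ L} {l} (there x∈L) xs∈ = ∈-++⁺ʳ (map (y ∷_) (tuples (y ∷ L) l)) (rest x∈L xs∈)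
    where
    rest : ∀ {M T x xs} → x ∈ M → xs ∈ T → x ∷ xs ∈ concatMap (λ z → map (z ∷_) T) M
    rest {z ∷ M} {T} (here refl) xs∈ = ∈-++⁺ˡ (∈-map⁺ _ xs∈)
    rest {z ∷ M} {T} (there x∈M) xs∈ = ∈-++⁺ʳ (map (z ∷_) T) (rest x∈M xs∈)

  ∈-tuples⁻ : ∀ {A : Set} {L : List A} {l x xs} → x ∷ xs ∈ tuples L (suc l) → x ∈ L ∧′ xs ∈ tuples L l
  ∈-tuples⁻ {L = L} {l} = go L
    where
    go : ∀ M {x xs} → x ∷ xs ∈ concatMap (λ z → map (z ∷_) (tuples L l)) M → x ∈ M ∧′ xs ∈ tuples L l
    go (z ∷ M) h with ∈-++⁻ (map (z ∷_) (tuples L l)) h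
    ... | inj₂ h′ = let x∈ , xs∈ = go M h′ in there x∈ , xs∈
    ... | inj₁ h′ with ∈-map⁻ (z ∷_) h′
    ...   | _ , ys∈ , refl = here refl , ys∈

  -- Without function extensionality the enumeration reaches a function only up to pointwise
  -- equality, so later arguments pass to a listed representative.
  allFuns-complete : ∀ {n} (f : Fin n → Bool) → ∃ λ g → g ∈ allFuns n ∧′ (∀ e → g e ≡ f e)
  allFuns-complete {zero}  f = (λ ()) , here refl , λ ()
  allFuns-complete {suc n} f with allFuns-complete (λ e → f (suc e))
  ... | g , g∈ , g≗f = cons (f zero) g , cons∈ (f zero) g∈ , λ { zero → refl ; (suc e) → g≗f e }
    where
    cons∈ : ∀ b {g L} → g ∈ L → cons {n} b g ∈ concatMap (λ f → cons false f ∷ cons true f ∷ []) L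
    cons∈ false (here refl) = here refl
    cons∈ true  (here refl) = there (here refl)
    cons∈ b     (there g∈L) = there (there (cons∈ b g∈L))

  maxL-attained : ∀ {A : Set} (f : A → ℕ) x L → ∃ λ y → y ∈ x ∷ L ∧′ f y ≡ maxL (map f (x ∷ L))
  maxL-attained f x []      = x , here refl , sym (ℕ.⊔-identityʳ (f x))
  maxL-attained f x (y ∷ L) with ℕ.⊔-sel (f x) (maxL (map f (y ∷ L)))
  ... | inj₁ max≡fx   = x , here refl , sym max≡fx
  ... | inj₂ max≡rest = let z , z∈ , fz≡ = maxL-attained f y L
                        in z , there z∈ , trans fz≡ (sym max≡rest)

  maxL-attained∈ : ∀ {A : Set} (f : A → ℕ) {x} L → x ∈ L → ∃ λ y → y ∈ L ∧′ f y ≡ maxL (map f L)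
  maxL-attained∈ f (x ∷ L) _ = maxL-attained f x L

  ≤-maxL : ∀ {A : Set} (f : A → ℕ) {x} L → x ∈ L → f x ≤ maxL (map f L)
  ≤-maxL f (x ∷ L) (here refl) = ℕ.m≤m⊔n (f x) _
  ≤-maxL f (y ∷ L) (there x∈L) = ℕ.≤-trans (≤-maxL f L x∈L) (ℕ.m≤n⊔m (f y) _)

  count-cong : ∀ {n} {f g : Fin n → Bool} → (∀ e → f e ≡ g e) → count f ≡ count g
  count-cong {zero}  h = refl
  count-cong {suc n} h = cong₂ (λ b k → (if b then 1 else 0) ℕ.+ k) (h zero) (count-cong (λ e → h (suc e)))

  count-insert : ∀ {n} {f g : Fin n → Bool} e → f e ≡ false → g e ≡ true →
    (∀ e′ → e′ ≢ e → g e′ ≡ f e′) → count g ≡ suc (count f)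
  count-insert zero    fe ge h rewrite fe | ge = cong suc (count-cong (λ e → h (suc e) (λ ())))
  count-insert {suc n} {f} {g} (suc e) fe ge h =
    trans (cong₂ (λ b k → (if b then 1 else 0) ℕ.+ k) (h zero (λ ()))
            (count-insert e fe ge (λ e′ e′≢e → h (suc e′) (e′≢e ∘ Fin.suc-injective))))
      (ℕ.+-suc _ _)

  count≡ᵇ0⁻ : ∀ {n} (f : Fin n → Bool) → (count f ℕ.≡ᵇ 0) ≡ true → ∀ e → f e ≡ false
  count≡ᵇ0⁻ {suc n} f h e with f zero in eq
  count≡ᵇ0⁻ {suc n} f () e       | true
  count≡ᵇ0⁻ {suc n} f h  zero    | false = eq
  count≡ᵇ0⁻ {suc n} f h  (suc e) | false = count≡ᵇ0⁻ (λ e → f (suc e)) h e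

  ⊕-false : ∀ {n} {f : Fin n → Bool} → (∀ i → f i ≡ false) → ⊕-sum f ≡ false
  ⊕-false {zero}  h = refl
  ⊕-false {suc n} h = cong₂ _xor_ (h zero) (⊕-false (λ i → h (suc i)))

  ∧-⊕ : ∀ {n} b (f : Fin n → Bool) → b ∧ ⊕-sum f ≡ ⊕-sum (λ i → b ∧ f i)
  ∧-⊕ {n} false f = sym (⊕-false {n} {λ _ → false} (λ _ → refl))
  ∧-⊕ true  f = refl

  module Z = Sums ℤ.+-*-commutativeRing
  open Z using (∑; ∏; ind)

  open CommutativeRing ℤ.+-*-commutativeRing using (*-identityˡ; *-identityʳ; *-assoc; *-comm)

  ∑-cong∈ : {A : Set} (L : List A) {f g : A → ℤ} → (∀ {x} → x ∈ L → f x ≡ g x) → ∑ L f ≡ ∑ L g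
  ∑-cong∈ []      h = refl
  ∑-cong∈ (x ∷ L) h = cong₂ _+ℤ_ (h (here refl)) (∑-cong∈ L (h ∘ there))

  ∏-single : ∀ {n} {f : Fin n → ℤ} e → (∀ e′ → e′ ≢ e → f e′ ≡ + 1) → ∏ f ≡ f e
  ∏-single {f = f} zero    h = trans (cong (f zero *ℤ_) (Z.∏-one (λ e → h (suc e) (λ ())))) (*-identityʳ _)
  ∏-single {f = f} (suc e) h = trans
    (cong₂ _*ℤ_ (h zero (λ ())) (∏-single e (λ e′ e′≢e → h (suc e′) (e′≢e ∘ Fin.suc-injective))))
    (*-identityˡ _)

  ∏-count : ∀ {n} (k : ℤ) (S : Fin n → Bool) → ∏ (λ e → if S e then k else + 1) ≡ k ^ℤ count S
  ∏-count {zero}  k S = refl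
  ∏-count {suc n} k S with S zero
  ... | true  = cong (k *ℤ_) (∏-count k (λ e → S (suc e)))
  ... | false = trans (*-identityˡ _) (∏-count k (λ e → S (suc e)))

  -- The nontrivial additive character of GF(2).
  sgn : Bool → ℤ
  sgn b = if b then -ℤ + 1 else + 1

  sgn-xor : ∀ a b → sgn (a xor b) ≡ sgn a *ℤ sgn b
  sgn-xor false b     = sym (*-identityˡ _)
  sgn-xor true  false = refl
  sgn-xor true  true  = refl

  sgn-⊕ : ∀ {n} (f : Fin n → Bool) → sgn (⊕-sum f) ≡ ∏ (λ i → sgn (f i))
  sgn-⊕ {zero}  f = refl
  sgn-⊕ {suc n} f = trans (sgn-xor (f zero) _) (cong (sgn (f zero) *ℤ_) (sgn-⊕ (λ i → f (suc i))))

  ind-empty : ∀ {n} (T : Fin n → Bool) → ind (count T ℕ.≡ᵇ 0) ≡ ∏ (λ e → ind (not (T e)))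
  ind-empty {zero}  T = refl
  ind-empty {suc n} T with T zero
  ... | true  = refl
  ... | false = trans (ind-empty (λ e → T (suc e))) (sym (*-identityˡ _))

  ∑-ind : {A : Set} (P : A → Bool) (L : List A) → ∃ λ k → ∑ L (λ x → ind (P x)) ≡ + k
    ∧′ (k ≡ 0 → ∀ {x} → x ∈ L → P x ≡ false) ∧′ (k ≢ 0 → ∃ λ x → x ∈ L ∧′ P x ≡ true)
  ∑-ind P []      = 0 , refl , (λ _ ()) , λ 0≢0 → ⊥-elim (0≢0 refl)
  ∑-ind P (x ∷ L) with P x in eq | ∑-ind P L
  ... | true  | k , ∑≡k , _ , _ = suc k , cong (+ 1 +ℤ_) ∑≡k , (λ ()) , λ _ → x , here refl , eq
  ... | false | k , ∑≡k , all , some = k , trans (ℤ.+-identityˡ _) ∑≡k ,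
        (λ { k≡0 (here refl) → eq ; k≡0 (there y∈L) → all k≡0 y∈L }) ,
        λ k≢0 → let y , y∈L , Py = some k≢0 in y , there y∈L , Py

  module MatroidRank {p n : ℕ} (G : Matrix p n) where

    -- Both sides are -1 to the power ∑ x_i·G_ie·T_e: the row combination paired with T is x paired
    -- with the column sum.
    pairing : ∀ x T → ∏ (λ e → sgn (T e ∧ rowComb G x e)) ≡ ∏ (λ i → sgn (x i ∧ colSum G T i))
    pairing x T = begin
      ∏ (λ e → sgn (T e ∧ rowComb G x e))
        ≡⟨ Z.∏-cong (λ e → trans (cong sgn (∧-⊕ (T e) (λ i → x i ∧ G i e))) (sgn-⊕ (λ i → T e ∧ (x i ∧ G i e)))) ⟩
      ∏ (λ e → ∏ (λ i → sgn (T e ∧ (x i ∧ G i e))))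
        ≡⟨ Z.∏-swap (λ e i → sgn (T e ∧ (x i ∧ G i e))) ⟩
      ∏ (λ i → ∏ (λ e → sgn (T e ∧ (x i ∧ G i e))))
        ≡⟨ Z.∏-cong (λ i → trans (Z.∏-cong (λ e → cong sgn (∧-exchange (T e) (x i) (G i e))))
             (sym (trans (cong sgn (∧-⊕ (x i) (λ e → T e ∧ G i e))) (sgn-⊕ (λ e → x i ∧ (T e ∧ G i e)))))) ⟩
      ∏ (λ i → sgn (x i ∧ colSum G T i)) ∎
      where
      open ≡.≡-Reasoning
      ∧-exchange : ∀ a b c → a ∧ (b ∧ c) ≡ b ∧ (a ∧ c)
      ∧-exchange false false c = refl
      ∧-exchange false true  c = refl
      ∧-exchange true  b     c = refl

    vanish : (Fin n → Bool) → (Fin p → Bool) → Bool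
    vanish B x = allᵇ (λ e → not (B e) ∨ not (rowComb G x e))

    -- Equal to 2^(p - rk B) by `kernelSize-rk`. Through this number the rank, defined by maximal
    -- independent sets, becomes accessible to counting.
    kernelSize : (Fin n → Bool) → ℤ
    kernelSize B = ∑ (allFuns p) (λ x → ind (vanish B x))

    factor-sgn : ∀ b → + 1 +ℤ sgn b ≡ ind (not b) *ℤ + 2
    factor-sgn false = refl
    factor-sgn true  = refl

    -- Orthogonality: the product over i of 1 + (-1)^(u i) is 2^p for u = 0 and vanishes otherwise.
    characterSum : (u : Fin p → Bool) → ∑ (allFuns p) (λ x → ∏ (λ i → sgn (x i ∧ u i)))
      ≡ ind (allᵇ (λ i → not (u i))) *ℤ (+ 2) ^ℤ p
    characterSum u = trans (Z.∑-∏ (λ i b → sgn (b ∧ u i)))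
      (trans (Z.∏-cong (λ i → factor-sgn (u i)))
        (trans (Z.∏-* {p} (λ i → ind (not (u i))) (λ _ → + 2))
          (cong₂ _*ℤ_ (sym (Z.ind-allᵇ (λ i → not (u i)))) (const p))))
      where
      const : ∀ k → ∏ {k} (λ _ → + 2) ≡ (+ 2) ^ℤ k
      const zero    = refl
      const (suc k) = cong (+ 2 *ℤ_) (const k)

    -- The sum over T ⊆ S is the product over e ∈ S of 1 + (-1)^((xG)_e), and each factor is 2 or 0.
    expandVanish : ∀ S x → ∑ (allFuns n) (λ T → ind (⊆ᵇ T S) *ℤ ∏ (λ e → sgn (T e ∧ rowComb G x e)))
      ≡ ind (vanish S x) *ℤ (+ 2) ^ℤ count S
    expandVanish S x = begin
      ∑ (allFuns n) (λ T → ind (⊆ᵇ T S) *ℤ ∏ (λ e → sgn (T e ∧ rowComb G x e)))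
        ≡⟨ Z.∑-cong (allFuns n) (λ T → trans (cong (_*ℤ ∏ (λ e → sgn (T e ∧ rowComb G x e))) (Z.ind-allᵇ (λ e → not (T e) ∨ S e)))
             (sym (Z.∏-* (λ e → ind (not (T e) ∨ S e)) _))) ⟩
      ∑ (allFuns n) (λ T → ∏ (λ e → φ e (T e)))
        ≡⟨ Z.∑-∏ φ ⟩
      ∏ (λ e → φ e false +ℤ φ e true)
        ≡⟨ Z.∏-cong (λ e → factor (S e) (rowComb G x e)) ⟩
      ∏ (λ e → ind (not (S e) ∨ not (rowComb G x e)) *ℤ (if S e then + 2 else + 1))
        ≡⟨ Z.∏-* (λ e → ind (not (S e) ∨ not (rowComb G x e))) (λ e → if S e then + 2 else + 1) ⟩
      ∏ (λ e → ind (not (S e) ∨ not (rowComb G x e))) *ℤ ∏ (λ e → if S e then + 2 else + 1)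
        ≡⟨ cong₂ _*ℤ_ (sym (Z.ind-allᵇ (λ e → not (S e) ∨ not (rowComb G x e)))) (∏-count (+ 2) S) ⟩
      ind (vanish S x) *ℤ (+ 2) ^ℤ count S ∎
      where
      open ≡.≡-Reasoning
      φ : Fin n → Bool → ℤ
      φ e b = ind (not b ∨ S e) *ℤ sgn (b ∧ rowComb G x e)
      factor : ∀ s c → + 1 *ℤ + 1 +ℤ ind s *ℤ sgn c ≡ ind (not s ∨ not c) *ℤ (if s then + 2 else + 1)
      factor false c     = refl
      factor true  false = refl
      factor true  true  = refl

    dependenceTest : (Fin n → Bool) → (Fin n → Bool) → Bool
    dependenceTest S T = not (⊆ᵇ T S) ∨ (count T ℕ.≡ᵇ 0) ∨ not (allᵇ (λ i → not (colSum G T i)))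

    -- Expand the indicator of xG vanishing on S in characters indexed by T ⊆ S: summing over x
    -- kills every T with nonzero column sum.
    kernelSize-independent : ∀ S → independentᵇ G S ≡ true →
      kernelSize S *ℤ (+ 2) ^ℤ count S ≡ (+ 2) ^ℤ p
    kernelSize-independent S S-ind = begin
      kernelSize S *ℤ (+ 2) ^ℤ count S
        ≡⟨ Z.∑-* (allFuns p) _ _ ⟩
      ∑ (allFuns p) (λ x → ind (vanish S x) *ℤ (+ 2) ^ℤ count S)
        ≡⟨ Z.∑-cong (allFuns p) (λ x → sym (expandVanish S x)) ⟩
      ∑ (allFuns p) (λ x → ∑ (allFuns n) (λ T → ind (⊆ᵇ T S) *ℤ ∏ (λ e → sgn (T e ∧ rowComb G x e))))
        ≡⟨ Z.∑-swap (allFuns p) (allFuns n) _ ⟩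
      ∑ (allFuns n) (λ T → ∑ (allFuns p) (λ x → ind (⊆ᵇ T S) *ℤ ∏ (λ e → sgn (T e ∧ rowComb G x e))))
        ≡⟨ Z.∑-cong (allFuns n) (λ T → trans (sym (Z.*-∑ (allFuns p) (ind (⊆ᵇ T S)) _))
             (cong (ind (⊆ᵇ T S) *ℤ_) (trans (Z.∑-cong (allFuns p) (λ x → pairing x T)) (characterSum (colSum G T))))) ⟩
      ∑ (allFuns n) (λ T → ind (⊆ᵇ T S) *ℤ (ind (allᵇ (λ i → not (colSum G T i))) *ℤ (+ 2) ^ℤ p))
        ≡⟨ ∑-cong∈ (allFuns n) (λ {T} T∈ → trans (sym (*-assoc (ind (⊆ᵇ T S)) (ind (allᵇ (λ i → not (colSum G T i)))) ((+ 2) ^ℤ p)))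
             (cong (_*ℤ (+ 2) ^ℤ p) (trans (only-empty T (allL⁻ {P = dependenceTest S} S-ind T∈)) (ind-empty T)))) ⟩
      ∑ (allFuns n) (λ T → ∏ (λ e → ind (not (T e))) *ℤ (+ 2) ^ℤ p)
        ≡⟨ Z.∑-* (allFuns n) _ _ ⟨
      ∑ (allFuns n) (λ T → ∏ (λ e → ind (not (T e)))) *ℤ (+ 2) ^ℤ p
        ≡⟨ cong (_*ℤ (+ 2) ^ℤ p) (trans (Z.∑-∏ {n} (λ _ b → ind (not b))) (Z.∏-one {n} (λ _ → refl))) ⟩
      + 1 *ℤ (+ 2) ^ℤ p
        ≡⟨ *-identityˡ _ ⟩
      (+ 2) ^ℤ p ∎
      where
      open ≡.≡-Reasoning
      only-empty : ∀ T → dependenceTest S T ≡ true →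
        ind (⊆ᵇ T S) *ℤ ind (allᵇ (λ i → not (colSum G T i))) ≡ ind (count T ℕ.≡ᵇ 0)
      only-empty T h with count T ℕ.≡ᵇ 0 in empty
      ... | true  = cong₂ (λ a b → ind a *ℤ ind b)
            (allᵇ⁺ (λ e → cong (λ b → not b ∨ S e) (count≡ᵇ0⁻ T empty e)))
            (allᵇ⁺ (λ i → cong not (⊕-false (λ e → cong (_∧ G i e) (count≡ᵇ0⁻ T empty e)))))
      ... | false with ⊆ᵇ T S | allᵇ (λ i → not (colSum G T i))
      ...   | false | b     = refl
      ...   | true  | false = refl
      only-empty T () | false | true | true

    -- Keeps the list under `rk` nonempty, so that its maximum is attained by some set and is not
    -- the default 0.
    ∅-independent : ∀ {T} → (∀ e → T e ≡ false) → independentᵇ G T ≡ true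
    ∅-independent {T} T≗∅ = allL⁺ (allFuns n) test
      where
      test : ∀ S → dependenceTest T S ≡ true
      test S with count S ℕ.≡ᵇ 0 in empty
      ... | true  = Bool.∨-zeroʳ _
      ... | false with ⊆ᵇ S T in S⊆T
      ...   | false = refl
      ...   | true  = ⊥-elim (true≢false {count S ℕ.≡ᵇ 0}
                (trans (cong (ℕ._≡ᵇ 0) (count≡0 S (λ e → S-empty e))) refl) empty)
        where
        S-empty : ∀ e → S e ≡ false
        S-empty e with S e | T e | T≗∅ e | allᵇ⁻ S⊆T e
        ... | false | _     | _  | _ = refl
        ... | true  | false | _  | ()
        count≡0 : ∀ {k} (f : Fin k → Bool) → (∀ e → f e ≡ false) → count f ≡ 0
        count≡0 {zero}  f h = refl
        count≡0 {suc k} f h rewrite h zero = count≡0 (λ e → f (suc e)) (λ e → h (suc e))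

    IndependentIn : (Fin n → Bool) → (Fin n → Bool) → Set
    IndependentIn B S = ⊆ᵇ S B ∧ independentᵇ G S ≡ true

    count≤rk : ∀ {B S} → S ∈ allFuns n → IndependentIn B S → count S ≤ rk G B
    count≤rk S∈ S-ind = ≤-maxL count _ (∈-filter⁺ _ S∈ S-ind)

    maximalIndependent : ∀ B → ∃ λ S → S ∈ allFuns n ∧′ IndependentIn B S ∧′ count S ≡ rk G B
    maximalIndependent B with allFuns-complete {n} (λ _ → false)
    ... | ∅ , ∅∈ , ∅≗ with maxL-attained∈ count
          (filter (λ S → Data.Bool._≟_ (⊆ᵇ S B ∧ independentᵇ G S) true) (allFuns n))
          (∈-filter⁺ _ ∅∈ (cong₂ _∧_ (allᵇ⁺ (λ e → cong (λ b → not b ∨ B e) (∅≗ e))) (∅-independent ∅≗)))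
    ...   | S , S∈ , S≡ = let S∈′ , S-ind = ∈-filter⁻ (λ S → Data.Bool._≟_ (⊆ᵇ S B ∧ independentᵇ G S) true) S∈ in S , S∈′ , S-ind , S≡

    rk-mono : ∀ B → rk G B ≤ rank G
    rk-mono B with maximalIndependent B
    ... | S , S∈ , S-ind , S≡ = subst (_≤ rank G) S≡
      (count≤rk S∈ (cong₂ _∧_ (allᵇ⁺ (λ e → Bool.∨-zeroʳ (not (S e)))) (proj₂ (∧-true S-ind))))

    -- By maximality S ∪ {e} contains a nonempty T with column sum 0, and e ∈ T since S is
    -- independent; so column e is a sum of columns of S.
    vanish-spanned : ∀ {B S} → IndependentIn B S → count S ≡ rk G B →
      ∀ x → vanish S x ≡ true → ∀ e → B e ≡ true → S e ≡ false → rowComb G x e ≡ false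
    vanish-spanned {B} {S} S-ind S≡ x x-van e Be Se with allFuns-complete (λ e′ → S e′ ∨ does (e′ Fin.≟ e))
    ... | J , J∈ , J≗ = conclude (allL-false⁻ (allFuns n) J-dependent)
      where
      J-e : J e ≡ true
      J-e = trans (J≗ e) (trans (cong (S e ∨_) does-refl) (Bool.∨-zeroʳ (S e)))
        where
        does-refl : does (e Fin.≟ e) ≡ true
        does-refl with e Fin.≟ e
        ... | yes _  = refl
        ... | no e≢e = ⊥-elim (e≢e refl)
      J-other : ∀ e′ → e′ ≢ e → J e′ ≡ S e′
      J-other e′ e′≢e with e′ Fin.≟ e | J≗ e′
      ... | yes e′≡e | _  = ⊥-elim (e′≢e e′≡e)
      ... | no _     | eq = trans eq (Bool.∨-identityʳ (S e′))
      S⊆B = allᵇ⁻ (proj₁ (∧-true S-ind))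
      J⊆B : ⊆ᵇ J B ≡ true
      J⊆B = allᵇ⁺ sub
        where
        sub : ∀ e′ → not (J e′) ∨ B e′ ≡ true
        sub e′ with e′ Fin.≟ e
        ... | yes refl = trans (cong (not (J e′) ∨_) Be) (Bool.∨-zeroʳ _)
        ... | no e′≢e  = trans (cong (λ b → not b ∨ B e′) (J-other e′ e′≢e)) (S⊆B e′)
      J-dependent : independentᵇ G J ≡ false
      J-dependent with independentᵇ G J in J-ind
      ... | false = refl
      ... | true  = ⊥-elim (ℕ.<-irrefl (trans S≡ refl)
            (subst (_≤ rk G B) (count-insert e Se J-e J-other) (count≤rk J∈ (cong₂ _∧_ J⊆B J-ind))))
      conclude : (∃ λ T → T ∈ allFuns n ∧′ dependenceTest J T ≡ false) → rowComb G x e ≡ false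
      conclude (T , T∈ , T-dep) with ⊆ᵇ T J in T⊆J | count T ℕ.≡ᵇ 0 in T≠∅ | allᵇ (λ i → not (colSum G T i)) in T-cyc
      -- In `pairing` for T the right side is 1 because the columns of T sum to zero; on the left
      -- only the factor at e can differ from 1, as xG vanishes on S.
      ... | true | false | true = sgn-injective (trans (sym (trans
              (∏-single e others) (cong (λ b → sgn (b ∧ rowComb G x e)) T-e)))
              (trans (pairing x T) (Z.∏-one (λ i → cong sgn (col i)))))
        where
        sgn-injective : ∀ {b} → sgn b ≡ + 1 → b ≡ false
        sgn-injective {false} _ = refl
        col : ∀ i → x i ∧ colSum G T i ≡ false
        col i = trans (cong (x i ∧_) (Bool.not-injective (allᵇ⁻ T-cyc i))) (Bool.∧-zeroʳ (x i))
        T-e : T e ≡ true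
        T-e with T e in Te
        ... | true  = refl
        ... | false = ⊥-elim (true≢false {dependenceTest S T}
              (allL⁻ {P = dependenceTest S} (proj₂ (∧-true S-ind)) T∈)
              (cong₂ (λ a b → not a ∨ b) (allᵇ⁺ T⊆S) (cong₂ _∨_ T≠∅ (cong not T-cyc))))
          where
          T⊆S : ∀ e′ → not (T e′) ∨ S e′ ≡ true
          T⊆S e′ with e′ Fin.≟ e
          ... | yes refl = cong (λ b → not b ∨ S e′) Te
          ... | no e′≢e  = trans (cong (not (T e′) ∨_) (sym (J-other e′ e′≢e))) (allᵇ⁻ T⊆J e′)
        others : ∀ e′ → e′ ≢ e → sgn (T e′ ∧ rowComb G x e′) ≡ + 1
        others e′ e′≢e = cong sgn (∧-false (T e′) (S e′) (rowComb G x e′)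
          (trans (cong (not (T e′) ∨_) (sym (J-other e′ e′≢e))) (allᵇ⁻ T⊆J e′)) (allᵇ⁻ x-van e′))
          where
          ∧-false : ∀ t s c → not t ∨ s ≡ true → not s ∨ not c ≡ true → t ∧ c ≡ false
          ∧-false false s     c     _ _ = refl
          ∧-false true  true  false _ _ = refl

    -- The columns of B are sums of columns of S, so vanishing on S propagates to B; the converse is
    -- S ⊆ B.
    vanish-maximal : ∀ {B S} → IndependentIn B S → count S ≡ rk G B → ∀ x → vanish B x ≡ vanish S x
    vanish-maximal {B} {S} S-ind S≡ x with vanish S x in van-S
    ... | true  = allᵇ⁺ go
      where
      go : ∀ e → not (B e) ∨ not (rowComb G x e) ≡ true
      go e with B e in Be | S e in Se
      ... | false | _     = refl
      ... | true  | true  = trans (cong (λ b → not b ∨ not (rowComb G x e)) (sym Se)) (allᵇ⁻ van-S e)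
      ... | true  | false = cong not (vanish-spanned S-ind S≡ x van-S e Be Se)
    ... | false with vanish B x in van-B
    ...   | false = refl
    ...   | true  = ⊥-elim (true≢false (allᵇ⁺ (λ e → go (S e) (B e) (rowComb G x e)
                      (allᵇ⁻ (proj₁ (∧-true S-ind)) e) (allᵇ⁻ van-B e))) van-S)
      where
      go : ∀ s b c → not s ∨ b ≡ true → not b ∨ not c ≡ true → not s ∨ not c ≡ true
      go false b    c     _ _ = refl
      go true  true false _ _ = refl

    kernelSize-rk : ∀ B → kernelSize B *ℤ (+ 2) ^ℤ rk G B ≡ (+ 2) ^ℤ p
    kernelSize-rk B with maximalIndependent B
    ... | S , _ , S-ind , S≡ = trans
      (cong₂ (λ k r → k *ℤ (+ 2) ^ℤ r)
        (Z.∑-cong (allFuns p) (λ x → cong ind (vanish-maximal S-ind S≡ x))) (sym S≡))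
      (kernelSize-independent S (proj₂ (∧-true S-ind)))

    open import Algebra.Properties.Semiring.Exp (CommutativeRing.semiring ℤ.+-*-commutativeRing)
      using (_^_; ^-assocʳ)
    open import Algebra.Properties.CommutativeSemiring.Exp (CommutativeRing.commutativeSemiring ℤ.+-*-commutativeRing)
      using (^-distrib-*)

    -- The supports of the row combinations cover E.
    valid : ∀ {m} → Vec (Fin p → Bool) m → Bool
    valid xs = allᵇ (λ e → not (allV (λ x → not (rowComb G x e)) xs))

    ind-vanish-all : ∀ {m} B (xs : Vec (Fin p → Bool) m) → ind (allV (vanish B) xs)
      ≡ ∏ (λ e → if B e then ind (allV (λ x → not (rowComb G x e)) xs) else + 1)
    ind-vanish-all B []       = sym (Z.∏-one (λ e → Bool.if-eta (B e)))
    ind-vanish-all B (x ∷ xs) = begin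
      ind (vanish B x ∧ allV (vanish B) xs)
        ≡⟨ Z.ind-∧ (vanish B x) _ ⟩
      ind (vanish B x) *ℤ ind (allV (vanish B) xs)
        ≡⟨ cong₂ _*ℤ_ (Z.ind-allᵇ (λ e → not (B e) ∨ not (rowComb G x e))) (ind-vanish-all B xs) ⟩
      ∏ (λ e → ind (not (B e) ∨ not (rowComb G x e))) *ℤ ∏ (λ e → if B e then z e else + 1)
        ≡⟨ Z.∏-* (λ e → ind (not (B e) ∨ not (rowComb G x e))) (λ e → if B e then z e else + 1) ⟨
      ∏ (λ e → ind (not (B e) ∨ not (rowComb G x e)) *ℤ (if B e then z e else + 1))
        ≡⟨ Z.∏-cong (λ e → factor (B e) (rowComb G x e) _) ⟩
      ∏ (λ e → if B e then ind (not (rowComb G x e) ∧ allV (λ x → not (rowComb G x e)) xs) else + 1) ∎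
      where
      open ≡.≡-Reasoning
      z = λ e → ind (allV (λ x → not (rowComb G x e)) xs)
      factor : ∀ b c d → ind (not b ∨ not c) *ℤ (if b then ind d else + 1) ≡ (if b then ind (not c ∧ d) else + 1)
      factor false c d = refl
      factor true  c d = sym (Z.ind-∧ (not c) d)

    -- For a fixed tuple the alternating sum over B factors into 1 - [all combinations vanish at e],
    -- which is the indicator that e is covered.
    inclusionExclusion : ∀ m → ∑ (allFuns n) (λ B → sign (count B) *ℤ kernelSize B ^ m)
      ≡ ∑ (tuples (allFuns p) m) (λ xs → ind (valid xs))
    inclusionExclusion m = begin
      ∑ (allFuns n) (λ B → sign (count B) *ℤ kernelSize B ^ m)
        ≡⟨ Z.∑-cong (allFuns n) (λ B → trans (cong (sign (count B) *ℤ_) (sym (Z.∑-allV (allFuns p) (vanish B) m)))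
             (Z.*-∑ X (sign (count B)) _)) ⟩
      ∑ (allFuns n) (λ B → ∑ X (λ xs → sign (count B) *ℤ ind (allV (vanish B) xs)))
        ≡⟨ Z.∑-swap (allFuns n) X _ ⟩
      ∑ X (λ xs → ∑ (allFuns n) (λ B → sign (count B) *ℤ ind (allV (vanish B) xs)))
        ≡⟨ Z.∑-cong X (λ xs → Z.∑-cong (allFuns n) (λ B → trans
             (cong₂ _*ℤ_ (sym (∏-count (-ℤ + 1) B)) (ind-vanish-all B xs))
             (sym (Z.∏-* (λ e → if B e then -ℤ + 1 else + 1) (λ e → if B e then z xs e else + 1))))) ⟩
      ∑ X (λ xs → ∑ (allFuns n) (λ B → ∏ (λ e → φ xs e (B e))))
        ≡⟨ Z.∑-cong X (λ xs → trans (Z.∑-∏ (φ xs)) (trans (Z.∏-cong (λ e → factor (allV (λ x → not (rowComb G x e)) xs)))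
             (sym (Z.ind-allᵇ (λ e → not (allV (λ x → not (rowComb G x e)) xs)))))) ⟩
      ∑ X (λ xs → ind (valid xs)) ∎
      where
      open ≡.≡-Reasoning
      X = tuples (allFuns p) m
      z : Vec (Fin p → Bool) m → Fin n → ℤ
      z xs e = ind (allV (λ x → not (rowComb G x e)) xs)
      φ : Vec (Fin p → Bool) m → Fin n → Bool → ℤ
      φ xs e b = (if b then -ℤ + 1 else + 1) *ℤ (if b then z xs e else + 1)
      factor : ∀ b → + 1 *ℤ + 1 +ℤ (-ℤ + 1) *ℤ ind b ≡ ind (not b)
      factor false = refl
      factor true  = refl

    ^ℤ≡^ : ∀ x k → x ^ℤ k ≡ x ^ k
    ^ℤ≡^ x zero    = refl
    ^ℤ≡^ x (suc k) = cong (x *ℤ_) (^ℤ≡^ x k)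

    +-^ : ∀ a k → + (a ℕ.^ k) ≡ (+ a) ^ k
    +-^ a zero    = refl
    +-^ a (suc k) = trans (ℤ.pos-* a (a ℕ.^ k)) (cong (+ a *ℤ_) (+-^ a k))

    2^ℤ≢0 : ∀ k → (+ 2) ^ℤ k ≢ + 0
    2^ℤ≢0 zero    ()
    2^ℤ≢0 (suc k) h with ℤ.i*j≡0⇒i≡0∨j≡0 (+ 2) h
    ... | inj₂ h′ = 2^ℤ≢0 k h′

    total : Fin n → Bool
    total _ = true

    -- Multiplied by 2^(rk B) both sides become 2^p. By `rk-mono` the truncated subtraction is a
    -- true one.
    kernelSize-corank : ∀ B → (+ 2) ^ℤ (rank G ℕ.∸ rk G B) *ℤ kernelSize total ≡ kernelSize B
    kernelSize-corank B = ℤ.*-cancelʳ-≡ _ _ ((+ 2) ^ℤ rk G B) {{ℤ.≢-nonZero (2^ℤ≢0 (rk G B))}} (begin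
      (+ 2) ^ℤ (rank G ℕ.∸ rk G B) *ℤ kernelSize total *ℤ (+ 2) ^ℤ rk G B
        ≡⟨ rotate ((+ 2) ^ℤ (rank G ℕ.∸ rk G B)) (kernelSize total) ((+ 2) ^ℤ rk G B) ⟩
      kernelSize total *ℤ ((+ 2) ^ℤ (rank G ℕ.∸ rk G B) *ℤ (+ 2) ^ℤ rk G B)
        ≡⟨ cong (kernelSize total *ℤ_) (trans (sym (^ℤ-+ (rank G ℕ.∸ rk G B) (rk G B)))
             (cong ((+ 2) ^ℤ_) (ℕ.m∸n+n≡m (rk-mono B)))) ⟩
      kernelSize total *ℤ (+ 2) ^ℤ rank G
        ≡⟨ trans (kernelSize-rk total) (sym (kernelSize-rk B)) ⟩
      kernelSize B *ℤ (+ 2) ^ℤ rk G B ∎)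
      where
      open ≡.≡-Reasoning
      rotate : ∀ a b c → a *ℤ b *ℤ c ≡ b *ℤ (a *ℤ c)
      rotate a b c = trans (cong (_*ℤ c) (*-comm a b)) (*-assoc b a c)
      ^ℤ-+ : ∀ k l → (+ 2) ^ℤ (k ℕ.+ l) ≡ (+ 2) ^ℤ k *ℤ (+ 2) ^ℤ l
      ^ℤ-+ zero    l = sym (*-identityˡ _)
      ^ℤ-+ (suc k) l = trans (cong (+ 2 *ℤ_) (^ℤ-+ k l)) (sym (*-assoc (+ 2) ((+ 2) ^ℤ k) ((+ 2) ^ℤ l)))

    kernelSize-^ : ∀ m B → (+ (2 ℕ.^ m)) ^ℤ (rank G ℕ.∸ rk G B) *ℤ kernelSize total ^ m ≡ kernelSize B ^ m
    kernelSize-^ m B = begin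
      (+ (2 ℕ.^ m)) ^ℤ d *ℤ kernelSize total ^ m
        ≡⟨ cong (_*ℤ kernelSize total ^ m) (trans (^ℤ≡^ (+ (2 ℕ.^ m)) d) (trans (cong (_^ d) (+-^ 2 m))
             (trans (^-assocʳ (+ 2) m d) (trans (cong ((+ 2) ^_) (ℕ.*-comm m d)) (sym (^-assocʳ (+ 2) d m)))))) ⟩
      ((+ 2) ^ d) ^ m *ℤ kernelSize total ^ m
        ≡⟨ ^-distrib-* ((+ 2) ^ d) (kernelSize total) m ⟨
      ((+ 2) ^ d *ℤ kernelSize total) ^ m
        ≡⟨ cong (_^ m) (trans (cong (_*ℤ kernelSize total) (sym (^ℤ≡^ (+ 2) d))) (kernelSize-corank B)) ⟩
      kernelSize B ^ m ∎
      where
      open ≡.≡-Reasoning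
      d = rank G ℕ.∸ rk G B

    -- The critical theorem, counting tuples of coordinate vectors instead of row space elements;
    -- each row space element has kernelSize total coordinate vectors.
    χ-counts-valid : ∀ m → χ G (+ (2 ℕ.^ m)) *ℤ kernelSize total ^ m
      ≡ ∑ (tuples (allFuns p) m) (λ xs → ind (valid xs))
    χ-counts-valid m = begin
      χ G (+ (2 ℕ.^ m)) *ℤ kernelSize total ^ m
        ≡⟨ cong (_*ℤ kernelSize total ^ m) (foldr≡∑ (allFuns n)) ⟩
      ∑ (allFuns n) term *ℤ kernelSize total ^ m
        ≡⟨ Z.∑-* (allFuns n) _ term ⟩
      ∑ (allFuns n) (λ B → term B *ℤ kernelSize total ^ m)
        ≡⟨ Z.∑-cong (allFuns n) (λ B → trans (*-assoc (sign (count B)) ((+ (2 ℕ.^ m)) ^ℤ (rank G ℕ.∸ rk G B)) (kernelSize total ^ m)) (cong (sign (count B) *ℤ_) (kernelSize-^ m B))) ⟩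
      ∑ (allFuns n) (λ B → sign (count B) *ℤ kernelSize B ^ m)
        ≡⟨ inclusionExclusion m ⟩
      ∑ (tuples (allFuns p) m) (λ xs → ind (valid xs)) ∎
      where
      open ≡.≡-Reasoning
      term : (Fin n → Bool) → ℤ
      term B = sign (count B) *ℤ (+ (2 ℕ.^ m)) ^ℤ (rank G ℕ.∸ rk G B)
      foldr≡∑ : ∀ L → foldr _+ℤ_ (+ 0) (map term L) ≡ ∑ L term
      foldr≡∑ []      = refl
      foldr≡∑ (B ∷ L) = cong (term B +ℤ_) (foldr≡∑ L)

    kernelSize-total≢0 : ∀ m → kernelSize total ^ m ≢ + 0
    kernelSize-total≢0 zero    ()
    kernelSize-total≢0 (suc m) h with ℤ.i*j≡0⇒i≡0∨j≡0 (kernelSize total) h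
    ... | inj₂ h′ = kernelSize-total≢0 m h′
    ... | inj₁ k≡0 = 2^ℤ≢0 p (trans (sym (kernelSize-rk total)) (cong (_*ℤ (+ 2) ^ℤ rank G) k≡0))

    χ≡0⇒invalid : ∀ m → χ G (+ (2 ℕ.^ m)) ≡ + 0 →
      ∀ {xs} → xs ∈ tuples (allFuns p) m → valid xs ≡ false
    χ≡0⇒invalid m χ≡0 with ∑-ind valid (tuples (allFuns p) m)
    ... | k , ∑≡k , all , _ = all (ℤ.+-injective (trans (sym ∑≡k)
      (trans (sym (χ-counts-valid m)) (cong (_*ℤ kernelSize total ^ m) χ≡0))))

    χ≢0⇒valid : ∀ m → χ G (+ (2 ℕ.^ m)) ≢ + 0 → ∃ λ xs → xs ∈ tuples (allFuns p) m ∧′ valid xs ≡ true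
    χ≢0⇒valid m χ≢0 with ∑-ind valid (tuples (allFuns p) m)
    ... | k , ∑≡k , _ , some = some k≢0
      where
      k≢0 : k ≢ 0
      k≢0 refl with ℤ.i*j≡0⇒i≡0∨j≡0 (χ G (+ (2 ℕ.^ m))) (trans (χ-counts-valid m) ∑≡k)
      ... | inj₁ χ≡0 = χ≢0 χ≡0
      ... | inj₂ h   = kernelSize-total≢0 m h

-- Expansion of the root sum

open BinaryMatroid

inRowSpaceᵇ-cong : ∀ {p n} (G : Matrix p n) {v w} → (∀ e → v e ≡ w e) → inRowSpaceᵇ G v ≡ inRowSpaceᵇ G w
inRowSpaceᵇ-cong {p} G {v} {w} v≗w = go (allFuns p)
  where
  go : ∀ L → anyL (λ x → allᵇ (λ e → v e == rowComb G x e)) L ≡ anyL (λ x → allᵇ (λ e → w e == rowComb G x e)) L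
  go []      = ≡.refl
  go (x ∷ L) = ≡.cong₂ _∨_ (allᵇ-cong (λ e → ≡.cong (_== rowComb G x e) (v≗w e))) (go L)

==-sound : ∀ a b → (a == b) ≡ true → a ≡ b
==-sound false false _ = ≡.refl
==-sound true  true  _ = ≡.refl

==-refl : ∀ a → (a == a) ≡ true
==-refl false = ≡.refl
==-refl true  = ≡.refl

xor-cancel : ∀ a b → a xor (a xor b) ≡ b
xor-cancel false b     = ≡.refl
xor-cancel true  false = ≡.refl
xor-cancel true  true  = ≡.refl

fromBool : Bool → ℕ
fromBool b = if b then 1 else 0

misses : ∀ {n l} → Vec (Fin n → Bool) l → Fin n → Bool
misses ds e = allV (λ d → not (d e)) ds

-- Recovers a tuple from its first member and its consecutive differences.
partialSums : ∀ {n l} → (Fin n → Bool) → Vec (Fin n → Bool) l → Vec (Fin n → Bool) (suc l)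
partialSums f []       = f ∷ []
partialSums f (d ∷ ds) = f ∷ partialSums (λ e → f e xor d e) ds

totalSupp-partialSums-cong : ∀ {n l} {f g : Fin n → Bool} (ds : Vec (Fin n → Bool) l) →
  (∀ e → f e ≡ g e) → totalSupp (partialSums f ds) ≡ totalSupp (partialSums g ds)
totalSupp-partialSums-cong []       f≗g = ≡.cong (ℕ._+ 0) (count-cong f≗g)
totalSupp-partialSums-cong (d ∷ ds) f≗g = ≡.cong₂ ℕ._+_ (count-cong f≗g)
  (totalSupp-partialSums-cong ds (λ e → ≡.cong (_xor d e) (f≗g e)))

-- The number of members of partialSums f ds containing e, when f e = b.
height : ∀ {n l} → Bool → Vec (Fin n → Bool) l → Fin n → ℕ
height b []       e = fromBool b
height b (d ∷ ds) e = fromBool b ℕ.+ height (b xor d e) ds e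

-- Complementing f₁ at e complements all l + 1 members there. This pairs ζ^w with ζ^(h - w) in the
-- sum over f₁.
height-complement : ∀ {n l} b (ds : Vec (Fin n → Bool) l) e → height b ds e ℕ.+ height (not b) ds e ≡ suc l
height-complement false []       e = ≡.refl
height-complement true  []       e = ≡.refl
height-complement false (d ∷ ds) e = ≡.trans (ℕ.+-suc _ _) (≡.cong suc (height-complement (d e) ds e))
height-complement {l = suc l} true (d ∷ ds) e = ≡.cong suc (≡.trans
  (≡.cong (λ c → height (not (d e)) ds e ℕ.+ height c ds e) (≡.sym (Bool.not-involutive (d e))))
  (height-complement (not (d e)) ds e))

height-true>0 : ∀ {n l} (ds : Vec (Fin n → Bool) l) e → 0 < height true ds e
height-true>0 []       e = s≤s z≤n
height-true>0 (d ∷ ds) e = s≤s z≤n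

height≤ : ∀ {n l} (ds : Vec (Fin n → Bool) l) e → height false ds e ≤ l
height≤ {l = l} ds e = ℕ.≤-pred (≡.subst (height false ds e <_) (height-complement false ds e)
  (ℕ.m<m+n (height false ds e) (height-true>0 ds e)))

misses⇒height≡0 : ∀ {n l} (ds : Vec (Fin n → Bool) l) e → misses ds e ≡ true → height false ds e ≡ 0
misses⇒height≡0 []       e _ = ≡.refl
misses⇒height≡0 (d ∷ ds) e h with d e
... | false = misses⇒height≡0 ds e h

hit⇒height>0 : ∀ {n l} (ds : Vec (Fin n → Bool) l) e → misses ds e ≡ false → 0 < height false ds e
hit⇒height>0 (d ∷ ds) e h with d e
... | false = hit⇒height>0 ds e h
... | true  = height-true>0 ds e

rowCoordinates : ∀ {p n l} (G : Matrix p n) (ds : Vec (Fin n → Bool) l) → allV (inRowSpaceᵇ G) ds ≡ true →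
  ∃ λ xs → xs ∈ tuples (allFuns p) l ∧′ (∀ e → allV (λ x → not (rowComb G x e)) xs ≡ misses ds e)
rowCoordinates G []       _ = [] , here ≡.refl , λ _ → ≡.refl
rowCoordinates {p} G (d ∷ ds) h =
  let x , x∈ , d≗ = anyL⁻ (allFuns p) (proj₁ (∧-true h))
      xs , xs∈ , eq = rowCoordinates G ds (proj₂ (∧-true h))
  in x ∷ xs , ∈-tuples x∈ xs∈ ,
     λ e → ≡.cong₂ (λ b c → not b ∧ c) (≡.sym (==-sound (d e) (rowComb G x e) (allᵇ⁻ d≗ e))) (eq e)

-- The combinations themselves need not be listed in `allFuns n`; listed representatives miss the
-- same elements, and only this matters for covering.
rowCombinations : ∀ {p n l} (G : Matrix p n) {xs : Vec (Fin p → Bool) l} → xs ∈ tuples (allFuns p) l →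
  ∃ λ ds → ds ∈ tuples (allFuns n) l ∧′ allV (inRowSpaceᵇ G) ds ≡ true
    ∧′ (∀ e → allV (λ x → not (rowComb G x e)) xs ≡ misses ds e)
rowCombinations G {[]}     _ = [] , here ≡.refl , ≡.refl , λ _ → ≡.refl
rowCombinations {p} {n} G {x ∷ xs} xxs∈ =
  let x∈ , xs∈ = ∈-tuples⁻ xxs∈
      ds , ds∈ , rows , eq = rowCombinations G xs∈
      d , d∈ , d≗ = allFuns-complete (rowComb G x)
  in d ∷ ds , ∈-tuples d∈ ds∈ ,
     ≡.cong₂ _∧_ (anyL⁺ x∈ (allᵇ⁺ (λ e → ≡.trans (≡.cong (_== rowComb G x e) (d≗ e)) (==-refl (rowComb G x e))))) rows ,
     λ e → ≡.cong₂ (λ b c → not b ∧ c) (≡.sym (d≗ e)) (eq e)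

module RootSum {c ℓ : Level} (K : CommutativeRing c ℓ)
  (domain : IsIntegralDomain K) (charZero : CharZero K)
  (m : ℕ) (ζ : CommutativeRing.Carrier K)
  (prim : IsPrimitiveRoot K (2 ℕ.* m ℕ.+ 2) ζ) (1≤m : 1 ≤ m)
  {p n : ℕ} (G : Matrix p n) where

  open CommutativeRing K hiding (zero)
  open Sums K
  open PowerSums K
  open IntegerImage K using (solve; _:=_; _:*_)
  open QuantumIntegers K m
  open Positivity K domain charZero m ζ prim 1≤m
  open import Algebra.Properties.Semiring.Exp semiring using (_^_; ^-homo-*)
  open import Relation.Binary.Reasoning.Setoid setoid

  ζᴺ≈1 : ζ ^ suc (suc (2 ℕ.* m)) ≈ 1#
  ζᴺ≈1 = trans (reflexive (≡.cong (ζ ^_) (ℕ.+-comm 2 (2 ℕ.* m)))) (proj₁ prim)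

  module _ {A : Set} (P : ℕ → A → Bool) (L : List A) where

    indicatorSum : ℕ → A → Carrier
    indicatorSum zero    t = 0#
    indicatorSum (suc M) t = indicatorSum M t + ζ ^ M * ind (P M t)

    rootSum-count : ∀ M → rootSum K M ζ (λ k → length (filter (λ t → Bool._≟_ (P k t) true) L))
      ≈ ∑ L (indicatorSum M)
    rootSum-count zero    = sym (∑-zero L (λ _ → refl))
    rootSum-count (suc M) = trans
      (+-cong (rootSum-count M) (trans (*-congˡ (length-filter (P M) L)) (*-∑ L _ _)))
      (sym (∑-+ L _ _))

  module _ (t : Vec (Fin n → Bool) (suc m)) where
    -- The modulus in the shape used by `inTᵇ`; it agrees with 2 m + 2 only propositionally.
    N′ : ℕ
    N′ = suc (suc (2 ℕ.* m))

    r : ℕ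
    r = totalSupp t % N′

    sumTo : ℕ → Carrier
    sumTo M = indicatorSum (inTᵇ m G) (allTuples n (suc m)) M t

    inTᵇ-true : ∀ {k} → k < N′ → r ≡ k → inTᵇ m G k t ≡ consecutiveᵇ G t
    inTᵇ-true {k} k<N r≡k = ≡.trans (≡.cong (consecutiveᵇ G t ∧_)
      (≡.trans (≡.cong₂ ℕ._≡ᵇ_ r≡k (m<n⇒m%n≡m k<N)) (≡ᵇ-refl k))) (Bool.∧-identityʳ _)
      where
      ≡ᵇ-refl : ∀ k → (k ℕ.≡ᵇ k) ≡ true
      ≡ᵇ-refl zero    = ≡.refl
      ≡ᵇ-refl (suc k) = ≡ᵇ-refl k

    inTᵇ-false : ∀ {k} → k < N′ → r ≢ k → inTᵇ m G k t ≡ false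
    inTᵇ-false {k} k<N r≢k = ≡.trans (≡.cong (consecutiveᵇ G t ∧_)
      (≡.trans (≡.cong (r ℕ.≡ᵇ_) (m<n⇒m%n≡m k<N)) (≡ᵇ-≢ r k r≢k))) (Bool.∧-zeroʳ _)
      where
      ≡ᵇ-≢ : ∀ a b → a ≢ b → (a ℕ.≡ᵇ b) ≡ false
      ≡ᵇ-≢ zero    zero    a≢b = ⊥-elim (a≢b ≡.refl)
      ≡ᵇ-≢ zero    (suc b) _   = ≡.refl
      ≡ᵇ-≢ (suc a) zero    _   = ≡.refl
      ≡ᵇ-≢ (suc a) (suc b) a≢b = ≡ᵇ-≢ a b (λ a≡b → a≢b (≡.cong suc a≡b))

    sumTo-below : ∀ M → M ≤ N′ → M ≤ r → sumTo M ≈ 0#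
    sumTo-below zero    _   _   = refl
    sumTo-below (suc M) M<N M<r = trans (+-cong (sumTo-below M (ℕ.<⇒≤ M<N) (ℕ.<⇒≤ M<r))
      (trans (*-congˡ (reflexive (≡.cong ind (inTᵇ-false {M} M<N (λ r≡M → ℕ.<-irrefl (≡.sym r≡M) M<r))))) (zeroʳ _)))
      (+-identityˡ _)

    sumTo-above : ∀ M → M ≤ N′ → r < M → sumTo M ≈ ind (consecutiveᵇ G t) * ζ ^ r
    sumTo-above (suc M) M<N (s≤s r≤M) = [ above , at ]′ (ℕ.m≤n⇒m<n∨m≡n r≤M)
      where
      above : r < M → sumTo (suc M) ≈ ind (consecutiveᵇ G t) * ζ ^ r
      above r<M = trans (+-cong (sumTo-above M (ℕ.<⇒≤ M<N) r<M)
        (trans (*-congˡ (reflexive (≡.cong ind (inTᵇ-false {M} M<N (λ r≡M → ℕ.<-irrefl r≡M r<M))))) (zeroʳ _)))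
        (+-identityʳ _)
      at : r ≡ M → sumTo (suc M) ≈ ind (consecutiveᵇ G t) * ζ ^ r
      at r≡M = trans (+-cong (sumTo-below M (ℕ.<⇒≤ M<N) (ℕ.≤-reflexive (≡.sym r≡M)))
        (trans (*-cong (reflexive (≡.cong (ζ ^_) (≡.sym r≡M))) (reflexive (≡.cong ind (inTᵇ-true {M} M<N r≡M)))) (*-comm _ _)))
        (+-identityˡ _)

    -- Only the residue k = r contributes, and ζ^r is the full power since ζ^N = 1.
    sumTo-all : sumTo N′ ≈ ind (consecutiveᵇ G t) * ζ ^ totalSupp t
    sumTo-all = trans (sumTo-above N′ ℕ.≤-refl (m%n<n (totalSupp t) N′))
      (*-congˡ (sym (^-mod {N = N′} ζᴺ≈1 (totalSupp t))))

  rootSum-tuples : rootSum K (2 ℕ.* m ℕ.+ 2) ζ (Tcard m G)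
    ≈ ∑ (tuples (allFuns n) (suc m)) (λ t → ind (consecutiveᵇ G t) * ζ ^ totalSupp t)
  rootSum-tuples = begin
    rootSum K (2 ℕ.* m ℕ.+ 2) ζ (Tcard m G)
      ≡⟨ ≡.cong (λ M → rootSum K M ζ (Tcard m G)) (ℕ.+-comm (2 ℕ.* m) 2) ⟩
    rootSum K (suc (suc (2 ℕ.* m))) ζ (Tcard m G)
      ≈⟨ rootSum-count (inTᵇ m G) (allTuples n (suc m)) (suc (suc (2 ℕ.* m))) ⟩
    ∑ (allTuples n (suc m)) (indicatorSum (inTᵇ m G) (allTuples n (suc m)) (suc (suc (2 ℕ.* m))))
      ≈⟨ ∑-cong (allTuples n (suc m)) sumTo-all ⟩
    ∑ (allTuples n (suc m)) (λ t → ind (consecutiveᵇ G t) * ζ ^ totalSupp t)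
      ≡⟨ ≡.cong (λ L → ∑ L (λ t → ind (consecutiveᵇ G t) * ζ ^ totalSupp t)) (allTuples≡tuples n (suc m)) ⟩
    ∑ (tuples (allFuns n) (suc m)) (λ t → ind (consecutiveᵇ G t) * ζ ^ totalSupp t) ∎

  inC : ∀ {l} → Vec (Fin n → Bool) l → Bool
  inC = allV (inRowSpaceᵇ G)

  -- Induction along the tuple: `∑-translate` replaces the next member g by f + d, and f + (f + d) =
  -- d turns the row space condition into one on d alone.
  ∑-differences : ∀ l f → ∑ (tuples (allFuns n) l) (λ gs → ind (consecutiveᵇ G (f ∷ gs)) * ζ ^ totalSupp (f ∷ gs))
    ≈ ∑ (tuples (allFuns n) l) (λ ds → ind (inC ds) * ζ ^ totalSupp (partialSums f ds))
  ∑-differences zero    f = refl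
  ∑-differences (suc l) f = begin
    ∑ (tuples F (suc l)) (λ gs → ind (consecutiveᵇ G (f ∷ gs)) * ζ ^ totalSupp (f ∷ gs))
      ≈⟨ ∑-tuples F l _ ⟩
    ∑ F (λ g → ∑ (tuples F l) (λ gs → ind (row f g ∧ consecutiveᵇ G (g ∷ gs)) * ζ ^ (count f ℕ.+ totalSupp (g ∷ gs))))
      ≈⟨ ∑-cong F (λ g → trans (∑-cong (tuples F l) (λ gs → split (row f g) (consecutiveᵇ G (g ∷ gs)) (totalSupp (g ∷ gs))))
           (trans (sym (*-∑ (tuples F l) _ _)) (*-congˡ (∑-differences l g)))) ⟩
    ∑ F summand
      ≈⟨ ∑-translate f summand summand-cong ⟩
    ∑ F (λ d → summand (λ e → f e xor d e))
      ≈⟨ ∑-cong F (λ d → trans (*-congʳ (*-congʳ (reflexive (≡.cong ind (inRowSpaceᵇ-cong G (λ e → xor-cancel (f e) (d e)))))))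
           (trans (*-∑ (tuples F l) _ _) (∑-cong (tuples F l) (λ ds → sym (split (inRowSpaceᵇ G d) (inC ds) (totalSupp (partialSums (λ e → f e xor d e) ds))))))) ⟩
    ∑ F (λ d → ∑ (tuples F l) (λ ds → ind (inC (d ∷ ds)) * ζ ^ totalSupp (partialSums f (d ∷ ds))))
      ≈⟨ ∑-tuples F l (λ ds → ind (inC ds) * ζ ^ totalSupp (partialSums f ds)) ⟨
    ∑ (tuples F (suc l)) (λ ds → ind (inC ds) * ζ ^ totalSupp (partialSums f ds)) ∎
    where
    F = allFuns n
    row : (Fin n → Bool) → (Fin n → Bool) → Bool
    row f g = inRowSpaceᵇ G (λ e → f e xor g e)
    split : ∀ a b k → ind (a ∧ b) * ζ ^ (count f ℕ.+ k) ≈ ind a * ζ ^ count f * (ind b * ζ ^ k)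
    split a b k = trans (*-cong (ind-∧ a b) (^-homo-* ζ (count f) k))
      (solve 4 (λ a b x y → a :* b :* (x :* y) := a :* x :* (b :* y)) refl _ _ _ _)
    summand : (Fin n → Bool) → Carrier
    summand g = ind (row f g) * ζ ^ count f
      * ∑ (tuples F l) (λ ds → ind (inC ds) * ζ ^ totalSupp (partialSums g ds))
    summand-cong : ∀ g g′ → (∀ e → g e ≡ g′ e) → summand g ≈ summand g′
    summand-cong g g′ g≗g′ = *-cong
      (*-congʳ (reflexive (≡.cong ind (inRowSpaceᵇ-cong G (λ e → ≡.cong (f e xor_) (g≗g′ e))))))
      (∑-cong (tuples F l) (λ ds → *-congˡ (reflexive (≡.cong (ζ ^_) (totalSupp-partialSums-cong ds g≗g′)))))

  ζ^count : ∀ {k} (f : Fin k → Bool) → ζ ^ count f ≈ ∏ (λ e → ζ ^ fromBool (f e))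
  ζ^count {zero}  f = refl
  ζ^count {suc k} f = trans (^-homo-* ζ (fromBool (f zero)) _) (*-congˡ (ζ^count (λ e → f (suc e))))

  ζ^totalSupp : ∀ {l} f (ds : Vec (Fin n → Bool) l) →
    ζ ^ totalSupp (partialSums f ds) ≈ ∏ (λ e → ζ ^ height (f e) ds e)
  ζ^totalSupp f []       = trans (reflexive (≡.cong (ζ ^_) (ℕ.+-identityʳ (count f)))) (ζ^count f)
  ζ^totalSupp f (d ∷ ds) = trans (^-homo-* ζ (count f) _)
    (trans (*-cong (ζ^count f) (ζ^totalSupp (λ e → f e xor d e) ds))
      (trans (sym (∏-* (λ e → ζ ^ fromBool (f e)) (λ e → ζ ^ height (f e xor d e) ds e)))
        (∏-cong (λ e → sym (^-homo-* ζ (fromBool (f e)) _)))))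

  weight : Vec (Fin n → Bool) m → Carrier
  weight ds = ind (inC ds) * ∏ (λ e → s ζ (height false ds e))

  -- With the differences fixed, f₁ is chosen independently at each e, and the two choices there
  -- contribute ζ^w + ζ^(h - w) = s(w).
  ∑-supports : ∀ ds → ∑ (allFuns n) (λ f → ζ ^ totalSupp (partialSums f ds)) ≈ ∏ (λ e → s ζ (height false ds e))
  ∑-supports ds = begin
    ∑ (allFuns n) (λ f → ζ ^ totalSupp (partialSums f ds))
      ≈⟨ ∑-cong (allFuns n) (λ f → ζ^totalSupp f ds) ⟩
    ∑ (allFuns n) (λ f → ∏ (λ e → ζ ^ height (f e) ds e))
      ≈⟨ ∑-∏ (λ e b → ζ ^ height b ds e) ⟩
    ∏ (λ e → ζ ^ height false ds e + ζ ^ height true ds e)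
      ≈⟨ ∏-cong (λ e → trans (+-congˡ (reflexive (≡.cong (ζ ^_) (complement e))))
           (sym (s≈ ζ-odd (ℕ.m≤n⇒m≤1+n (height≤ ds e))))) ⟩
    ∏ (λ e → s ζ (height false ds e)) ∎
    where
    complement : ∀ e → height true ds e ≡ suc m ℕ.∸ height false ds e
    complement e = ≡.trans (≡.sym (ℕ.m+n∸m≡n (height false ds e) (height true ds e)))
      (≡.cong (ℕ._∸ height false ds e) (height-complement false ds e))

  rootSum-weights : rootSum K (2 ℕ.* m ℕ.+ 2) ζ (Tcard m G) ≈ ∑ (tuples (allFuns n) m) weight
  rootSum-weights = begin
    rootSum K (2 ℕ.* m ℕ.+ 2) ζ (Tcard m G)
      ≈⟨ trans rootSum-tuples (∑-tuples (allFuns n) m _) ⟩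
    ∑ (allFuns n) (λ f → ∑ (tuples (allFuns n) m) (λ gs → ind (consecutiveᵇ G (f ∷ gs)) * ζ ^ totalSupp (f ∷ gs)))
      ≈⟨ ∑-cong (allFuns n) (∑-differences m) ⟩
    ∑ (allFuns n) (λ f → ∑ (tuples (allFuns n) m) (λ ds → ind (inC ds) * ζ ^ totalSupp (partialSums f ds)))
      ≈⟨ ∑-swap (allFuns n) (tuples (allFuns n) m) _ ⟩
    ∑ (tuples (allFuns n) m) (λ ds → ∑ (allFuns n) (λ f → ind (inC ds) * ζ ^ totalSupp (partialSums f ds)))
      ≈⟨ ∑-cong (tuples (allFuns n) m) (λ ds → trans (sym (*-∑ (allFuns n) _ _)) (*-congˡ (∑-supports ds))) ⟩
    ∑ (tuples (allFuns n) m) weight ∎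

  covering : Vec (Fin n → Bool) m → Bool
  covering ds = inC ds ∧ allᵇ (λ e → not (misses ds e))

  weight-noncovering : ∀ ds → covering ds ≡ false → weight ds ≈ 0#
  weight-noncovering ds h with inC ds
  ... | false = zeroˡ _
  ... | true  = let e , hit = allᵇ-false⁻ h in trans (*-identityˡ _)
        (∏-factor-0 e (trans (reflexive (≡.cong (s ζ) (misses⇒height≡0 ds e (Bool.not-injective hit)))) (s₀≈0 ζ-odd)))

  -- Noncovering tuples drop out, having a factor s(0). All covering ones share the power s(1)^n, so
  -- their label lists simply concatenate, without cancellation.
  labelsOf : ∀ Ds → ∃ λ L → All (Label m) L ∧′ s ζ 1 * ∑ Ds weight ≈ s ζ 1 ^ n * S L ζ
    ∧′ (∀ {ds} → ds ∈ Ds → covering ds ≡ true → L ≢ [])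
  labelsOf []        = [] , [] , trans (zeroʳ _) (sym (zeroʳ _)) , λ ()
  labelsOf (ds ∷ Ds) with labelsOf Ds | covering ds in cov
  ... | L , L-lab , eq , ne | false = L , L-lab ,
        trans (*-congˡ (trans (+-congʳ (weight-noncovering ds cov)) (+-identityˡ _))) eq ,
        λ { (here ≡.refl) cov′ → ⊥-elim (true≢false cov′ cov) ; (there ds∈) → ne ds∈ }
  ... | L , L-lab , eq , ne | true with product-labels 1≤m (height false ds)
            (λ e → hit⇒height>0 ds e (Bool.not-injective (allᵇ⁻ (proj₂ (∧-true {inC ds} cov)) e)) , height≤ ds e)
  ...   | L′ , (L′≢[] , L′-lab) , eq′ = L′ ++ L , All.++⁺ L′-lab L-lab ,
          (begin
            s ζ 1 * (weight ds + ∑ Ds weight)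
              ≈⟨ distribˡ _ _ _ ⟩
            s ζ 1 * weight ds + s ζ 1 * ∑ Ds weight
              ≈⟨ +-cong (trans (*-congˡ (trans (*-congʳ (reflexive (≡.cong ind (proj₁ (∧-true {inC ds} cov))))) (*-identityˡ _)))
                   (eq′ ζ-odd)) eq ⟩
            s ζ 1 ^ n * S L′ ζ + s ζ 1 ^ n * S L ζ
              ≈⟨ distribˡ _ _ _ ⟨
            s ζ 1 ^ n * (S L′ ζ + S L ζ)
              ≈⟨ *-congˡ (∑-++ L′ L (s ζ)) ⟨
            s ζ 1 ^ n * S (L′ ++ L) ζ ∎) ,
          λ _ _ → nonempty L′ L′≢[]
    where
    nonempty : ∀ M → M ≢ [] → M ++ L ≢ []
    nonempty []      M≢[] = ⊥-elim (M≢[] ≡.refl)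
    nonempty (_ ∷ _) _    ()

  s₁≉0 : ¬ s ζ 1 ≈ 0#
  s₁≉0 s₁≈0 = S-nonzero (1 ∷ []) ((λ ()) , (s≤s z≤n , 1≤m) ∷ []) (trans (+-identityʳ _) s₁≈0)

  cancel-s₁^ : ∀ k {x} → s ζ 1 ^ k * x ≈ 0# → x ≈ 0#
  cancel-s₁^ zero    h = trans (sym (*-identityˡ _)) h
  cancel-s₁^ (suc k) h with domain _ _ (trans (sym (*-assoc _ _ _)) h)
  ... | inj₁ s₁≈0 = ⊥-elim (s₁≉0 s₁≈0)
  ... | inj₂ h′   = cancel-s₁^ k h′

  covering⇒∑≉0 : ∀ Ds {ds} → ds ∈ Ds → covering ds ≡ true → ¬ ∑ Ds weight ≈ 0#
  covering⇒∑≉0 Ds ds∈ cov ∑≈0 with labelsOf Ds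
  ... | L , L-lab , eq , ne = S-nonzero L (ne ds∈ cov , L-lab)
    (cancel-s₁^ n (trans (sym eq) (trans (*-congˡ ∑≈0) (zeroʳ _))))

  open MatroidRank G using (χ≡0⇒invalid; χ≢0⇒valid)

  -- Coordinate vectors of a row space tuple cannot be valid when χ vanishes; the element they miss
  -- gives a factor s(0).
  χ≡0⇒weight≈0 : χ G (+ (2 ℕ.^ m)) ≡ + 0 → ∀ ds → weight ds ≈ 0#
  χ≡0⇒weight≈0 χ≡0 ds with inC ds in rows
  ... | false = zeroˡ _
  ... | true with rowCoordinates G ds rows
  ...   | xs , xs∈ , eq = trans (*-identityˡ _)
          (let e , miss = allᵇ-false⁻ {f = λ e → not (allV (λ x → not (rowComb G x e)) xs)} (χ≡0⇒invalid m χ≡0 xs∈)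
               missed = ≡.trans (≡.sym (eq e)) (Bool.not-injective miss)
           in ∏-factor-0 e (trans (reflexive (≡.cong (s ζ) (misses⇒height≡0 ds e missed))) (s₀≈0 ζ-odd)))

  rootSum≉0⇔χ≢0 : (¬ rootSum K (2 ℕ.* m ℕ.+ 2) ζ (Tcard m G) ≈ 0#) ⇔ (¬ χ G (+ (2 ℕ.^ m)) ≡ + 0)
  rootSum≉0⇔χ≢0 = mk⇔
    (λ sum≉0 χ≡0 → sum≉0 (trans rootSum-weights (∑-zero (tuples (allFuns n) m) (χ≡0⇒weight≈0 χ≡0))))
    (λ χ≢0 sum≈0 →
      let xs , xs∈ , xs-valid = χ≢0⇒valid m χ≢0
          ds , ds∈ , rows , eq = rowCombinations G xs∈
          hits = allᵇ⁺ (λ e → ≡.trans (≡.cong not (≡.sym (eq e))) (allᵇ⁻ xs-valid e))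
      in covering⇒∑≉0 (tuples (allFuns n) m) ds∈ (≡.cong₂ _∧_ rows hits) (trans (sym rootSum-weights) sum≈0))

open import Data.Nat using (_*_; _+_; _^_)

theorem5p6 : {c ℓ : Level} (K : CommutativeRing c ℓ) →
    IsIntegralDomain K → CharZero K →
    (m : ℕ) → 2 ≤ m → (ζ : CommutativeRing.Carrier K) →
    IsPrimitiveRoot K (2 * m + 2) ζ →
    {p n : ℕ} (G : Matrix p n) →
    (¬ CommutativeRing._≈_ K (rootSum K (2 * m + 2) ζ (Tcard m G)) (CommutativeRing.0# K))
    ⇔ (¬ χ G (+ (2 ^ m)) ≡ + 0)
theorem5p6 K domain charZero m 2≤m ζ prim G =
  RootSum.rootSum≉0⇔χ≢0 K domain charZero m ζ prim (ℕ.<⇒≤ 2≤m) G
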